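{- Let $G$ be a finite simple graph with spectral radius $\lambda(G)$ and clique number $\omega(G)=\omega\geq 2$. For each edge $e\in E(G)$, let $c(e)$ be the order of the largest clique of $G$ containing $e$. Then $$\lambda(G) \leq \sqrt{2 \sum_{e\in E(G)} \frac{c(e) - 1}{c(e)}}.$$ Moreover, equality holds if and only if, possibly up to the presence of some isolated vertices, $G$ is a complete bipartite graph (when $\omega = 2$) or a complete regular $\omega$-partite graph (when $\omega \geq 3$).
   Context: The spectral radius $\lambda(G)$ of a graph $G$ is the largest eigenvalue of its adjacency matrix $A(G)$. The clique number $\omega(G)$ is the maximum order of a complete subgraph of $G$. A complete regular $\omega$-partite graph is a complete $\omega$-partite graph that is regular, i.e. whose $\omega$ (nonempty) vertex classes all have the same size. "Possibly with some isolated vertices" means that $G$ may be the disjoint union of such a graph with any number (including zero) of isolated vertices. -}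

module Defs where

open import Level using (0ℓ)
open import Data.Bool.Base using (if_then_else_)
open import Data.Nat.Base as ℕ using (ℕ; zero; suc)
import Data.Nat.Properties as ℕ
import Data.Nat.Coprimality as ℕ
open import Data.Integer.Base as ℤ using (+_; -[1+_]; +≤+; -≤+)
import Data.Integer.Properties as ℤ
open import Data.Rational.Base as ℚ
  using (ℚ; mkℚ; 0ℚ; 1ℚ; ½; *≤*; positive; nonNegative)
import Data.Rational.Properties as ℚ
import Data.Rational.Unnormalised.Base as ℚᵘ
import Data.Rational.Unnormalised.Properties as ℚᵘ
open import Data.Rational.Solver using (module +-*-Solver)
open import Data.Fin.Base as Fin using (Fin)
import Data.Fin.Properties as Fin
open import Data.Fin.Subset using (Subset; inside; outside; _∈_; ∣_∣; Nonempty)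
open import Data.Fin.Subset.Properties using (_∈?_)
open import Data.Vec.Base using ([]; _∷_)
open import Data.Vec.Functional using (Vector; foldr)
open import Data.List.Base as List using (List; allFin; cartesianProduct; filter; _++_)
open import Data.List.Extrema ℕ.≤-totalOrder using (max)
open import Data.Product.Base using (∃-syntax; _×_; _,_)
open import Data.Sum.Base using (inj₁; inj₂)
open import Function.Bundles using (_⇔_)
open import Relation.Nullary using (¬_; Dec; does; yes; no)
open import Relation.Nullary.Decidable using (_×-dec_; _→-dec_; ¬?)
open import Relation.Binary.Core using (Rel)
open import Relation.Binary.Definitions using (Decidable; Symmetric; Irreflexive)
open import Relation.Binary.PropositionalEquality

module ℚ-Lemmas where
  open import Data.Rational.Base using (_+_; _*_; _-_; -_; _≤_; _<_)
  open ℚ.≤-Reasoning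
  open +-*-Solver

  ∣·∣≤ : ∀ {x b} → x ≤ b → - x ≤ b → ℚ.∣ x ∣ ≤ b
  ∣·∣≤ {x} x≤b -x≤b with ℚ.∣p∣≡p∨∣p∣≡-p x
  ... | inj₁ eq = subst (_≤ _) (sym eq) x≤b
  ... | inj₂ eq = subst (_≤ _) (sym eq) -x≤b

  ∣-∣-within : ∀ {a b x y} → a ≤ x → x ≤ a + b → a ≤ y → y ≤ a + b →
               ℚ.∣ x - y ∣ ≤ b
  ∣-∣-within {a} {b} {x} {y} a≤x x≤ a≤y y≤ = ∣·∣≤ (gap x≤ a≤y) (begin
      - (x - y)  ≡⟨ solve 2 (λ x y → :- (x :- y) := y :- x) refl x y ⟩
      y - x      ≤⟨ gap y≤ a≤x ⟩
      b          ∎)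
    where
    gap : ∀ {u v} → u ≤ a + b → a ≤ v → u - v ≤ b
    gap {u} {v} u≤ a≤v = begin
      u - v        ≤⟨ ℚ.+-mono-≤ u≤ (ℚ.neg-antimono-≤ a≤v) ⟩
      (a + b) - a  ≡⟨ solve 2 (λ a b → (a :+ b) :- a := b) refl a b ⟩
      b            ∎

  half-pos : ∀ {ε} → 0ℚ < ε → 0ℚ < ½ * ε
  half-pos {ε} 0<ε =
    ℚ.positive⁻¹ (½ * ε) {{ℚ.pos*pos⇒pos ½ ε {{positive 0<ε}}}}

  half+half : ∀ ε → ½ * ε + ½ * ε ≡ ε
  half+half ε = begin-equality
    ½ * ε + ½ * ε  ≡⟨ ℚ.*-distribʳ-+ ε ½ ½ ⟨
    (½ + ½) * ε    ≡⟨ ℚ.*-identityˡ ε ⟩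
    ε              ∎

  divide : ∀ {b ε} → 0ℚ < b → 0ℚ < ε → ∃[ δ ] (0ℚ < δ × b * δ ≡ ε)
  divide {b} {ε} 0<b 0<ε = δ , ℚ.positive⁻¹ δ {{pos}} , (begin-equality
      b * (1/b * ε)  ≡⟨ ℚ.*-assoc b 1/b ε ⟨
      b * 1/b * ε    ≡⟨ cong (_* ε) (ℚ.*-inverseʳ b {{nz}}) ⟩
      1ℚ * ε         ≡⟨ ℚ.*-identityˡ ε ⟩
      ε              ∎)
    where
    nz = ℚ.pos⇒nonZero b {{positive 0<b}}
    1/b = (ℚ.1/ b) {{nz}}
    δ = 1/b * ε
    pos = ℚ.pos*pos⇒pos 1/b {{ℚ.1/pos⇒pos b {{positive 0<b}}}} ε {{positive 0<ε}}

  fromℕ : ℕ → ℚ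
  fromℕ k = mkℚ (+ k) 0 (ℕ.sym (ℕ.1-coprimeTo k))

  fromℕ-suc : ∀ k → fromℕ (suc k) ≡ 1ℚ + fromℕ k
  fromℕ-suc k = ℚ.toℚᵘ-injective (ℚᵘ.≃-trans
    (ℚᵘ.*≡* (cong (λ j → (+ 1 ℤ.+ j) ℤ.* + 1) (sym (ℤ.*-identityʳ (+ k)))))
    (ℚᵘ.≃-sym (ℚ.toℚᵘ-homo-+ 1ℚ (fromℕ k))))

  ≤fromℕ : ∀ q → ∃[ k ] q ≤ fromℕ k
  ≤fromℕ (mkℚ (+ n) d c) = n , *≤* (ℤ.*-monoˡ-≤-nonNeg (+ n) (+≤+ (ℕ.s≤s ℕ.z≤n)))
  ≤fromℕ (mkℚ -[1+ n ] d c) = 0 , *≤* -≤+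

  halve-multiple : ∀ k {w ε} → 0ℚ < ε → w ≤ fromℕ (2 ℕ.+ k) * ε →
                   ½ * w ≤ fromℕ (suc k) * ε
  halve-multiple k {w} {ε} 0<ε w≤ = begin
    ½ * w                  ≤⟨ ℚ.*-monoˡ-≤-nonNeg ½ w≤2aε ⟩
    ½ * (a * ε + a * ε)    ≡⟨ ℚ.*-distribˡ-+ ½ (a * ε) (a * ε) ⟩
    ½ * (a * ε) + ½ * (a * ε) ≡⟨ half+half (a * ε) ⟩
    a * ε                  ∎
    where
    a = fromℕ (suc k)

    1≤a : 1ℚ ≤ a
    1≤a = *≤* (ℤ.*-monoʳ-≤-nonNeg (+ 1) (+≤+ (ℕ.s≤s (ℕ.z≤n {k}))))

    w≤2aε : w ≤ a * ε + a * ε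
    w≤2aε = begin
      w                    ≤⟨ w≤ ⟩
      fromℕ (2 ℕ.+ k) * ε  ≡⟨ cong (_* ε) (fromℕ-suc (suc k)) ⟩
      (1ℚ + a) * ε         ≤⟨ ℚ.*-monoʳ-≤-nonNeg ε {{nonNegative (ℚ.<⇒≤ 0<ε)}}
                                (ℚ.+-monoˡ-≤ a 1≤a) ⟩
      (a + a) * ε          ≡⟨ ℚ.*-distribʳ-+ ε a a ⟩
      a * ε + a * ε        ∎

  archimedean : ∀ q {ε} → 0ℚ < ε → ∃[ k ] q ≤ fromℕ k * ε
  archimedean q {ε} 0<ε with divide 0<ε (ℚ.positive⁻¹ 1ℚ)
  ... | δ , _ , εδ≡1 with ≤fromℕ (q * δ)
  ... | k , qδ≤k = k , (begin
    q            ≡⟨ ℚ.*-identityʳ q ⟨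
    q * 1ℚ       ≡⟨ cong (q *_) εδ≡1 ⟨
    q * (ε * δ)  ≡⟨ solve 3 (λ q e d → q :* (e :* d) := (q :* d) :* e) refl q ε δ ⟩
    q * δ * ε    ≤⟨ ℚ.*-monoʳ-≤-nonNeg ε {{ℚ.pos⇒nonNeg ε {{positive 0<ε}}}} qδ≤k ⟩
    fromℕ k * ε  ∎)

open ℚ-Lemmas

-- Real numbers: Cauchy sequences of rationals, compared up to null
-- sequences (_≃_ is the equality of real numbers)

Cauchy : (ℕ → ℚ) → Set
Cauchy f = ∀ ε → 0ℚ ℚ.< ε →
  ∃[ N ] (∀ m n → N ℕ.≤ m → N ℕ.≤ n → ℚ.∣ f m ℚ.- f n ∣ ℚ.≤ ε)

record ℝ : Set where
  constructor mkℝ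
  field
    seq    : ℕ → ℚ
    cauchy : Cauchy seq

open ℝ public

infix  4 _≃_ _≤_
infixl 6 _+_
infixl 7 _*_

-- Wrapped as records so that Agda can infer x and y from x ≃ y and x ≤ y.
record _≃_ (x y : ℝ) : Set where
  constructor mk≃
  field
    null : ∀ ε → 0ℚ ℚ.< ε →
      ∃[ N ] (∀ n → N ℕ.≤ n → ℚ.∣ seq x n ℚ.- seq y n ∣ ℚ.≤ ε)

record _≤_ (x y : ℝ) : Set where
  constructor mk≤
  field
    below : ∀ ε → 0ℚ ℚ.< ε →
      ∃[ N ] (∀ n → N ℕ.≤ n → seq x n ℚ.≤ seq y n ℚ.+ ε)

fromℚ : ℚ → ℝ
fromℚ q = mkℝ (λ _ → q) λ ε 0<ε → 0 , λ _ _ _ _ →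
  subst (λ r → ℚ.∣ r ∣ ℚ.≤ ε) (sym (ℚ.+-inverseʳ q)) (ℚ.<⇒≤ 0<ε)

0ℝ 1ℝ : ℝ
0ℝ = fromℚ 0ℚ
1ℝ = fromℚ 1ℚ

module _ where
  open ℚ.≤-Reasoning
  open +-*-Solver

  +-cauchy : ∀ {f g} → Cauchy f → Cauchy g → Cauchy (λ n → f n ℚ.+ g n)
  +-cauchy {f} {g} cf cg ε 0<ε
    with cf (½ ℚ.* ε) (half-pos 0<ε) | cg (½ ℚ.* ε) (half-pos 0<ε)
  ... | M , hf | N , hg = M ℕ.⊔ N , λ m n m≥ n≥ → begin
    ℚ.∣ (f m ℚ.+ g m) ℚ.- (f n ℚ.+ g n) ∣
      ≡⟨ cong ℚ.∣_∣ (solve 4 (λ a b c d →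
           (a :+ b) :- (c :+ d) := (a :- c) :+ (b :- d)) refl (f m) (g m) (f n) (g n)) ⟩
    ℚ.∣ (f m ℚ.- f n) ℚ.+ (g m ℚ.- g n) ∣
      ≤⟨ ℚ.∣p+q∣≤∣p∣+∣q∣ (f m ℚ.- f n) (g m ℚ.- g n) ⟩
    ℚ.∣ f m ℚ.- f n ∣ ℚ.+ ℚ.∣ g m ℚ.- g n ∣
      ≤⟨ ℚ.+-mono-≤ (hf m n (ℕ.m⊔n≤o⇒m≤o M N m≥) (ℕ.m⊔n≤o⇒m≤o M N n≥))
                    (hg m n (ℕ.m⊔n≤o⇒n≤o M N m≥) (ℕ.m⊔n≤o⇒n≤o M N n≥)) ⟩
    ½ ℚ.* ε ℚ.+ ½ ℚ.* ε
      ≡⟨ half+half ε ⟩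
    ε ∎

  bounded : ∀ {f} → Cauchy f → ∃[ B ] (∀ n → ℚ.∣ f n ∣ ℚ.≤ B)
  bounded {f} cf with cf 1ℚ (ℚ.positive⁻¹ 1ℚ)
  ... | N , h = B N ℚ.+ 1ℚ , bound
    where
    B : ℕ → ℚ
    B zero    = ℚ.∣ f 0 ∣
    B (suc k) = B k ℚ.⊔ ℚ.∣ f (suc k) ∣

    last≤ : ∀ k → ℚ.∣ f k ∣ ℚ.≤ B k
    last≤ zero    = ℚ.≤-refl
    last≤ (suc k) = ℚ.p≤q⊔p (B k) _

    ≤B : ∀ {m k} → m ℕ.≤′ k → ℚ.∣ f m ∣ ℚ.≤ B k
    ≤B {m} (ℕ.≤′-reflexive refl) = last≤ m
    ≤B (ℕ.≤′-step {k} m≤k) = ℚ.≤-trans (≤B m≤k) (ℚ.p≤p⊔q (B k) _)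

    bound : ∀ n → ℚ.∣ f n ∣ ℚ.≤ B N ℚ.+ 1ℚ
    bound n with ℕ.≤-total n N
    ... | inj₁ n≤N = begin
      ℚ.∣ f n ∣      ≡⟨ ℚ.+-identityʳ _ ⟨
      ℚ.∣ f n ∣ ℚ.+ 0ℚ ≤⟨ ℚ.+-mono-≤ (≤B (ℕ.≤⇒≤′ n≤N)) (ℚ.<⇒≤ (ℚ.positive⁻¹ 1ℚ)) ⟩
      B N ℚ.+ 1ℚ     ∎
    ... | inj₂ N≤n = begin
      ℚ.∣ f n ∣
        ≡⟨ cong ℚ.∣_∣ (solve 2 (λ a b → a := b :+ (a :- b)) refl (f n) (f N)) ⟩
      ℚ.∣ f N ℚ.+ (f n ℚ.- f N) ∣
        ≤⟨ ℚ.∣p+q∣≤∣p∣+∣q∣ (f N) (f n ℚ.- f N) ⟩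
      ℚ.∣ f N ∣ ℚ.+ ℚ.∣ f n ℚ.- f N ∣
        ≤⟨ ℚ.+-mono-≤ (last≤ N) (h n N N≤n ℕ.≤-refl) ⟩
      B N ℚ.+ 1ℚ ∎

  ∣*∣-mono : ∀ x y {b d} → ℚ.∣ x ∣ ℚ.≤ b → ℚ.∣ y ∣ ℚ.≤ d → ℚ.∣ x ℚ.* y ∣ ℚ.≤ b ℚ.* d
  ∣*∣-mono x y {b} {d} x≤b y≤d = begin
    ℚ.∣ x ℚ.* y ∣          ≡⟨ ℚ.∣p*q∣≡∣p∣*∣q∣ x y ⟩
    ℚ.∣ x ∣ ℚ.* ℚ.∣ y ∣    ≤⟨ ℚ.*-monoʳ-≤-nonNeg ℚ.∣ y ∣ {{ℚ.∣-∣-nonNeg y}} x≤b ⟩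
    b ℚ.* ℚ.∣ y ∣          ≤⟨ ℚ.*-monoˡ-≤-nonNeg b
                                {{nonNegative (ℚ.≤-trans (ℚ.0≤∣p∣ x) x≤b)}} y≤d ⟩
    b ℚ.* d                ∎

  ∣*-*∣ : ∀ a b c d {A B δ} → ℚ.∣ a ∣ ℚ.≤ A → ℚ.∣ d ∣ ℚ.≤ B →
          ℚ.∣ a ℚ.- c ∣ ℚ.≤ δ → ℚ.∣ b ℚ.- d ∣ ℚ.≤ δ →
          ℚ.∣ a ℚ.* b ℚ.- c ℚ.* d ∣ ℚ.≤ (A ℚ.+ B) ℚ.* δ
  ∣*-*∣ a b c d {A} {B} {δ} a≤A d≤B ac≤δ bd≤δ = begin
    ℚ.∣ a ℚ.* b ℚ.- c ℚ.* d ∣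
      ≡⟨ cong ℚ.∣_∣ (solve 4 (λ a b c d →
           a :* b :- c :* d := a :* (b :- d) :+ d :* (a :- c)) refl a b c d) ⟩
    ℚ.∣ a ℚ.* (b ℚ.- d) ℚ.+ d ℚ.* (a ℚ.- c) ∣
      ≤⟨ ℚ.∣p+q∣≤∣p∣+∣q∣ (a ℚ.* (b ℚ.- d)) (d ℚ.* (a ℚ.- c)) ⟩
    ℚ.∣ a ℚ.* (b ℚ.- d) ∣ ℚ.+ ℚ.∣ d ℚ.* (a ℚ.- c) ∣
      ≤⟨ ℚ.+-mono-≤ (∣*∣-mono a (b ℚ.- d) a≤A bd≤δ) (∣*∣-mono d (a ℚ.- c) d≤B ac≤δ) ⟩
    A ℚ.* δ ℚ.+ B ℚ.* δ
      ≡⟨ ℚ.*-distribʳ-+ δ A B ⟨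
    (A ℚ.+ B) ℚ.* δ ∎

  *-cauchy : ∀ {f g} → Cauchy f → Cauchy g → Cauchy (λ n → f n ℚ.* g n)
  *-cauchy {f} {g} cf cg ε 0<ε =
    let (A , f≤A)        = bounded cf
        (B , g≤B)        = bounded cg
        0≤A              = ℚ.≤-trans (ℚ.0≤∣p∣ (f 0)) (f≤A 0)
        0<B+1            = ℚ.+-mono-≤-< (ℚ.≤-trans (ℚ.0≤∣p∣ (g 0)) (g≤B 0)) (ℚ.positive⁻¹ 1ℚ)
        g≤B+1            = λ n → ℚ.≤-trans (g≤B n) (ℚ.≤-trans
                             (ℚ.≤-reflexive (sym (ℚ.+-identityʳ B)))
                             (ℚ.+-monoʳ-≤ B (ℚ.<⇒≤ (ℚ.positive⁻¹ 1ℚ))))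
        (δ , 0<δ , Cδ≡ε) = divide {A ℚ.+ (B ℚ.+ 1ℚ)} (ℚ.+-mono-≤-< 0≤A 0<B+1) 0<ε
        (M , hf)         = cf δ 0<δ
        (N , hg)         = cg δ 0<δ
    in M ℕ.⊔ N , λ m n m≥ n≥ → ℚ.≤-trans
         (∣*-*∣ (f m) (g m) (f n) (g n) (f≤A m) (g≤B+1 n)
           (hf m n (ℕ.m⊔n≤o⇒m≤o M N m≥) (ℕ.m⊔n≤o⇒m≤o M N n≥))
           (hg m n (ℕ.m⊔n≤o⇒n≤o M N m≥) (ℕ.m⊔n≤o⇒n≤o M N n≥)))
         (ℚ.≤-reflexive Cδ≡ε)

_+_ _*_ : ℝ → ℝ → ℝ
x + y = mkℝ (λ n → seq x n ℚ.+ seq y n) (+-cauchy {seq x} {seq y} (cauchy x) (cauchy y))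
x * y = mkℝ (λ n → seq x n ℚ.* seq y n) (*-cauchy {seq x} {seq y} (cauchy x) (cauchy y))

-- Square roots of rationals, by bisection: for q ≥ 0 the n-th interval
-- [ √-lower q n , √-lower q n + √-width q n ] contains √ q, since
-- 0 ≤ q ≤ (∣ q ∣ + 1)².  (For q < 0 the result is the junk value 0.)

√-width : ℚ → ℕ → ℚ
√-width q zero    = ℚ.∣ q ∣ ℚ.+ 1ℚ
√-width q (suc n) = ½ ℚ.* √-width q n

√-lower : ℚ → ℕ → ℚ
√-lower q zero    = 0ℚ
√-lower q (suc n) with (√-lower q n ℚ.+ √-width q (suc n)) ℚ.* (√-lower q n ℚ.+ √-width q (suc n)) ℚ.≤? q
... | yes _ = √-lower q n ℚ.+ √-width q (suc n)
... | no  _ = √-lower q n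

module _ (q : ℚ) where
  open ℚ.≤-Reasoning
  open +-*-Solver

  private
    lo w : ℕ → ℚ
    lo = √-lower q
    w  = √-width q

  √-width-pos : ∀ n → 0ℚ ℚ.< w n
  √-width-pos zero    = ℚ.+-mono-≤-< (ℚ.0≤∣p∣ q) (ℚ.positive⁻¹ 1ℚ)
  √-width-pos (suc n) = half-pos (√-width-pos n)

  ≤+w : ∀ x n → x ℚ.≤ x ℚ.+ w n
  ≤+w x n = begin
    x           ≡⟨ ℚ.+-identityʳ x ⟨
    x ℚ.+ 0ℚ    ≤⟨ ℚ.+-monoʳ-≤ x (ℚ.<⇒≤ (√-width-pos n)) ⟩
    x ℚ.+ w n   ∎

  halves : ∀ x n → (x ℚ.+ w (suc n)) ℚ.+ w (suc n) ≡ x ℚ.+ w n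
  halves x n = trans (ℚ.+-assoc x _ _) (cong (x ℚ.+_) (half+half (w n)))

  √-step : ∀ n → lo n ℚ.≤ lo (suc n) ×
                 lo (suc n) ℚ.+ w (suc n) ℚ.≤ lo n ℚ.+ w n
  √-step n with (lo n ℚ.+ w (suc n)) ℚ.* (lo n ℚ.+ w (suc n)) ℚ.≤? q
  ... | yes _ = ≤+w (lo n) (suc n) , ℚ.≤-reflexive (halves (lo n) n)
  ... | no  _ = ℚ.≤-refl ,
    ℚ.≤-trans (≤+w (lo n ℚ.+ w (suc n)) (suc n)) (ℚ.≤-reflexive (halves (lo n) n))

  √-nested : ∀ {N n} → N ℕ.≤′ n →
             lo N ℚ.≤ lo n × lo n ℚ.+ w n ℚ.≤ lo N ℚ.+ w N
  √-nested (ℕ.≤′-reflexive refl) = ℚ.≤-refl , ℚ.≤-refl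
  √-nested (ℕ.≤′-step {n} N≤n) with √-nested N≤n | √-step n
  ... | l , u | l′ , u′ = ℚ.≤-trans l l′ , ℚ.≤-trans u′ u

  √-width-shrinks : ∀ {ε} → 0ℚ ℚ.< ε → ∀ k n → w n ℚ.≤ fromℕ k ℚ.* ε →
                    ∃[ N ] w N ℚ.≤ ε
  √-width-shrinks {ε} 0<ε zero n w≤ = n , ℚ.≤-trans w≤
    (ℚ.≤-trans (ℚ.≤-reflexive (ℚ.*-zeroˡ ε)) (ℚ.<⇒≤ 0<ε))
  √-width-shrinks {ε} 0<ε (suc zero) n w≤ = n ,
    ℚ.≤-trans w≤ (ℚ.≤-reflexive (ℚ.*-identityˡ ε))
  √-width-shrinks {ε} 0<ε (suc (suc k)) n w≤ =
    √-width-shrinks 0<ε (suc k) (suc n) (halve-multiple k {w n} {ε} 0<ε w≤)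

  √-width-small : ∀ {ε} → 0ℚ ℚ.< ε → ∃[ N ] w N ℚ.≤ ε
  √-width-small 0<ε =
    let (k , w≤) = archimedean (w 0) 0<ε in √-width-shrinks 0<ε k 0 w≤

  √-lower-near : ∀ {N n} → N ℕ.≤ n → lo N ℚ.≤ lo n × lo n ℚ.≤ lo N ℚ.+ w N
  √-lower-near {N} {n} N≤n =
    let (l , u) = √-nested {N} {n} (ℕ.≤⇒≤′ N≤n)
    in l , ℚ.≤-trans {lo n} {lo n ℚ.+ w n} (≤+w (lo n) n) u

  √-close : ∀ {N m n} → N ℕ.≤ m → N ℕ.≤ n → ℚ.∣ lo m ℚ.- lo n ∣ ℚ.≤ w N
  √-close {N} {m} {n} N≤m N≤n =
    let (lm , um) = √-lower-near {N} {m} N≤m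
        (ln , un) = √-lower-near {N} {n} N≤n
    in ∣-∣-within {lo N} {w N} {lo m} {lo n} lm um ln un

  √-cauchy : Cauchy (√-lower q)
  √-cauchy ε 0<ε =
    let (N , wN≤ε) = √-width-small {ε} 0<ε in N , λ m n N≤m N≤n →
      ℚ.≤-trans {ℚ.∣ lo m ℚ.- lo n ∣} {w N} {ε} (√-close {N} {m} {n} N≤m N≤n) wN≤ε

√ : ℚ → ℝ
√ q = mkℝ (√-lower q) (√-cauchy q)

Matrix : ℕ → Set
Matrix n = Fin n → Fin n → ℝ

_·_ : ∀ {n} → Matrix n → Vector ℝ n → Vector ℝ n
(A · x) i = foldr _+_ 0ℝ (λ j → A i j * x j)

-- A real matrix with a real eigenvalue has a real eigenvector for it, and the
-- eigenvalues of the symmetric matrices considered here are all real.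
IsEigenvalue : ∀ {n} → Matrix n → ℝ → Set
IsEigenvalue A μ = ∃[ x ] (¬ (∀ i → x i ≃ 0ℝ) × (∀ i → (A · x) i ≃ μ * x i))

IsLargestEigenvalue : ∀ {n} → Matrix n → ℝ → Set
IsLargestEigenvalue A lam = IsEigenvalue A lam × (∀ μ → IsEigenvalue A μ → μ ≤ lam)

record Graph (n : ℕ) : Set₁ where
  field
    Adj        : Rel (Fin n) 0ℓ
    adj?       : Decidable Adj
    adj-sym    : Symmetric Adj
    adj-irrefl : Irreflexive _≡_ Adj

allSubsets : ∀ n → List (Subset n)
allSubsets zero    = List.[ [] ]
allSubsets (suc n) = List.map (inside ∷_) (allSubsets n) ++ List.map (outside ∷_) (allSubsets n)

-- (k - 1) / k; the value at 0 is irrelevant, as c(e) ≥ 2 for every edge e.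
weight : ℕ → ℚ
weight zero    = 0ℚ
weight (suc k) = + k ℚ./ suc k

module _ {n : ℕ} (G : Graph n) where
  open Graph G

  adjacencyMatrix : Matrix n
  adjacencyMatrix u v = if does (adj? u v) then 1ℝ else 0ℝ

  IsSpectralRadius : ℝ → Set
  IsSpectralRadius = IsLargestEigenvalue adjacencyMatrix

  IsClique : Subset n → Set
  IsClique S = ∀ u v → u ∈ S → v ∈ S → u ≢ v → Adj u v

  isClique? : ∀ S → Dec (IsClique S)
  isClique? S = Fin.all? λ u → Fin.all? λ v →
    (u ∈? S) →-dec (v ∈? S) →-dec ¬? (u Fin.≟ v) →-dec adj? u v

  cliques : List (Subset n)
  cliques = filter isClique? (allSubsets n)

  ω : ℕ
  ω = max 0 (List.map ∣_∣ cliques)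

  -- For the edge e = uv this is c(e).
  c : Fin n → Fin n → ℕ
  c u v = max 0 (List.map ∣_∣ (filter (λ S → (u ∈? S) ×-dec (v ∈? S)) cliques))

  -- Each edge is listed once, as the pair of its endpoints in increasing order.
  edges : List (Fin n × Fin n)
  edges = filter (λ (u , v) → (u Fin.<? v) ×-dec adj? u v)
                 (cartesianProduct (allFin n) (allFin n))

  edgeSum : ℚ
  edgeSum = List.foldr ℚ._+_ 0ℚ (List.map (λ (u , v) → weight (c u v)) edges)

  -- G is the disjoint union of a complete k-partite graph (with nonempty
  -- vertex classes) and isolated vertices, the latter being exactly the
  -- vertices that lie in no class.
  record IsCompletePartite+Isolated (k : ℕ) (class : Fin k → Subset n) : Set where
    field
      nonempty : ∀ i → Nonempty (class i)
      disjoint : ∀ {i j v} → v ∈ class i → v ∈ class j → i ≡ j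
      adjacent : ∀ u v → Adj u v ⇔ (∃[ i ] ∃[ j ] (i ≢ j × u ∈ class i × v ∈ class j))

  CompleteBipartite+Isolated : Set
  CompleteBipartite+Isolated = ∃[ class ] IsCompletePartite+Isolated 2 class

  CompleteRegularPartite+Isolated : ℕ → Set
  CompleteRegularPartite+Isolated k =
    ∃[ class ] (IsCompletePartite+Isolated k class × (∀ i j → ∣ class i ∣ ≡ ∣ class j ∣))

{-# OPTIONS --safe #-}
module Submission where

-- Let x be an eigenvector for λ, and put y_v = x_v², N = Σ y, W = 2 Σ_e w(e) with
-- w = (c - 1)/c, and g = 1/w on edges.  Cauchy–Schwarz gives
-- (λ N)² = (Σ_{u ~ v} x_u x_v)² ≤ W Σ g_uv y_u y_v, and λ² ≤ W follows from the local
-- Motzkin–Straus inequality: Q(y) = N² - Σ g_uv y_u y_v is nonnegative for y ≥ 0.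
-- Indeed Q is affine along the transfer of weight between two nonadjacent vertices, so
-- the support of y may be shrunk to a clique S, and there c(e) ≥ |S| for every edge.
--
-- If λ² = W, then Q(y) = 0, and x_u x_v is proportional to w_uv on edges, so x vanishes
-- only on isolated vertices.  For nonadjacent u, v and any z, none of them isolated,
-- Q is nonnegative in the direction d = e_u - e_v - r e_z; but Q(d) = - r² for
-- r = g_vz - g_uz.  Hence g_uz = g_vz: nonadjacency is transitive and the
-- nonisolated part is complete multipartite.  If ω ≥ 3, common neighbours show that x is
-- constant there, so the degrees agree.  Conversely the extremal graphs have an explicit
-- eigenvector whose eigenvalue is at least √W.
--
-- The order of the reals is only ¬¬-stable, but every conclusion drawn from a case
-- distinction on reals is itself stable or decidable.

-- Writing g = 1 - h turns the estimate on Σ g_uv y_u y_v into copositivity of one rational matrix: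
-- `h` is 1 on nonadjacent pairs, the diagonal included, and -1/(c - 1) on edges. The value 1 makes
-- Q vanish at e_u - e_v for nonadjacent u, v, hence the affine behaviour. The value -1/(k - 1) is
-- the threshold on a clique of order k: if c = k on all its edges, then (k - 1) Q is the sum of
-- (y_u - y_v)² over its pairs of vertices.
--
-- The vector x may have entries of either sign. The form sees only y, while the equality condition
-- g_uv W x_u x_v = λ N on edges keeps the signs, which is what makes x constant and not only x².
--
-- The obstacle is that neither the support of a real vector nor the sign of an entry can be
-- decided. Therefore the shrinking of the support follows a decidable set S that merely contains
-- it, and everything that determines the shape of G stays rational: h_uz = h_vz is an equation in
-- ℚ, from which adjacency is read off.

open import Level using (0ℓ)
open import Algebra.Bundles using (CommutativeRing; RawRing)
import Algebra.Properties.Semiring.Sum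
import Algebra.Solver.Ring as RingSolver
import Algebra.Solver.Ring.AlmostCommutativeRing as ACR
open import Algebra.Structures using (IsCommutativeRing)
open import Data.Bool.Base using (if_then_else_; true; false)
open import Data.Empty using (⊥-elim)
open import Data.Fin.Base as Fin using (Fin)
import Data.Fin.Properties as Fin
open import Data.Fin.Subset using (Subset; inside; outside; _∈_; _∉_; ∣_∣; ⊤; ⁅_⁆; _∪_) renaming (_-_ to _∖_)
open import Data.Fin.Subset.Properties
open import Data.Integer.Base as ℤ using (+_; +≤+)
import Data.Integer.Properties as ℤ
open import Data.List.Base as List using (List)
import Data.List.Membership.Propositional as List
import Data.List.Membership.Propositional.Properties as List
import Data.List.Properties as List
import Data.List.Relation.Unary.All as All
import Data.List.Relation.Unary.All.Properties as All
import Data.List.Relation.Unary.Any as Any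
open import Data.Maybe.Base using (Maybe; just; nothing)
open import Data.Nat.Base as ℕ using (ℕ; zero; suc; z≤n; s≤s)
import Data.Nat.Properties as ℕ
open import Data.List.Extrema ℕ.≤-totalOrder using (max≤v⁺; xs≤max; argmax-sel)
open import Data.Product.Base using (Σ-syntax; ∃-syntax; _×_; _,_; proj₁; proj₂)
open import Data.Rational.Base as ℚ using (ℚ; 0ℚ; 1ℚ; ½; *≤*; nonNegative)
import Data.Rational.Properties as ℚ
open import Data.Rational.Solver using (module +-*-Solver)
import Data.Rational.Unnormalised.Base as ℚᵘ
import Data.Rational.Unnormalised.Properties as ℚᵘ
open import Data.Sum.Base using (_⊎_; inj₁; inj₂; [_,_]′)
open import Data.Vec.Base as Vec using ([]; _∷_; here; there)
open import Data.Vec.Functional using (Vector; foldr)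
import Data.Vec.Properties as Vec
open import Function.Base using (_∘_; id)
open import Function.Bundles using (_⇔_; mk⇔; Equivalence)
open import Relation.Binary.PropositionalEquality as ≡ using (_≡_; _≢_)
open import Relation.Binary.Structures using (IsEquivalence)
open import Relation.Nullary using (¬_; Dec; does; yes; no)
open import Relation.Nullary.Decidable using (_×-dec_; ¬?; decidable-stable; dec-true)
open import Defs using (Graph; IsClique; isClique?; cliques; allSubsets; ω; c; weight; edgeSum;
  IsCompletePartite+Isolated; CompleteBipartite+Isolated; CompleteRegularPartite+Isolated; module ℚ-Lemmas)
open ℚ-Lemmas using (divide; half-pos; half+half; ∣·∣≤; fromℕ; fromℕ-suc)

-- Algebra in ordered rings with a ¬¬-stable order

-- The order laws ≤-stable and ≰⇒≥ replace totality, which fails constructively for ℝ.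
record ArchimedeanRing : Set₁ where
  field
    commutativeRing : CommutativeRing 0ℓ 0ℓ

  open CommutativeRing commutativeRing public

  infix 4 _≤_
  field
    _≤_         : Carrier → Carrier → Set
    ≤-reflexive : ∀ {x y} → x ≈ y → x ≤ y
    ≤-trans     : ∀ {x y z} → x ≤ y → y ≤ z → x ≤ z
    ≤-antisym   : ∀ {x y} → x ≤ y → y ≤ x → x ≈ y
    ≤-stable    : ∀ {x y} → ¬ ¬ (x ≤ y) → x ≤ y
    ≰⇒≥         : ∀ {x y} → ¬ (x ≤ y) → y ≤ x
    +-mono-≤    : ∀ {x y u v} → x ≤ y → u ≤ v → x + u ≤ y + v
    *-nonNeg    : ∀ {x y} → 0# ≤ x → 0# ≤ y → 0# ≤ x * y
    ι           : ℚ → Carrier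
    ι-+         : ∀ p q → ι (p ℚ.+ q) ≈ ι p + ι q
    ι-*         : ∀ p q → ι (p ℚ.* q) ≈ ι p * ι q
    ι-neg       : ∀ p → ι (ℚ.- p) ≈ - ι p
    ι-0         : ι 0ℚ ≈ 0#
    ι-1         : ι 1ℚ ≈ 1#
    ι-mono      : ∀ {p q} → p ℚ.≤ q → ι p ≤ ι q
    ι-injective : ∀ {p q} → ι p ≈ ι q → p ≡ q
    ≤-limit     : ∀ {x y} → (∀ ε → 0ℚ ℚ.< ε → x ≤ y + ι ε) → x ≤ y

module ArchimedeanRingProperties (K : ArchimedeanRing) where
  open ArchimedeanRing K
  import Algebra.Properties.Semiring.Sum semiring as Sum
  open import Relation.Binary.Reasoning.Setoid setoid

  private
    ℚ-rawRing : RawRing 0ℓ 0ℓ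
    ℚ-rawRing = CommutativeRing.rawRing ℚ.+-*-commutativeRing

    acr : ACR.AlmostCommutativeRing 0ℓ 0ℓ
    acr = ACR.fromCommutativeRing commutativeRing

    morphism : ℚ-rawRing ACR.-Raw-AlmostCommutative⟶ acr
    morphism = record
      { ⟦_⟧ = ι ; +-homo = ι-+ ; *-homo = ι-* ; -‿homo = ι-neg ; 0-homo = ι-0 ; 1-homo = ι-1 }

    coeff≟ : ∀ p q → Maybe (ι p ≈ ι q)
    coeff≟ p q with p ℚ.≟ q
    ... | yes p≡q = just (reflexive (≡.cong ι p≡q))
    ... | no  _   = nothing

  -- With coefficients in ℚ the solver evaluates constants `ι q`. This is why `0#` and `1#` are
  -- rewritten as `ι 0ℚ` and `ι 1ℚ` before many of its calls.
  module Solver = RingSolver ℚ-rawRing acr morphism coeff≟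
  open Solver using (solve; _:=_; _:+_; _:*_; :-_; con)

  ι-cong : ∀ {p q} → p ≡ q → ι p ≈ ι q
  ι-cong = reflexive ∘ ≡.cong ι

  ι-0⇒≡0 : ∀ {p} → ι p ≈ 0# → p ≡ 0ℚ
  ι-0⇒≡0 p≈0 = ι-injective (trans p≈0 (sym ι-0))

  ι-nonNeg : ∀ {p} → 0ℚ ℚ.≤ p → 0# ≤ ι p
  ι-nonNeg 0≤p = ≤-trans (≤-reflexive (sym ι-0)) (ι-mono 0≤p)

  ≤-refl : ∀ {x} → x ≤ x
  ≤-refl = ≤-reflexive refl

  ≤-respʳ : ∀ {x y z} → y ≈ z → x ≤ y → x ≤ z
  ≤-respʳ y≈z x≤y = ≤-trans x≤y (≤-reflexive y≈z)

  ≤-respˡ : ∀ {x y z} → x ≈ y → x ≤ z → y ≤ z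
  ≤-respˡ x≈y x≤z = ≤-trans (≤-reflexive (sym x≈y)) x≤z

  ≈-stable : ∀ {x y} → ¬ ¬ (x ≈ y) → x ≈ y
  ≈-stable h = ≤-antisym (≤-stable λ k → h (k ∘ ≤-reflexive))
                         (≤-stable λ k → h (k ∘ ≤-reflexive ∘ sym))

  ≤-cases : ∀ {p} {P : Set p} → (¬ ¬ P → P) → ∀ x y → (x ≤ y → P) → (y ≤ x → P) → P
  ≤-cases stable x y f g = stable λ ¬p → ¬p (g (≰⇒≥ (¬p ∘ f)))

  +-nonNeg : ∀ {x y} → 0# ≤ x → 0# ≤ y → 0# ≤ x + y
  +-nonNeg 0≤x 0≤y = ≤-respˡ (+-identityˡ 0#) (+-mono-≤ 0≤x 0≤y)

  ≤⇒0≤- : ∀ {x y} → x ≤ y → 0# ≤ y - x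
  ≤⇒0≤- {x} x≤y = ≤-respˡ (-‿inverseʳ x) (+-mono-≤ x≤y ≤-refl)

  0≤-⇒≤ : ∀ {x y} → 0# ≤ y - x → x ≤ y
  0≤-⇒≤ {x} {y} h = ≤-respˡ (+-identityˡ x)
    (≤-respʳ (solve 2 (λ x y → (y :+ :- x) :+ x := y) refl x y) (+-mono-≤ h ≤-refl))

  neg-nonNeg : ∀ {x} → x ≤ 0# → 0# ≤ - x
  neg-nonNeg {x} x≤0 = ≤-respʳ (+-identityˡ (- x)) (≤⇒0≤- x≤0)

  nonNeg-neg : ∀ {x} → 0# ≤ - x → x ≤ 0#
  nonNeg-neg {x} 0≤-x = 0≤-⇒≤ (≤-respʳ (sym (+-identityˡ (- x))) 0≤-x)

  -neg : ∀ x → - (- x) ≈ x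
  -neg = solve 1 (λ x → :- (:- x) := x) refl

  -0≈0 : - 0# ≈ 0#
  -0≈0 = trans (-‿cong (sym ι-0)) (trans (sym (ι-neg 0ℚ)) ι-0)

  square-nonNeg : ∀ x → 0# ≤ x * x
  square-nonNeg x = ≤-cases ≤-stable 0# x (λ h → *-nonNeg h h)
    (λ h → ≤-respʳ (solve 1 (λ x → :- x :* :- x := x :* x) refl x)
             (*-nonNeg (neg-nonNeg h) (neg-nonNeg h)))

  -- A rational lower bound δ has an inverse γ, which an element x of the ring need not have. For y
  -- ≥ 0 the product γ (x - δ) y is nonnegative and equals -y when x y = 0; negative y reduce to
  -- this case.
  *-cancelˡ-≥ι : ∀ {x y δ} → 0ℚ ℚ.< δ → ι δ ≤ x → x * y ≈ 0# → y ≈ 0#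
  *-cancelˡ-≥ι {x} {y} {δ} 0<δ δ≤x xy≈0 = ≤-cases ≈-stable 0# y
    (λ 0≤y → ≤-antisym (≤0 xy≈0 0≤y) 0≤y)
    (λ y≤0 → ≤-antisym y≤0 (≤-respʳ (-neg y) (neg-nonNeg (≤0
      (trans (solve 2 (λ x y → x :* :- y := :- (x :* y)) refl x y)
             (trans (-‿cong xy≈0) -0≈0))
      (neg-nonNeg y≤0)))))
    where
    ≤0 : ∀ {y} → x * y ≈ 0# → 0# ≤ y → y ≤ 0#
    ≤0 {y} xy≈0 0≤y = let (γ , 0<γ , δγ≡1) = divide 0<δ (ℚ.positive⁻¹ 1ℚ) in
      nonNeg-neg (≤-respʳ (begin
        ι γ * ((x - ι δ) * y)          ≈⟨ solve 4 (λ g d x y → g :* ((x :+ :- d) :* y)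
                                            := g :* (x :* y) :+ :- (d :* g :* y)) refl (ι γ) (ι δ) x y ⟩
        ι γ * (x * y) - ι δ * ι γ * y  ≈⟨ +-cong (trans (*-congˡ xy≈0) (zeroʳ _)) (-‿cong (*-congʳ
                                            (trans (sym (ι-* δ γ)) (ι-cong δγ≡1)))) ⟩
        0# - ι 1ℚ * y                  ≈⟨ +-identityˡ _ ⟩
        - (ι 1ℚ * y)                   ≈⟨ solve 1 (λ y → :- (con 1ℚ :* y) := :- y) refl y ⟩
        - y                            ∎)
        (*-nonNeg (ι-nonNeg (ℚ.<⇒≤ 0<γ)) (*-nonNeg (≤⇒0≤- δ≤x) 0≤y)))

  -- From x ≉ 0 alone no positive lower bound on ±x can be extracted. The argument is therefore
  -- indirect: if y ≉ 0, then by `*-cancelˡ-≥ι` neither x nor -x can exceed a positive rational, and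
  -- `≤-limit` forces x ≈ 0.
  zeroDivisorFree : ∀ {x y} → ¬ (x ≈ 0#) → x * y ≈ 0# → y ≈ 0#
  zeroDivisorFree {x} {y} x≉0 xy≈0 = ≈-stable λ y≉0 → x≉0 (≤-antisym
    (≤-limit λ ε 0<ε → ≤-stable λ x≰ε → y≉0 (*-cancelˡ-≥ι 0<ε
      (≤-respˡ (+-identityˡ (ι ε)) (≰⇒≥ x≰ε)) xy≈0))
    (≤-limit λ ε 0<ε → ≤-stable λ 0≰x+ε → y≉0 (*-cancelˡ-≥ι {x = - x} 0<ε
      (0≤-⇒≤ (≤-respʳ (solve 2 (λ x e → :- (x :+ e) := :- x :+ :- e) refl x (ι ε))
        (neg-nonNeg (≰⇒≥ 0≰x+ε))))
      (trans (solve 2 (λ x y → :- x :* y := :- (x :* y)) refl x y)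
             (trans (-‿cong xy≈0) -0≈0)))))

  square≈0⇒≈0 : ∀ {x} → x * x ≈ 0# → x ≈ 0#
  square≈0⇒≈0 xx≈0 = ≈-stable λ x≉0 → x≉0 (zeroDivisorFree x≉0 xx≈0)

  *-≉0 : ∀ {x y} → ¬ (x ≈ 0#) → ¬ (y ≈ 0#) → ¬ (x * y ≈ 0#)
  *-≉0 x≉0 y≉0 xy≈0 = y≉0 (zeroDivisorFree x≉0 xy≈0)

  *-cancelˡ-nonNeg : ∀ {x y} → 0# ≤ x → ¬ (x ≈ 0#) → 0# ≤ x * y → 0# ≤ y
  *-cancelˡ-nonNeg {x} {y} 0≤x x≉0 0≤xy = ≤-cases ≤-stable 0# y (λ h → h) λ y≤0 →
    ≤-reflexive (sym (zeroDivisorFree x≉0 (≤-antisym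
      (nonNeg-neg (≤-respʳ (solve 2 (λ x y → x :* :- y := :- (x :* y)) refl x y)
                           (*-nonNeg 0≤x (neg-nonNeg y≤0))))
      0≤xy)))

  *-cancelˡ : ∀ {x y z} → ¬ (x ≈ 0#) → x * y ≈ x * z → y ≈ z
  *-cancelˡ {x} {y} {z} x≉0 xy≈xz = begin
    y            ≈⟨ solve 2 (λ y z → y := (y :+ :- z) :+ z) refl y z ⟩
    (y - z) + z  ≈⟨ +-congʳ (zeroDivisorFree x≉0 (begin
      x * (y - z)    ≈⟨ solve 3 (λ x y z → x :* (y :+ :- z) := x :* y :+ :- (x :* z)) refl x y z ⟩
      x * y - x * z  ≈⟨ +-congʳ xy≈xz ⟩
      x * z - x * z  ≈⟨ -‿inverseʳ _ ⟩
      0#             ∎)) ⟩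
    0# + z       ≈⟨ +-identityˡ z ⟩
    z            ∎

  +-nonNeg-≈0ˡ : ∀ {x y} → 0# ≤ x → 0# ≤ y → x + y ≈ 0# → x ≈ 0#
  +-nonNeg-≈0ˡ {x} {y} 0≤x 0≤y eq = ≤-antisym
    (≤-respʳ eq (≤-respˡ (+-identityʳ x) (+-mono-≤ ≤-refl 0≤y))) 0≤x

  +-nonNeg-≈0ʳ : ∀ {x y} → 0# ≤ x → 0# ≤ y → x + y ≈ 0# → y ≈ 0#
  +-nonNeg-≈0ʳ 0≤x 0≤y eq = +-nonNeg-≈0ˡ 0≤y 0≤x (trans (+-comm _ _) eq)

  -- If y ≤ x, then -(x - y)² = (y² - x²) + 2 y (x - y) is a sum of nonnegative terms, so x - y
  -- squares to zero. The sign of x is free, as it must be for an arbitrary eigenvalue.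
  square-cancel-≤ : ∀ {x y} → 0# ≤ y → x * x ≤ y * y → x ≤ y
  square-cancel-≤ {x} {y} 0≤y xx≤yy = ≤-cases ≤-stable x y (λ h → h) λ y≤x →
    let d≥0 = ≤⇒0≤- y≤x
        dd≈0 = ≤-antisym
          (nonNeg-neg (≤-respʳ
            (solve 2 (λ x y → (y :* y :+ :- (x :* x)) :+ (y :* (x :+ :- y) :+ y :* (x :+ :- y))
                        := :- ((x :+ :- y) :* (x :+ :- y))) refl x y)
            (+-nonNeg (≤⇒0≤- xx≤yy) (+-nonNeg (*-nonNeg 0≤y d≥0) (*-nonNeg 0≤y d≥0)))))
          (square-nonNeg _)
    in ≤-reflexive (begin
      x            ≈⟨ solve 2 (λ x y → x := (x :+ :- y) :+ y) refl x y ⟩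
      (x - y) + y  ≈⟨ +-congʳ (square≈0⇒≈0 dd≈0) ⟩
      0# + y       ≈⟨ +-identityˡ y ⟩
      y            ∎)

  opaque
    -- Opaque, so that outside this block a sum unfolds only on request, through `sum≡`, `sum-zero`
    -- and `sum-suc`.
    sum : ∀ {n} → (Fin n → Carrier) → Carrier
    sum f = Sum.sum f

    sum≡ : ∀ {n} (f : Fin n → Carrier) → sum f ≡ foldr _+_ 0# f
    sum≡ f = ≡.refl

    sum-zero : ∀ (f : Fin 0 → Carrier) → sum f ≡ 0#
    sum-zero f = ≡.refl

    sum-suc : ∀ {n} (f : Fin (ℕ.suc n) → Carrier) → sum f ≡ f Fin.zero + sum (f ∘ Fin.suc)
    sum-suc f = ≡.refl

    sum-cong : ∀ {n} {f g : Fin n → Carrier} → (∀ i → f i ≈ g i) → sum f ≈ sum g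
    sum-cong = Sum.sum-cong-≋

    sum-+ : ∀ {n} (f g : Fin n → Carrier) → sum (λ i → f i + g i) ≈ sum f + sum g
    sum-+ = Sum.∑-distrib-+

    sum-comm : ∀ {m n} (f : Fin m → Fin n → Carrier) →
      sum (λ i → sum λ j → f i j) ≈ sum λ j → sum λ i → f i j
    sum-comm = Sum.∑-comm

    sum-*ˡ : ∀ {n} x (f : Fin n → Carrier) → x * sum f ≈ sum λ i → x * f i
    sum-*ˡ = Sum.*-distribˡ-sum

    sum-*ʳ : ∀ {n} x (f : Fin n → Carrier) → sum f * x ≈ sum λ i → f i * x
    sum-*ʳ = Sum.*-distribʳ-sum

    sum-≈0 : ∀ {n} {f : Fin n → Carrier} → (∀ i → f i ≈ 0#) → sum f ≈ 0#
    sum-≈0 {n} h = trans (Sum.sum-cong-≋ h) (Sum.sum-replicate-zero n)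

    sum-nonNeg : ∀ {n} (f : Fin n → Carrier) → (∀ i → 0# ≤ f i) → 0# ≤ sum f
    sum-nonNeg {ℕ.zero}  f h = ≤-refl
    sum-nonNeg {ℕ.suc n} f h = +-nonNeg (h Fin.zero) (sum-nonNeg (f ∘ Fin.suc) (h ∘ Fin.suc))

    sum-mono : ∀ {n} {f g : Fin n → Carrier} → (∀ i → f i ≤ g i) → sum f ≤ sum g
    sum-mono {ℕ.zero}  h = ≤-refl
    sum-mono {ℕ.suc n} h = +-mono-≤ (h Fin.zero) (sum-mono (h ∘ Fin.suc))

    sum-nonNeg-≈0 : ∀ {n} (f : Fin n → Carrier) → (∀ i → 0# ≤ f i) → sum f ≈ 0# → ∀ i → f i ≈ 0#
    sum-nonNeg-≈0 f h eq Fin.zero    = +-nonNeg-≈0ˡ (h Fin.zero) (sum-nonNeg _ (h ∘ Fin.suc)) eq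
    sum-nonNeg-≈0 f h eq (Fin.suc i) = sum-nonNeg-≈0 (f ∘ Fin.suc) (h ∘ Fin.suc)
      (+-nonNeg-≈0ʳ (h Fin.zero) (sum-nonNeg _ (h ∘ Fin.suc)) eq) i

-- Rational estimates for Cauchy sequences

module ℚ-Order where
  open +-*-Solver
  open ℚ.≤-Reasoning

  ∣∣≤⇒≤ : ∀ {x ε} → ℚ.∣ x ∣ ℚ.≤ ε → x ℚ.≤ ε
  ∣∣≤⇒≤ {x} h = ℚ.≤-trans (x≤∣x∣ x) h
    where
    x≤∣x∣ : ∀ x → x ℚ.≤ ℚ.∣ x ∣
    x≤∣x∣ x with ℚ.≤-total 0ℚ x
    ... | inj₁ 0≤x = ℚ.≤-reflexive (≡.sym (ℚ.0≤p⇒∣p∣≡p 0≤x))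
    ... | inj₂ x≤0 = ℚ.≤-trans x≤0 (ℚ.0≤∣p∣ x)

  -≤⇒≤+ : ∀ {x y ε} → x ℚ.- y ℚ.≤ ε → x ℚ.≤ y ℚ.+ ε
  -≤⇒≤+ {x} {y} {ε} h = begin
    x               ≡⟨ solve 2 (λ x y → x := y :+ (x :- y)) ≡.refl x y ⟩
    y ℚ.+ (x ℚ.- y) ≤⟨ ℚ.+-monoʳ-≤ y h ⟩
    y ℚ.+ ε         ∎

  ≤+⇒-≤ : ∀ {x y ε} → x ℚ.≤ y ℚ.+ ε → x ℚ.- y ℚ.≤ ε
  ≤+⇒-≤ {x} {y} {ε} h = begin
    x ℚ.- y           ≤⟨ ℚ.+-monoˡ-≤ (ℚ.- y) h ⟩
    y ℚ.+ ε ℚ.- y     ≡⟨ solve 2 (λ y e → y :+ e :- y := e) ≡.refl y ε ⟩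
    ε                 ∎

  ∣-∣-comm : ∀ x y → ℚ.∣ x ℚ.- y ∣ ≡ ℚ.∣ y ℚ.- x ∣
  ∣-∣-comm x y = ≡.trans (≡.sym (ℚ.∣-p∣≡∣p∣ (x ℚ.- y)))
    (≡.cong ℚ.∣_∣ (solve 2 (λ x y → :- (x :- y) := y :- x) ≡.refl x y))

  ∣-∣≤⇒≤+ : ∀ {x y ε} → ℚ.∣ x ℚ.- y ∣ ℚ.≤ ε → x ℚ.≤ y ℚ.+ ε
  ∣-∣≤⇒≤+ h = -≤⇒≤+ (∣∣≤⇒≤ h)

  ∣-∣≤⇒≤+′ : ∀ {x y ε} → ℚ.∣ x ℚ.- y ∣ ℚ.≤ ε → y ℚ.≤ x ℚ.+ ε
  ∣-∣≤⇒≤+′ {x} {y} h = ∣-∣≤⇒≤+ (≡.subst (ℚ._≤ _) (∣-∣-comm x y) h)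

  ≤+⇒∣-∣≤ : ∀ {x y ε} → x ℚ.≤ y ℚ.+ ε → y ℚ.≤ x ℚ.+ ε → ℚ.∣ x ℚ.- y ∣ ℚ.≤ ε
  ≤+⇒∣-∣≤ {x} {y} h k = ∣·∣≤ (≤+⇒-≤ h) (ℚ.≤-trans
    (ℚ.≤-reflexive (solve 2 (λ x y → :- (x :- y) := y :- x) ≡.refl x y)) (≤+⇒-≤ k))

  ≤+nonNeg : ∀ {x ε} → 0ℚ ℚ.≤ ε → x ℚ.≤ x ℚ.+ ε
  ≤+nonNeg {x} 0≤ε = ℚ.≤-trans (ℚ.≤-reflexive (≡.sym (ℚ.+-identityʳ x))) (ℚ.+-monoʳ-≤ x 0≤ε)

  half-sum : ∀ {x y z ε} → x ℚ.≤ y ℚ.+ ½ ℚ.* ε → y ℚ.≤ z ℚ.+ ½ ℚ.* ε → x ℚ.≤ z ℚ.+ ε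
  half-sum {x} {y} {z} {ε} h k = begin
    x                              ≤⟨ h ⟩
    y ℚ.+ ½ ℚ.* ε                  ≤⟨ ℚ.+-monoˡ-≤ _ k ⟩
    z ℚ.+ ½ ℚ.* ε ℚ.+ ½ ℚ.* ε      ≡⟨ ℚ.+-assoc z _ _ ⟩
    z ℚ.+ (½ ℚ.* ε ℚ.+ ½ ℚ.* ε)    ≡⟨ ≡.cong (z ℚ.+_) (half+half ε) ⟩
    z ℚ.+ ε                        ∎

  *-nonNeg : ∀ {x y} → 0ℚ ℚ.≤ x → 0ℚ ℚ.≤ y → 0ℚ ℚ.≤ x ℚ.* y
  *-nonNeg {x} {y} 0≤x 0≤y = ℚ.≤-trans (ℚ.≤-reflexive (≡.sym (ℚ.*-zeroˡ y)))
    (ℚ.*-monoʳ-≤-nonNeg y {{nonNegative 0≤y}} 0≤x)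

  +-nonNeg : ∀ {x y} → 0ℚ ℚ.≤ x → 0ℚ ℚ.≤ y → 0ℚ ℚ.≤ x ℚ.+ y
  +-nonNeg 0≤x 0≤y = ℚ.+-mono-≤ 0≤x 0≤y

  0≤-⇒≤ : ∀ {x y} → 0ℚ ℚ.≤ y ℚ.- x → x ℚ.≤ y
  0≤-⇒≤ {x} {y} h = begin
    x               ≡⟨ ℚ.+-identityʳ x ⟨
    x ℚ.+ 0ℚ        ≤⟨ ℚ.+-monoʳ-≤ x h ⟩
    x ℚ.+ (y ℚ.- x) ≡⟨ solve 2 (λ x y → x :+ (y :- x) := y) ≡.refl x y ⟩
    y               ∎

  ≤⇒0≤- : ∀ {x y} → x ℚ.≤ y → 0ℚ ℚ.≤ y ℚ.- x
  ≤⇒0≤- {x} {y} h = ℚ.≤-trans (ℚ.≤-reflexive (≡.sym (ℚ.+-inverseʳ x))) (ℚ.+-monoˡ-≤ (ℚ.- x) h)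

  0≤-neg : ∀ {x} → x ℚ.≤ 0ℚ → 0ℚ ℚ.≤ ℚ.- x
  0≤-neg h = ℚ.neg-antimono-≤ h

  -- The termwise form of closure of nonnegative reals under products, whose terms are nonnegative
  -- only up to δ. If x ≥ 0, the error is charged to y + δ ≥ 0 and x ≤ A; the case y ≥ 0 is
  -- symmetric; two nonpositive factors have a nonnegative product.
  almost-nonNeg-* : ∀ {x y A B δ} → 0ℚ ℚ.≤ δ → ℚ.∣ x ∣ ℚ.≤ A → ℚ.∣ y ∣ ℚ.≤ B →
    0ℚ ℚ.≤ x ℚ.+ δ → 0ℚ ℚ.≤ y ℚ.+ δ → 0ℚ ℚ.≤ x ℚ.* y ℚ.+ (A ℚ.+ B) ℚ.* δ
  almost-nonNeg-* {x} {y} {A} {B} {δ} 0≤δ ∣x∣≤A ∣y∣≤B x+δ y+δ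
    with ℚ.≤-total 0ℚ x | ℚ.≤-total 0ℚ y
  ... | inj₁ 0≤x | _ = begin
    0ℚ ≤⟨ +-nonNeg (+-nonNeg (*-nonNeg 0≤x y+δ) (*-nonNeg (≤⇒0≤- (∣∣≤⇒≤ ∣x∣≤A)) 0≤δ))
                   (*-nonNeg (ℚ.≤-trans (ℚ.0≤∣p∣ y) ∣y∣≤B) 0≤δ) ⟩
    x ℚ.* (y ℚ.+ δ) ℚ.+ (A ℚ.- x) ℚ.* δ ℚ.+ B ℚ.* δ
      ≡⟨ solve 5 (λ x y a b d → x :* (y :+ d) :+ (a :- x) :* d :+ b :* d
                   := x :* y :+ (a :+ b) :* d) ≡.refl x y A B δ ⟩
    x ℚ.* y ℚ.+ (A ℚ.+ B) ℚ.* δ ∎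
  ... | inj₂ x≤0 | inj₁ 0≤y = begin
    0ℚ ≤⟨ +-nonNeg (+-nonNeg (*-nonNeg x+δ 0≤y) (*-nonNeg (≤⇒0≤- (∣∣≤⇒≤ ∣y∣≤B)) 0≤δ))
                   (*-nonNeg (ℚ.≤-trans (ℚ.0≤∣p∣ x) ∣x∣≤A) 0≤δ) ⟩
    (x ℚ.+ δ) ℚ.* y ℚ.+ (B ℚ.- y) ℚ.* δ ℚ.+ A ℚ.* δ
      ≡⟨ solve 5 (λ x y a b d → (x :+ d) :* y :+ (b :- y) :* d :+ a :* d
                   := x :* y :+ (a :+ b) :* d) ≡.refl x y A B δ ⟩
    x ℚ.* y ℚ.+ (A ℚ.+ B) ℚ.* δ ∎
  ... | inj₂ x≤0 | inj₂ y≤0 = begin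
    0ℚ ≤⟨ +-nonNeg (*-nonNeg (0≤-neg x≤0) (0≤-neg y≤0))
            (*-nonNeg (+-nonNeg (ℚ.≤-trans (ℚ.0≤∣p∣ x) ∣x∣≤A) (ℚ.≤-trans (ℚ.0≤∣p∣ y) ∣y∣≤B)) 0≤δ) ⟩
    (ℚ.- x) ℚ.* (ℚ.- y) ℚ.+ (A ℚ.+ B) ℚ.* δ
      ≡⟨ solve 5 (λ x y a b d → (:- x) :* (:- y) :+ (a :+ b) :* d
                   := x :* y :+ (a :+ b) :* d) ≡.refl x y A B δ ⟩
    x ℚ.* y ℚ.+ (A ℚ.+ B) ℚ.* δ ∎

  square-nonNeg : ∀ x → 0ℚ ℚ.≤ x ℚ.* x
  square-nonNeg x with ℚ.≤-total 0ℚ x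
  ... | inj₁ p = *-nonNeg p p
  ... | inj₂ p = ℚ.≤-trans (*-nonNeg (0≤-neg p) (0≤-neg p))
    (ℚ.≤-reflexive (solve 1 (λ x → (:- x) :* (:- x) := x :* x) ≡.refl x))

  -- With both tails within δ = ε/8 of stage K, a comparison against the midpoint ε/2 loses at most
  -- 2 δ = ε/4. What remains is the bound 3ε/4 here, relaxed to ε, and the positive gap ε/4 in
  -- `near-≥`.
  near-≤ : ∀ {xn xK yn yK ε} → 0ℚ ℚ.< ε →
    ℚ.∣ xK ℚ.- xn ∣ ℚ.≤ ½ ℚ.* (½ ℚ.* (½ ℚ.* ε)) → ℚ.∣ yK ℚ.- yn ∣ ℚ.≤ ½ ℚ.* (½ ℚ.* (½ ℚ.* ε)) →
    xK ℚ.≤ yK ℚ.+ ½ ℚ.* ε → xn ℚ.≤ yn ℚ.+ ε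
  near-≤ {xn} {xK} {yn} {yK} {ε} 0<ε px py x≤y = 0≤-⇒≤ {xn} {yn ℚ.+ ε} (begin
    0ℚ ≤⟨ +-nonNeg (+-nonNeg (+-nonNeg
            (≤⇒0≤- {xn} {xK ℚ.+ δ} (∣-∣≤⇒≤+′ {xK} {xn} {δ} px))
            (≤⇒0≤- {yK} {yn ℚ.+ δ} (∣-∣≤⇒≤+ {yK} {yn} {δ} py)))
            (≤⇒0≤- {xK} {yK ℚ.+ ½ ℚ.* ε} x≤y)) (ℚ.<⇒≤ (half-pos (half-pos 0<ε))) ⟩
    (xK ℚ.+ δ ℚ.- xn) ℚ.+ (yn ℚ.+ δ ℚ.- yK) ℚ.+ (yK ℚ.+ ½ ℚ.* ε ℚ.- xK) ℚ.+ ½ ℚ.* (½ ℚ.* ε)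
      ≡⟨ solve 5 (λ xn xK yn yK e →
           (xK :+ con ½ :* (con ½ :* (con ½ :* e)) :- xn) :+ (yn :+ con ½ :* (con ½ :* (con ½ :* e)) :- yK)
             :+ (yK :+ con ½ :* e :- xK) :+ con ½ :* (con ½ :* e)
           := (yn :+ e) :- xn) ≡.refl xn xK yn yK ε ⟩
    yn ℚ.+ ε ℚ.- xn ∎)
    where δ = ½ ℚ.* (½ ℚ.* (½ ℚ.* ε))

  near-≥ : ∀ {xn xK yn yK ε} →
    ℚ.∣ xK ℚ.- xn ∣ ℚ.≤ ½ ℚ.* (½ ℚ.* (½ ℚ.* ε)) → ℚ.∣ yK ℚ.- yn ∣ ℚ.≤ ½ ℚ.* (½ ℚ.* (½ ℚ.* ε)) →
    yK ℚ.+ ½ ℚ.* ε ℚ.≤ xK → yn ℚ.+ ½ ℚ.* (½ ℚ.* ε) ℚ.≤ xn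
  near-≥ {xn} {xK} {yn} {yK} {ε} px py y≤x = 0≤-⇒≤ {yn ℚ.+ ½ ℚ.* (½ ℚ.* ε)} {xn} (begin
    0ℚ ≤⟨ +-nonNeg (+-nonNeg
            (≤⇒0≤- {xK} {xn ℚ.+ δ} (∣-∣≤⇒≤+ {xK} {xn} {δ} px))
            (≤⇒0≤- {yn} {yK ℚ.+ δ} (∣-∣≤⇒≤+′ {yK} {yn} {δ} py)))
            (≤⇒0≤- {yK ℚ.+ ½ ℚ.* ε} {xK} y≤x) ⟩
    (xn ℚ.+ δ ℚ.- xK) ℚ.+ (yK ℚ.+ δ ℚ.- yn) ℚ.+ (xK ℚ.- (yK ℚ.+ ½ ℚ.* ε))
      ≡⟨ solve 5 (λ xn xK yn yK e →
           (xn :+ con ½ :* (con ½ :* (con ½ :* e)) :- xK) :+ (yK :+ con ½ :* (con ½ :* (con ½ :* e)) :- yn)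
             :+ (xK :- (yK :+ con ½ :* e))
           := xn :- (yn :+ con ½ :* (con ½ :* e))) ≡.refl xn xK yn yK ε ⟩
    xn ℚ.- (yn ℚ.+ ½ ℚ.* (½ ℚ.* ε)) ∎)
    where δ = ½ ℚ.* (½ ℚ.* (½ ℚ.* ε))


-- Subsets, cliques and the numbers c(e)

allSubsets-complete : ∀ {n} (S : Subset n) → S List.∈ allSubsets n
allSubsets-complete []            = Any.here ≡.refl
allSubsets-complete (inside  ∷ S) = List.∈-++⁺ˡ (List.∈-map⁺ (inside ∷_) (allSubsets-complete S))
allSubsets-complete (outside ∷ S) =
  List.∈-++⁺ʳ _ (List.∈-map⁺ (outside ∷_) (allSubsets-complete S))

record Enumeration {n} (S : Subset n) : Set where
  field
    element   : Fin ∣ S ∣ → Fin n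
    element∈  : ∀ i → element i ∈ S
    injective : ∀ {i j} → element i ≡ element j → i ≡ j
    index     : ∀ {v} → v ∈ S → ∃[ i ] element i ≡ v

enumerate : ∀ {n} (S : Subset n) → Enumeration S
enumerate []            = record { element = λ () ; element∈ = λ () ; injective = λ {} ; index = λ () }
enumerate (outside ∷ S) = record
  { element = Fin.suc ∘ element ; element∈ = there ∘ element∈ ; injective = injective ∘ Fin.suc-injective
  ; index = λ { (there v∈S) → let (i , eq) = index v∈S in i , ≡.cong Fin.suc eq } }
  where open Enumeration (enumerate S)
enumerate (inside ∷ S) = record
  { element   = λ { Fin.zero → Fin.zero ; (Fin.suc i) → Fin.suc (element i) }
  ; element∈  = λ { Fin.zero → here ; (Fin.suc i) → there (element∈ i) }
  ; injective = λ { {Fin.zero} {Fin.zero} _ → ≡.refl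
                  ; {Fin.suc i} {Fin.suc j} eq → ≡.cong Fin.suc (injective (Fin.suc-injective eq)) }
  ; index     = λ { here → Fin.zero , ≡.refl
                  ; (there v∈S) → let (i , eq) = index v∈S in Fin.suc i , ≡.cong Fin.suc eq } }
  where open Enumeration (enumerate S)

∣S∪⁅v⁆∣>∣S∣ : ∀ {n} {S : Subset n} {v} → v ∉ S → ∣ S ∣ ℕ.< ∣ S ∪ ⁅ v ⁆ ∣
∣S∪⁅v⁆∣>∣S∣ {S = S} {v} v∉S = p⊂q⇒∣p∣<∣q∣ (p⊆p∪q ⁅ v ⁆ , v , q⊆p∪q S ⁅ v ⁆ (x∈⁅x⁆ v) , v∉S)

∈∧≢⇒2≤∣∣ : ∀ {n} {S : Subset n} {u v} → u ∈ S → v ∈ S → u ≢ v → 2 ℕ.≤ ∣ S ∣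
∈∧≢⇒2≤∣∣ {S = S} {u} {v} u∈S v∈S u≢v = ℕ.≤-trans
  (s≤s (≡.subst (ℕ._≤ ∣ S ∖ u ∣) (∣⁅x⁆∣≡1 v) (p⊆q⇒∣p∣≤∣q∣ λ x∈ →
    ≡.subst (_∈ S ∖ u) (≡.sym (x∈⁅y⁆⇒x≡y v x∈)) (x∈p∧x≢y⇒x∈p-y v∈S (u≢v ∘ ≡.sym)))))
  (x∈p⇒∣p-x∣<∣p∣ u∈S)

module CliqueNumber {n : ℕ} (G : Graph n) where
  open Graph G

  clique∈cliques : ∀ {S} → IsClique G S → S List.∈ cliques G
  clique∈cliques {S} = List.∈-filter⁺ (isClique? G) (allSubsets-complete S)

  clique-size≤ω : ∀ {S} → IsClique G S → ∣ S ∣ ℕ.≤ ω G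
  clique-size≤ω clique = All.lookup (xs≤max 0 _) (List.∈-map⁺ ∣_∣ (clique∈cliques clique))

  clique-size≤c : ∀ {S u v} → IsClique G S → u ∈ S → v ∈ S → ∣ S ∣ ℕ.≤ c G u v
  clique-size≤c clique u∈S v∈S = All.lookup (xs≤max 0 _) (List.∈-map⁺ ∣_∣
    (List.∈-filter⁺ _ (clique∈cliques clique) (u∈S , v∈S)))

  c≤ : ∀ {u v k} → (∀ S → IsClique G S → u ∈ S → v ∈ S → ∣ S ∣ ℕ.≤ k) → c G u v ℕ.≤ k
  c≤ {u} {v} h = max≤v⁺ z≤n (All.map⁺ (All.tabulate λ {S} S∈ →
    let (S∈cliques , u∈S , v∈S) = List.∈-filter⁻ (λ S → (u ∈? S) ×-dec (v ∈? S)) {xs = cliques G} S∈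
        (_ , clique) = List.∈-filter⁻ (isClique? G) {xs = allSubsets n} S∈cliques
    in h S clique u∈S v∈S))

  c≤ω : ∀ u v → c G u v ℕ.≤ ω G
  c≤ω u v = c≤ λ S clique _ _ → clique-size≤ω clique

  c-sym : ∀ u v → c G u v ≡ c G v u
  c-sym u v = ℕ.≤-antisym (c≤ λ S q u∈S v∈S → clique-size≤c q v∈S u∈S)
                          (c≤ λ S q v∈S u∈S → clique-size≤c q u∈S v∈S)

  maximumClique : ∃[ S ] (IsClique G S × ∣ S ∣ ≡ ω G)
  maximumClique with argmax-sel id 0 (List.map ∣_∣ (cliques G))
  -- `max` may have returned its default 0; the empty clique attains that value.
  ... | inj₁ ω≡0 = Data.Fin.Subset.⊥ , (λ u v u∈⊥ → ⊥-elim (∉⊥ u∈⊥)) , ≡.trans (∣⊥∣≡0 n) (≡.sym ω≡0)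
  ... | inj₂ ω∈ = let (S , S∈ , ω≡) = List.∈-map⁻ ∣_∣ ω∈
                      (_ , clique) = List.∈-filter⁻ (isClique? G) {xs = allSubsets n} S∈
                  in S , clique , ≡.sym ω≡

  adj⇒≢ : ∀ {u v} → Adj u v → u ≢ v
  adj⇒≢ uv u≡v = adj-irrefl u≡v uv

  ⁅⁆-clique : ∀ v → IsClique G ⁅ v ⁆
  ⁅⁆-clique v x y x∈ y∈ x≢y = ⊥-elim (x≢y (≡.trans (x∈⁅y⁆⇒x≡y v x∈) (≡.sym (x∈⁅y⁆⇒x≡y v y∈))))

  ∪⁅⁆-clique : ∀ {S v} → IsClique G S → (∀ u → u ∈ S → Adj u v) → IsClique G (S ∪ ⁅ v ⁆)
  ∪⁅⁆-clique {S} {v} clique adj x y x∈ y∈ x≢y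
    with x∈p∪q⁻ S ⁅ v ⁆ x∈ | x∈p∪q⁻ S ⁅ v ⁆ y∈
  ... | inj₁ x∈S | inj₁ y∈S = clique x y x∈S y∈S x≢y
  ... | inj₁ x∈S | inj₂ y∈v = ≡.subst (Adj x) (≡.sym (x∈⁅y⁆⇒x≡y v y∈v)) (adj x x∈S)
  ... | inj₂ x∈v | inj₁ y∈S = ≡.subst (λ z → Adj z y) (≡.sym (x∈⁅y⁆⇒x≡y v x∈v)) (adj-sym (adj y y∈S))
  ... | inj₂ x∈v | inj₂ y∈v = ⊥-elim (x≢y (≡.trans (x∈⁅y⁆⇒x≡y v x∈v) (≡.sym (x∈⁅y⁆⇒x≡y v y∈v))))

  2≤c : ∀ {u v} → Adj u v → 2 ℕ.≤ c G u v
  2≤c {u} {v} uv = ℕ.≤-trans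
    (∈∧≢⇒2≤∣∣ u∈ v∈ (adj⇒≢ uv))
    (clique-size≤c (∪⁅⁆-clique (⁅⁆-clique u) λ x x∈ → ≡.subst (λ z → Adj z v) (≡.sym (x∈⁅y⁆⇒x≡y u x∈)) uv) u∈ v∈)
    where
    u∈ : u ∈ ⁅ u ⁆ ∪ ⁅ v ⁆
    u∈ = p⊆p∪q ⁅ v ⁆ (x∈⁅x⁆ u)
    v∈ : v ∈ ⁅ u ⁆ ∪ ⁅ v ⁆
    v∈ = q⊆p∪q ⁅ u ⁆ ⁅ v ⁆ (x∈⁅x⁆ v)

  maximumClique-maximal : ∀ {S} → IsClique G S → ∣ S ∣ ≡ ω G → ∀ v → ¬ (∀ u → u ∈ S → Adj u v)
  maximumClique-maximal {S} clique ∣S∣≡ω v adj = ℕ.<-irrefl ∣S∣≡ω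
    (ℕ.<-≤-trans (∣S∪⁅v⁆∣>∣S∣ λ v∈S → adj-irrefl ≡.refl (adj v v∈S)) (clique-size≤ω (∪⁅⁆-clique clique adj)))

  -- Indexing by `Fin k` with k = ω makes the clique vertices usable as names for the ω classes. The
  -- field `maximal` holds because a further common neighbour would enlarge the clique; it is what
  -- assigns every vertex to a class.
  record MaximumClique (k : ℕ) : Set where
    field
      vertex   : Fin k → Fin n
      adjacent : ∀ {i j} → i ≢ j → Adj (vertex i) (vertex j)
      maximal  : ∀ v → ¬ (∀ i → Adj (vertex i) v)
      size≤c   : ∀ i j → k ℕ.≤ c G (vertex i) (vertex j)

  enumeratedMaximumClique : MaximumClique (ω G)
  enumeratedMaximumClique = let (S , clique , ∣S∣≡ω) = maximumClique in
    ≡.subst MaximumClique ∣S∣≡ω (fromSubset clique ∣S∣≡ω)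
    where
    fromSubset : ∀ {S} → IsClique G S → ∣ S ∣ ≡ ω G → MaximumClique ∣ S ∣
    fromSubset {S} clique ∣S∣≡ω = record
      { vertex   = element
      ; adjacent = λ {i} {j} i≢j → clique (element i) (element j) (element∈ i) (element∈ j) (i≢j ∘ injective)
      ; maximal  = λ v adj → maximumClique-maximal clique ∣S∣≡ω v λ u u∈S →
          let (i , eq) = index u∈S in ≡.subst (λ u → Adj u v) eq (adj i)
      ; size≤c   = λ i j → clique-size≤c clique (element∈ i) (element∈ j) }
      where open Enumeration (enumerate S)

-- Rational edge weights and their reciprocals

module Weights where
  open +-*-Solver
  open ℚ.≤-Reasoning

  fraction-* : ∀ i d → (+ i ℚ./ suc d) ℚ.* fromℕ (suc d) ≡ fromℕ i
  fraction-* i d = ℚ.toℚᵘ-injective (ℚᵘ.≃-trans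
    (ℚ.toℚᵘ-homo-* (+ i ℚ./ suc d) (fromℕ (suc d)))
    (ℚᵘ.≃-trans (ℚᵘ.*-congʳ {ℚ.toℚᵘ (fromℕ (suc d))} (ℚ.toℚᵘ-fromℚᵘ (ℚᵘ.mkℚᵘ (+ i) d)))
      (ℚᵘ.*≡* (ℤ.*-assoc (+ i) (+ suc d) (+ 1)))))

  fromℕ-mono : ∀ {i j} → i ℕ.≤ j → fromℕ i ℚ.≤ fromℕ j
  fromℕ-mono i≤j = *≤* (ℤ.*-monoʳ-≤-nonNeg (+ 1) (+≤+ i≤j))

  fromℕ-nonNeg : ∀ i → 0ℚ ℚ.≤ fromℕ i
  fromℕ-nonNeg i = fromℕ-mono {0} z≤n

  fromℕ-injective : ∀ {i j} → fromℕ i ≡ fromℕ j → i ≡ j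
  fromℕ-injective ≡.refl = ≡.refl

  -- 1/(c - 1), by which the reciprocal weight c/(c - 1) exceeds 1. The values at 0 and 1 are
  -- defaults, as every edge has c ≥ 2.
  excess : ℕ → ℚ
  excess (suc (suc k)) = + 1 ℚ./ suc k
  excess _             = 0ℚ

  excess-* : ∀ k → excess (2 ℕ.+ k) ℚ.* fromℕ (suc k) ≡ 1ℚ
  excess-* k = fraction-* 1 k

  fraction-nonNeg : ∀ i d → 0ℚ ℚ.≤ + i ℚ./ suc d
  fraction-nonNeg i d = ℚ.toℚᵘ-cancel-≤ (ℚᵘ.≤-respʳ-≃ (ℚᵘ.≃-sym (ℚ.toℚᵘ-fromℚᵘ (ℚᵘ.mkℚᵘ (+ i) d)))
    (ℚᵘ.*≤* (≡.subst (λ z → + 0 ℤ.≤ z) (≡.sym (ℤ.*-identityʳ (+ i))) (+≤+ z≤n))))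

  excess-nonNeg : ∀ k → 0ℚ ℚ.≤ excess k
  excess-nonNeg zero          = ℚ.≤-refl
  excess-nonNeg (suc zero)    = ℚ.≤-refl
  excess-nonNeg (suc (suc k)) = fraction-nonNeg 1 k

  *-excess≤1 : ∀ {k c} → suc k ℕ.≤ c → fromℕ k ℚ.* excess c ℚ.≤ 1ℚ
  *-excess≤1 {k} {suc zero}    h = ℚ.≤-trans (ℚ.≤-reflexive (ℚ.*-zeroʳ (fromℕ k))) (ℚ.<⇒≤ (ℚ.positive⁻¹ 1ℚ))
  *-excess≤1 {k} {suc (suc c)} (s≤s k≤) = begin
    fromℕ k ℚ.* excess (2 ℕ.+ c)
      ≤⟨ ℚ.*-monoʳ-≤-nonNeg (excess (2 ℕ.+ c)) {{nonNegative (excess-nonNeg (2 ℕ.+ c))}} (fromℕ-mono k≤) ⟩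
    fromℕ (suc c) ℚ.* excess (2 ℕ.+ c)  ≡⟨ ℚ.*-comm (fromℕ (suc c)) (excess (2 ℕ.+ c)) ⟩
    excess (2 ℕ.+ c) ℚ.* fromℕ (suc c)  ≡⟨ excess-* c ⟩
    1ℚ                                  ∎

  excess≤1 : ∀ k → excess k ℚ.≤ 1ℚ
  excess≤1 zero          = ℚ.<⇒≤ (ℚ.positive⁻¹ 1ℚ)
  excess≤1 (suc zero)    = ℚ.<⇒≤ (ℚ.positive⁻¹ 1ℚ)
  excess≤1 (suc (suc k)) = ℚ.≤-trans (ℚ.≤-reflexive (≡.sym (ℚ.*-identityˡ (excess (2 ℕ.+ k)))))
    (*-excess≤1 {1} {2 ℕ.+ k} (s≤s (s≤s z≤n)))

  weight-* : ∀ k → weight (suc k) ℚ.* fromℕ (suc k) ≡ fromℕ k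
  weight-* k = fraction-* k k

  weight-nonNeg : ∀ k → 0ℚ ℚ.≤ weight k
  weight-nonNeg zero    = ℚ.≤-refl
  weight-nonNeg (suc k) = fraction-nonNeg k k

  weight-mono : ∀ {i j} → i ℕ.≤ j → weight i ℚ.≤ weight j
  weight-mono {zero}  {j}     _        = weight-nonNeg j
  weight-mono {suc i} {suc j} (s≤s i≤j) = ℚ.toℚᵘ-cancel-≤
    (ℚᵘ.≤-respˡ-≃ (ℚᵘ.≃-sym (ℚ.toℚᵘ-fromℚᵘ (ℚᵘ.mkℚᵘ (+ i) i)))
    (ℚᵘ.≤-respʳ-≃ (ℚᵘ.≃-sym (ℚ.toℚᵘ-fromℚᵘ (ℚᵘ.mkℚᵘ (+ j) j)))
    (ℚᵘ.*≤* (≡.subst₂ ℤ._≤_ (ℤ.pos-* i (suc j)) (ℤ.pos-* j (suc i)) (+≤+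
      (≡.subst₂ ℕ._≤_ (≡.sym (ℕ.*-suc i j)) (≡.trans (≡.cong (j ℕ.+_) (ℕ.*-comm i j)) (≡.sym (ℕ.*-suc j i)))
        (ℕ.+-monoˡ-≤ (i ℕ.* j) i≤j)))))))

  weight*[1+excess] : ∀ {k} → 2 ℕ.≤ k → weight k ℚ.* (1ℚ ℚ.+ excess k) ≡ 1ℚ
  weight*[1+excess] {suc zero}    (s≤s ())
  weight*[1+excess] {suc (suc k)} _ = begin-equality
    w ℚ.* (1ℚ ℚ.+ x)                ≡⟨ ℚ.*-identityʳ _ ⟨
    w ℚ.* (1ℚ ℚ.+ x) ℚ.* 1ℚ         ≡⟨ ≡.cong (w ℚ.* (1ℚ ℚ.+ x) ℚ.*_) (excess-* k) ⟨
    w ℚ.* (1ℚ ℚ.+ x) ℚ.* (x ℚ.* a)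
      ≡⟨ solve 3 (λ w x a → w :* (con 1ℚ :+ x) :* (x :* a) := w :* (x :* a :+ a) :* x) ≡.refl w x a ⟩
    w ℚ.* (x ℚ.* a ℚ.+ a) ℚ.* x     ≡⟨ ≡.cong (λ y → w ℚ.* (y ℚ.+ a) ℚ.* x) (excess-* k) ⟩
    w ℚ.* (1ℚ ℚ.+ a) ℚ.* x          ≡⟨ ≡.cong (λ y → w ℚ.* y ℚ.* x) (fromℕ-suc (suc k)) ⟨
    w ℚ.* fromℕ (2 ℕ.+ k) ℚ.* x     ≡⟨ ≡.cong (ℚ._* x) (weight-* (suc k)) ⟩
    a ℚ.* x                         ≡⟨ ℚ.*-comm a x ⟩
    x ℚ.* a                         ≡⟨ excess-* k ⟩
    1ℚ                              ∎
    where
    w = weight (2 ℕ.+ k)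
    x = excess (2 ℕ.+ k)
    a = fromℕ (suc k)

module ListSums where
  open import Algebra.Properties.Semiring.Sum
    (CommutativeRing.semiring ℚ.+-*-commutativeRing) public using (sum; ∑-distrib-+; ∑-comm; sum-cong-≗; *-distribˡ-sum)

  sum-nonNeg : ∀ {n} (f : Fin n → ℚ) → (∀ i → 0ℚ ℚ.≤ f i) → 0ℚ ℚ.≤ sum f
  sum-nonNeg {zero}  f h = ℚ.≤-refl
  sum-nonNeg {suc n} f h = ℚ-Order.+-nonNeg (h Fin.zero) (sum-nonNeg (f ∘ Fin.suc) (h ∘ Fin.suc))

  private
    variable
      A B : Set

  sumList : (A → ℚ) → List A → ℚ
  sumList f xs = List.foldr ℚ._+_ 0ℚ (List.map f xs)

  sumList-filter : ∀ {P : A → Set} (P? : ∀ x → Dec (P x)) (f : A → ℚ) xs →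
    sumList f (List.filter P? xs) ≡ sumList (λ x → if does (P? x) then f x else 0ℚ) xs
  sumList-filter P? f List.[] = ≡.refl
  sumList-filter P? f (x List.∷ xs) with does (P? x)
  ... | true  = ≡.cong (f x ℚ.+_) (sumList-filter P? f xs)
  ... | false = ≡.trans (sumList-filter P? f xs) (≡.sym (ℚ.+-identityˡ _))

  sumList-++ : ∀ (f : A → ℚ) xs ys → sumList f (xs List.++ ys) ≡ sumList f xs ℚ.+ sumList f ys
  sumList-++ f List.[] ys = ≡.sym (ℚ.+-identityˡ _)
  sumList-++ f (x List.∷ xs) ys =
    ≡.trans (≡.cong (f x ℚ.+_) (sumList-++ f xs ys)) (≡.sym (ℚ.+-assoc (f x) _ _))

  sumList-cartesianProduct : ∀ (f : A × B → ℚ) xs ys →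
    sumList f (List.cartesianProduct xs ys) ≡ sumList (λ x → sumList (λ y → f (x , y)) ys) xs
  sumList-cartesianProduct f List.[] ys = ≡.refl
  sumList-cartesianProduct f (x List.∷ xs) ys = ≡.trans
    (sumList-++ f (List.map (x ,_) ys) _)
    (≡.cong₂ ℚ._+_ (≡.cong (List.foldr ℚ._+_ 0ℚ) (≡.sym (List.map-∘ ys))) (sumList-cartesianProduct f xs ys))

  sumList-tabulate : ∀ {n} (f : A → ℚ) (g : Fin n → A) → sumList f (List.tabulate g) ≡ sum (f ∘ g)
  sumList-tabulate {n = zero}  f g = ≡.refl
  sumList-tabulate {n = suc n} f g = ≡.cong (f (g Fin.zero) ℚ.+_) (sumList-tabulate f (g ∘ Fin.suc))

  sumList-allFin² : ∀ {n} (f : Fin n × Fin n → ℚ) →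
    sumList f (List.cartesianProduct (List.allFin n) (List.allFin n)) ≡ sum λ u → sum λ v → f (u , v)
  sumList-allFin² {n} f = ≡.trans (sumList-cartesianProduct f (List.allFin n) (List.allFin n))
    (≡.trans (sumList-tabulate {n = n} (λ u → sumList (λ v → f (u , v)) (List.allFin n)) id)
      (sum-cong-≗ {n} {λ u → sumList (λ v → f (u , v)) (List.allFin n)} {λ u → sum λ v → f (u , v)}
        λ u → sumList-tabulate {n = n} (λ v → f (u , v)) id))

-- The paper's weights as matrices: w = (c - 1)/c and g = c/(c - 1) on edges,
-- both 0 elsewhere; and h = 1 - g, the matrix of (Σ y)² - Σ g_uv y_u y_v.
module WeightMatrices {n : ℕ} (G : Graph n) where
  open Graph G
  open CliqueNumber G
  open Weights
  open ListSums
  open ℚ.≤-Reasoning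
  open +-*-Solver

  a w g h : Fin n → Fin n → ℚ
  a u v = if does (adj? u v) then 1ℚ else 0ℚ
  w u v = if does (adj? u v) then weight (c G u v) else 0ℚ
  h u v = if does (adj? u v) then ℚ.- excess (c G u v) else 1ℚ
  g u v = 1ℚ ℚ.- h u v

  a-adj : ∀ {u v} → Adj u v → a u v ≡ 1ℚ
  a-adj {u} {v} uv with adj? u v
  ... | yes _ = ≡.refl
  ... | no ¬uv = ⊥-elim (¬uv uv)

  h-nonadj : ∀ {u v} → ¬ Adj u v → h u v ≡ 1ℚ
  h-nonadj {u} {v} ¬uv with adj? u v
  ... | yes uv = ⊥-elim (¬uv uv)
  ... | no _ = ≡.refl

  h-adj : ∀ {u v} → Adj u v → h u v ≡ ℚ.- excess (c G u v)
  h-adj {u} {v} uv with adj? u v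
  ... | yes _ = ≡.refl
  ... | no ¬uv = ⊥-elim (¬uv uv)

  h-diagonal : ∀ u → h u u ≡ 1ℚ
  h-diagonal u = h-nonadj (adj-irrefl ≡.refl)

  h-sym : ∀ u v → h u v ≡ h v u
  h-sym u v with adj? u v | adj? v u
  ... | yes _  | yes _  = ≡.cong (λ k → ℚ.- excess k) (c-sym u v)
  ... | yes uv | no ¬vu = ⊥-elim (¬vu (adj-sym uv))
  ... | no ¬uv | yes vu = ⊥-elim (¬uv (adj-sym vu))
  ... | no _   | no _   = ≡.refl

  h≤1 : ∀ u v → h u v ℚ.≤ 1ℚ
  h≤1 u v with adj? u v
  ... | yes _ = ℚ.≤-trans (ℚ.neg-antimono-≤ (excess-nonNeg (c G u v))) (ℚ.<⇒≤ (ℚ.positive⁻¹ 1ℚ))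
  ... | no  _ = ℚ.≤-refl

  -1≤h : ∀ u v → ℚ.- 1ℚ ℚ.≤ h u v
  -1≤h u v with adj? u v
  ... | yes _ = ℚ.neg-antimono-≤ (excess≤1 (c G u v))
  ... | no  _ = ℚ.<⇒≤ (ℚ.<-trans (ℚ.negative⁻¹ (ℚ.- 1ℚ)) (ℚ.positive⁻¹ 1ℚ))

  h≢1⇒adj : ∀ {u v} → h u v ≢ 1ℚ → Adj u v
  h≢1⇒adj {u} {v} h≢1 with adj? u v
  ... | yes uv = uv
  ... | no  _  = ⊥-elim (h≢1 ≡.refl)

  h-adj≢1 : ∀ {u v} → Adj u v → h u v ≢ 1ℚ
  h-adj≢1 {u} {v} uv h≡1 = ℚ.<-irrefl ≡.refl (begin-strict
    0ℚ                    <⟨ ℚ.positive⁻¹ 1ℚ ⟩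
    1ℚ                    ≡⟨ ≡.trans (≡.sym h≡1) (h-adj uv) ⟩
    ℚ.- excess (c G u v)  ≤⟨ ℚ.neg-antimono-≤ (excess-nonNeg (c G u v)) ⟩
    0ℚ                    ∎)

  w-nonNeg : ∀ u v → 0ℚ ℚ.≤ w u v
  w-nonNeg u v with adj? u v
  ... | yes _ = weight-nonNeg (c G u v)
  ... | no  _ = ℚ.≤-refl

  w≤a*weight : ∀ {k} → ω G ≡ k → ∀ u v → w u v ℚ.≤ a u v ℚ.* weight k
  w≤a*weight {k} ω≡k u v with adj? u v
  ... | yes _ = ℚ.≤-trans (weight-mono (≡.subst (c G u v ℕ.≤_) ω≡k (c≤ω u v))) (ℚ.≤-reflexive (≡.sym (ℚ.*-identityˡ (weight k))))
  ... | no  _ = ℚ.≤-reflexive (≡.sym (ℚ.*-zeroˡ (weight k)))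

  w*g≡a : ∀ u v → w u v ℚ.* g u v ≡ a u v
  w*g≡a u v with adj? u v
  ... | yes uv = ≡.trans
    (solve 2 (λ w x → w :* (con 1ℚ :- :- x) := w :* (con 1ℚ :+ x)) ≡.refl (weight (c G u v)) (excess (c G u v)))
    (weight*[1+excess] (2≤c uv))
  ... | no  _  = ≡.refl

  a*g≡g : ∀ u v → a u v ℚ.* g u v ≡ g u v
  a*g≡g u v with adj? u v
  ... | yes _ = ℚ.*-identityˡ _
  ... | no  _ = ≡.refl

  w-adj≢0 : ∀ {u v} → Adj u v → w u v ≢ 0ℚ
  w-adj≢0 {u} {v} uv w≡0 = ℚ.<⇒≢ (ℚ.positive⁻¹ 1ℚ) (begin-equality
    0ℚ                   ≡⟨ ℚ.*-zeroˡ (g u v) ⟨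
    0ℚ ℚ.* g u v         ≡⟨ ≡.cong (ℚ._* g u v) w≡0 ⟨
    w u v ℚ.* g u v      ≡⟨ w*g≡a u v ⟩
    a u v                ≡⟨ a-adj uv ⟩
    1ℚ                   ∎)

  private
    e : Fin n → Fin n → ℚ
    e u v = if does ((u Fin.<? v) ×-dec adj? u v) then weight (c G u v) else 0ℚ

  -- `edgeSum` counts an edge only with its smaller endpoint first, so exactly one of `e u v` and
  -- `e v u` carries its weight. Symmetrising absorbs the factor 2 under the square root of the
  -- bound. In `split` the decisions are arguments so that `does` computes in each case.
  w≡e+e : ∀ u v → w u v ≡ e u v ℚ.+ e v u
  w≡e+e u v = split (adj? u v) (adj? v u) (u Fin.<? v) (v Fin.<? u)
    where
    split : (uv? : Dec (Adj u v)) (vu? : Dec (Adj v u)) (u<v? : Dec (u Fin.< v)) (v<u? : Dec (v Fin.< u)) →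
      (if does uv? then weight (c G u v) else 0ℚ)
      ≡ (if does (u<v? ×-dec uv?) then weight (c G u v) else 0ℚ)
        ℚ.+ (if does (v<u? ×-dec vu?) then weight (c G v u) else 0ℚ)
    split (yes uv) (no ¬vu) _         _         = ⊥-elim (¬vu (adj-sym uv))
    split (no ¬uv) (yes vu) _         _         = ⊥-elim (¬uv (adj-sym vu))
    split (no _)   (no _)   (yes _)   (yes _)   = ≡.refl
    split (no _)   (no _)   (yes _)   (no _)    = ≡.refl
    split (no _)   (no _)   (no _)    (yes _)   = ≡.refl
    split (no _)   (no _)   (no _)    (no _)    = ≡.refl
    split (yes _)  (yes _)  (yes u<v) (yes v<u) = ⊥-elim (Fin.<-asym u<v v<u)
    split (yes _)  (yes _)  (yes _)   (no _)    = ≡.sym (ℚ.+-identityʳ _)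
    split (yes _)  (yes _)  (no _)    (yes _)   = ≡.trans (≡.cong weight (c-sym u v)) (≡.sym (ℚ.+-identityˡ _))
    split (yes uv) (yes _)  (no u≮v)  (no v≮u)  =
      ⊥-elim (adj⇒≢ uv (Fin.≤-antisym (ℕ.≮⇒≥ v≮u) (ℕ.≮⇒≥ u≮v)))

  2*edgeSum≡∑∑w : (+ 2 ℚ./ 1) ℚ.* edgeSum G ≡ sum λ u → sum λ v → w u v
  2*edgeSum≡∑∑w = begin-equality
    (+ 2 ℚ./ 1) ℚ.* edgeSum G       ≡⟨ ≡.cong ((+ 2 ℚ./ 1) ℚ.*_) edgeSum≡ ⟩
    (+ 2 ℚ./ 1) ℚ.* E               ≡⟨ solve 1 (λ x → con (+ 2 ℚ./ 1) :* x := x :+ x) ≡.refl E ⟩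
    E ℚ.+ E                         ≡⟨ ≡.cong (E ℚ.+_) (∑-comm e) ⟩
    E ℚ.+ (sum λ u → sum λ v → e v u)
      ≡⟨ ∑-distrib-+ (λ u → sum λ v → e u v) (λ u → sum λ v → e v u) ⟨
    (sum λ u → (sum λ v → e u v) ℚ.+ (sum λ v → e v u))
      ≡⟨ sum-cong-≗ (λ u → ≡.trans (≡.sym (∑-distrib-+ (e u) (λ v → e v u))) (sum-cong-≗ (λ v → ≡.sym (w≡e+e u v)))) ⟩
    (sum λ u → sum λ v → w u v)     ∎
    where
    E = sum λ u → sum λ v → e u v
    edgeSum≡ : edgeSum G ≡ E
    edgeSum≡ = ≡.trans
      (sumList-filter (λ (u , v) → (u Fin.<? v) ×-dec adj? u v) (λ (u , v) → weight (c G u v))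
        (List.cartesianProduct (List.allFin n) (List.allFin n)))
      (sumList-allFin² (λ (u , v) → e u v))

-- Double sums, indicator vectors and quadratic forms

module DoubleSums (K : ArchimedeanRing) where
  open ArchimedeanRing K
  open ArchimedeanRingProperties K

  private
    variable
      n : ℕ

  ∑∑ : (Fin n → Fin n → Carrier) → Carrier
  ∑∑ f = sum λ u → sum λ v → f u v

  ∑∑-cong : ∀ {f g : Fin n → Fin n → Carrier} → (∀ u v → f u v ≈ g u v) → ∑∑ f ≈ ∑∑ g
  ∑∑-cong h = sum-cong λ u → sum-cong (h u)

  ∑∑-+ : ∀ (f g : Fin n → Fin n → Carrier) → ∑∑ (λ u v → f u v + g u v) ≈ ∑∑ f + ∑∑ g
  ∑∑-+ f g = trans (sum-cong λ u → sum-+ (f u) (g u)) (sum-+ _ _)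

  ∑∑-* : ∀ t (f : Fin n → Fin n → Carrier) → ∑∑ (λ u v → t * f u v) ≈ t * ∑∑ f
  ∑∑-* t f = sym (trans (sum-*ˡ t _) (sum-cong λ u → sum-*ˡ t (f u)))

  ∑∑-mono : ∀ {f g : Fin n → Fin n → Carrier} → (∀ u v → f u v ≤ g u v) → ∑∑ f ≤ ∑∑ g
  ∑∑-mono h = sum-mono λ u → sum-mono (h u)

  ∑∑-nonNeg : ∀ (f : Fin n → Fin n → Carrier) → (∀ u v → 0# ≤ f u v) → 0# ≤ ∑∑ f
  ∑∑-nonNeg f h = sum-nonNeg _ λ u → sum-nonNeg _ (h u)

  ∑∑-nonNeg-≈0 : ∀ (f : Fin n → Fin n → Carrier) → (∀ u v → 0# ≤ f u v) → ∑∑ f ≈ 0# → ∀ u v → f u v ≈ 0#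
  ∑∑-nonNeg-≈0 f h eq u = sum-nonNeg-≈0 _ (h u) (sum-nonNeg-≈0 _ (λ u → sum-nonNeg _ (h u)) eq u)

  ∑∑-product : ∀ (f g : Fin n → Carrier) → ∑∑ (λ u v → f u * g v) ≈ sum f * sum g
  ∑∑-product f g = sym (trans (sum-*ʳ (sum g) f) (sum-cong λ u → sum-*ˡ (f u) g))

  sum-ι : ∀ (f : Fin n → ℚ) → ι (ListSums.sum f) ≈ sum (ι ∘ f)
  sum-ι {zero}  f = trans ι-0 (sym (reflexive (sum-zero _)))
  sum-ι {suc n} f = trans (ι-+ (f Fin.zero) _)
    (trans (+-congˡ (sum-ι (f ∘ Fin.suc))) (sym (reflexive (sum-suc _))))

  ∑∑-ι : ∀ (f : Fin n → Fin n → ℚ) →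
    ι (ListSums.sum λ u → ListSums.sum λ v → f u v) ≈ ∑∑ λ u v → ι (f u v)
  ∑∑-ι f = trans (sum-ι _) (sum-cong λ u → sum-ι (f u))

  -- The Kronecker delta; partially applied, `e u` is a standard basis vector.
  e : Fin n → Fin n → Carrier
  e u v = if does (u Fin.≟ v) then 1# else 0#

  e-≡ : ∀ (u : Fin n) → e u u ≈ 1#
  e-≡ u with u Fin.≟ u
  ... | yes _  = refl
  ... | no u≢u = ⊥-elim (u≢u ≡.refl)

  e-≢ : ∀ {u v : Fin n} → u ≢ v → e u v ≈ 0#
  e-≢ {u = u} {v} u≢v with u Fin.≟ v
  ... | yes u≡v = ⊥-elim (u≢v u≡v)
  ... | no _    = refl

  sum-e : ∀ (u : Fin n) (f : Fin n → Carrier) → sum (λ v → e u v * f v) ≈ f u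
  sum-e Fin.zero    f = trans (reflexive (sum-suc _))
    (trans (+-cong (*-identityˡ _) (sum-≈0 λ v → zeroˡ (f (Fin.suc v)))) (+-identityʳ _))
  sum-e (Fin.suc u) f = trans (reflexive (sum-suc _))
    (trans (+-cong (zeroˡ _) (sum-e u (f ∘ Fin.suc))) (+-identityˡ _))

  indicator : Subset n → Fin n → Carrier
  indicator S v = if does (v ∈? S) then 1# else 0#

  indicator-∈ : ∀ {S : Subset n} {v} → v ∈ S → indicator S v ≈ 1#
  indicator-∈ {S = S} {v} v∈S with v ∈? S
  ... | yes _  = refl
  ... | no v∉S = ⊥-elim (v∉S v∈S)

  indicator-∉ : ∀ {S : Subset n} {v} → v ∉ S → indicator S v ≈ 0#
  indicator-∉ {S = S} {v} v∉S with v ∈? S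
  ... | yes v∈S = ⊥-elim (v∉S v∈S)
  ... | no _    = refl

  indicator-nonNeg : ∀ (S : Subset n) v → 0# ≤ indicator S v
  indicator-nonNeg S v with v ∈? S
  ... | yes _ = ≤-respʳ ι-1 (ι-nonNeg (ℚ.<⇒≤ (ℚ.positive⁻¹ 1ℚ)))
  ... | no  _ = ≤-refl

  sum-indicator : ∀ (S : Subset n) → sum (indicator S) ≈ ι (fromℕ ∣ S ∣)
  sum-indicator [] = trans (reflexive (sum-zero _)) (sym ι-0)
  sum-indicator (outside ∷ S) = trans (reflexive (sum-suc _)) (trans (+-identityˡ _) (sum-indicator S))
  sum-indicator (inside ∷ S) = trans (reflexive (sum-suc _)) (trans (+-cong (sym ι-1) (sum-indicator S))
    (trans (sym (ι-+ 1ℚ (fromℕ ∣ S ∣))) (ι-cong (≡.sym (fromℕ-suc ∣ S ∣)))))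

module QuadraticForm (K : ArchimedeanRing) {n : ℕ} (h : Fin n → Fin n → ℚ) (h-sym : ∀ u v → h u v ≡ h v u) where
  open ArchimedeanRing K
  open ArchimedeanRingProperties K
  open DoubleSums K
  open Solver using (solve; _:=_; _:+_; _:*_)
  open import Relation.Binary.Reasoning.Setoid setoid

  V : Set
  V = Fin n → Carrier

  infixl 6 _⊕_
  infixl 7 _⊛_
  _⊕_ : V → V → V
  (x ⊕ y) i = x i + y i

  _⊛_ : Carrier → V → V
  (t ⊛ x) i = t * x i

  B : V → V → Carrier
  B x y = ∑∑ λ u v → ι (h u v) * (x u * y v)

  Q : V → Carrier
  Q x = B x x

  B-sym : ∀ x y → B x y ≈ B y x
  B-sym x y = trans (∑∑-cong λ u v → *-cong (ι-cong (h-sym u v)) (*-comm (x u) (y v)))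
    (sum-comm λ u v → ι (h v u) * (y v * x u))

  B-⊕ˡ : ∀ x y z → B (x ⊕ y) z ≈ B x z + B y z
  B-⊕ˡ x y z = trans
    (∑∑-cong λ u v → solve 4 (λ h x y z → h :* ((x :+ y) :* z) := h :* (x :* z) :+ h :* (y :* z))
      refl (ι (h u v)) (x u) (y u) (z v))
    (∑∑-+ _ _)

  B-⊕ʳ : ∀ x y z → B x (y ⊕ z) ≈ B x y + B x z
  B-⊕ʳ x y z = trans (B-sym x (y ⊕ z)) (trans (B-⊕ˡ y z x) (+-cong (B-sym y x) (B-sym z x)))

  B-⊛ˡ : ∀ t x z → B (t ⊛ x) z ≈ t * B x z
  B-⊛ˡ t x z = trans
    (∑∑-cong λ u v → solve 4 (λ h t x z → h :* ((t :* x) :* z) := t :* (h :* (x :* z)))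
      refl (ι (h u v)) t (x u) (z v))
    (∑∑-* t _)

  B-⊛ʳ : ∀ t x z → B x (t ⊛ z) ≈ t * B x z
  B-⊛ʳ t x z = trans (B-sym x (t ⊛ z)) (trans (B-⊛ˡ t z x) (*-congˡ (B-sym z x)))

  B-e : ∀ u v → B (e u) (e v) ≈ ι (h u v)
  B-e u v = begin
    (sum λ i → sum λ j → ι (h i j) * (e u i * e v j))
      ≈⟨ ∑∑-cong (λ i j → solve 3 (λ h a b → h :* (a :* b) := a :* (b :* h)) refl (ι (h i j)) (e u i) (e v j)) ⟩
    (sum λ i → sum λ j → e u i * (e v j * ι (h i j)))
      ≈⟨ sum-cong (λ i → trans (sym (sum-*ˡ (e u i) (λ j → e v j * ι (h i j))))
           (*-congˡ (sum-e v (λ j → ι (h i j))))) ⟩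
    (sum λ i → e u i * ι (h i v))
      ≈⟨ sum-e u (λ i → ι (h i v)) ⟩
    ι (h u v) ∎

  Q-⊕ : ∀ x y → Q (x ⊕ y) ≈ Q x + (B x y + B x y) + Q y
  Q-⊕ x y = begin
    B (x ⊕ y) (x ⊕ y)                  ≈⟨ B-⊕ˡ x y (x ⊕ y) ⟩
    B x (x ⊕ y) + B y (x ⊕ y)          ≈⟨ +-cong (B-⊕ʳ x x y) (B-⊕ʳ y x y) ⟩
    (B x x + B x y) + (B y x + B y y)  ≈⟨ +-congˡ (+-congʳ (B-sym y x)) ⟩
    (B x x + B x y) + (B x y + B y y)  ≈⟨ solve 3 (λ a b d → (a :+ b) :+ (b :+ d) := a :+ (b :+ b) :+ d) refl _ _ _ ⟩
    Q x + (B x y + B x y) + Q y        ∎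

  Q-⊛ : ∀ t x → Q (t ⊛ x) ≈ t * t * Q x
  Q-⊛ t x = trans (B-⊛ˡ t x (t ⊛ x)) (trans (*-congˡ (B-⊛ʳ t x x)) (sym (*-assoc t t (Q x))))

  Q-along : ∀ x t d → Q (x ⊕ t ⊛ d) ≈ Q x + t * (B x d + B x d) + t * t * Q d
  Q-along x t d = trans (Q-⊕ x (t ⊛ d)) (+-cong (+-congˡ (trans
    (+-cong (B-⊛ʳ t x d) (B-⊛ʳ t x d)) (sym (distribˡ t _ _)))) (Q-⊛ t d))

-- The local Motzkin-Straus inequality and its equality case

module LocalMotzkinStraus (K : ArchimedeanRing) {n : ℕ} (G : Graph n) where
  open Graph G
  open CliqueNumber G
  open Weights
  open WeightMatrices G using (h; h-sym; h-diagonal; h-nonadj; h-adj; h≤1; -1≤h)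
  open ArchimedeanRing K
  open ArchimedeanRingProperties K
  open DoubleSums K
  open QuadraticForm K h h-sym
  open Solver using (solve; _:=_; _:+_; _:*_; :-_; con)
  open import Relation.Binary.Reasoning.Setoid setoid

  NonNeg : V → Set
  NonNeg y = ∀ i → 0# ≤ y i

  _SupportedOn_ : V → Subset n → Set
  y SupportedOn S = ∀ i → i ∉ S → y i ≈ 0#

  nonadjacentPair? : ∀ S → Dec (∃[ u ] ∃[ v ] (u ∈ S × v ∈ S × u ≢ v × ¬ Adj u v))
  nonadjacentPair? S = Fin.any? λ u → Fin.any? λ v →
    (u ∈? S) ×-dec (v ∈? S) ×-dec ¬? (u Fin.≟ v) ×-dec ¬? (adj? u v)

  -- Termwise form of the Motzkin–Straus inequality on a clique of order 1 + m;
  -- the terms without h sum to the same value on both sides.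
  clique-term : ∀ {S m} → IsClique G S → ∣ S ∣ ≡ suc m → ∀ {y} → NonNeg y → y SupportedOn S → ∀ u v →
    ι (fromℕ (suc m)) * (e u v * (y u * y v)) + ι (fromℕ (suc m)) * (e u v * (y u * y v))
    ≤ (ι (fromℕ m) * (ι (h u v) * (y u * y v)) + ι (fromℕ m) * (ι (h u v) * (y u * y v)))
      + (y u * y u * indicator S v + indicator S u * (y v * y v))
  clique-term {S} {m} clique ∣S∣≡ {y} 0≤y supp u v with u Fin.≟ v
  ... | yes ≡.refl = ≤-reflexive (begin
    N * (1# * (y u * y u)) + N * (1# * (y u * y u))
      ≈⟨ +-cong (*-congˡ (*-identityˡ _)) (*-congˡ (*-identityˡ _)) ⟩
    N * (y u * y u) + N * (y u * y u)
      ≈⟨ +-cong (*-congʳ N≈) (*-congʳ N≈) ⟩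
    (ι 1ℚ + M) * (y u * y u) + (ι 1ℚ + M) * (y u * y u)
      ≈⟨ solve 2 (λ m y → (con 1ℚ :+ m) :* (y :* y) :+ (con 1ℚ :+ m) :* (y :* y)
           := (m :* (con 1ℚ :* (y :* y)) :+ m :* (con 1ℚ :* (y :* y))) :+ (y :* y :+ y :* y)) refl M (y u) ⟩
    (M * (ι 1ℚ * (y u * y u)) + M * (ι 1ℚ * (y u * y u))) + (y u * y u + y u * y u)
      ≈⟨ +-cong (+-cong (*-congˡ (*-congʳ (ι-cong (≡.sym (h-diagonal u))))) (*-congˡ (*-congʳ (ι-cong (≡.sym (h-diagonal u))))))
           (+-cong (yyχ≈yy (u ∈? S)) (trans (yyχ≈yy (u ∈? S)) (*-comm _ _))) ⟩
    (M * (ι (h u u) * (y u * y u)) + M * (ι (h u u) * (y u * y u)))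
      + (y u * y u * indicator S u + indicator S u * (y u * y u)) ∎)
    where
    N = ι (fromℕ (suc m))
    M = ι (fromℕ m)
    N≈ : N ≈ ι 1ℚ + M
    N≈ = trans (ι-cong (fromℕ-suc m)) (ι-+ 1ℚ (fromℕ m))
    yyχ≈yy : Dec (u ∈ S) → y u * y u ≈ y u * y u * indicator S u
    yyχ≈yy (yes u∈S) = sym (trans (*-congˡ (indicator-∈ u∈S)) (*-identityʳ _))
    yyχ≈yy (no u∉S)  = trans yy≈0 (sym (trans (*-congʳ yy≈0) (zeroˡ _)))
      where
      yy≈0 : y u * y u ≈ 0#
      yy≈0 = trans (*-congʳ (supp u u∉S)) (zeroˡ _)
  ... | no u≢v = ≤-respˡ (sym lhs≈0) (nonNeg (u ∈? S) (v ∈? S))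
    where
    N = ι (fromℕ (suc m))
    M = ι (fromℕ m)
    H = ι (h u v)
    lhs≈0 : N * (0# * (y u * y v)) + N * (0# * (y u * y v)) ≈ 0#
    lhs≈0 = trans (+-cong p p) (+-identityʳ 0#)
      where
      p : N * (0# * (y u * y v)) ≈ 0#
      p = trans (*-congˡ (zeroˡ _)) (zeroʳ N)
    degenerate : y u * y v ≈ 0# →
      0# ≤ (M * (H * (y u * y v)) + M * (H * (y u * y v))) + (y u * y u * indicator S v + indicator S u * (y v * y v))
    degenerate yy≈0 = +-nonNeg (≤-reflexive (sym (trans (+-cong p p) (+-identityʳ 0#))))
      (+-nonNeg (*-nonNeg (square-nonNeg (y u)) (indicator-nonNeg S v))
                (*-nonNeg (indicator-nonNeg S u) (square-nonNeg (y v))))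
      where
      p : M * (H * (y u * y v)) ≈ 0#
      p = trans (*-congˡ (trans (*-congˡ yy≈0) (zeroʳ H))) (zeroʳ M)
    nonNeg : Dec (u ∈ S) → Dec (v ∈ S) →
      0# ≤ (M * (H * (y u * y v)) + M * (H * (y u * y v))) + (y u * y u * indicator S v + indicator S u * (y v * y v))
    nonNeg (no u∉S) _        = degenerate (trans (*-congʳ (supp u u∉S)) (zeroˡ _))
    nonNeg (yes _)  (no v∉S) = degenerate (trans (*-congˡ (supp v v∉S)) (zeroʳ _))
    -- Here y_u² + y_v² - 2 M X y_u y_v is written as (y_u - y_v)² + 2 (1 - M X) y_u y_v. Since S is
    -- itself a clique through the edge, c - 1 ≥ m, that is, M X ≤ 1.
    nonNeg (yes u∈S) (yes v∈S) = ≤-respʳ (begin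
        ((y u + - y v) * (y u + - y v) + ((ι 1ℚ + - (M * X)) * (y u * y v) + (ι 1ℚ + - (M * X)) * (y u * y v)))
          ≈⟨ solve 4 (λ a b m x →
               (a :+ :- b) :* (a :+ :- b) :+ ((con 1ℚ :+ :- (m :* x)) :* (a :* b) :+ (con 1ℚ :+ :- (m :* x)) :* (a :* b))
               := (m :* (:- x :* (a :* b)) :+ m :* (:- x :* (a :* b))) :+ (a :* a :* con 1ℚ :+ con 1ℚ :* (b :* b)))
               refl (y u) (y v) M X ⟩
        (M * (- X * (y u * y v)) + M * (- X * (y u * y v))) + (y u * y u * ι 1ℚ + ι 1ℚ * (y v * y v))
          ≈⟨ +-cong (+-cong (*-congˡ (*-congʳ -X≈H)) (*-congˡ (*-congʳ -X≈H)))
               (+-cong (*-congˡ (trans ι-1 (sym (indicator-∈ v∈S)))) (*-congʳ (trans ι-1 (sym (indicator-∈ u∈S))))) ⟩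
        (M * (H * (y u * y v)) + M * (H * (y u * y v))) + (y u * y u * indicator S v + indicator S u * (y v * y v)) ∎)
      (+-nonNeg (square-nonNeg _) (+-nonNeg (*-nonNeg 0≤1-MX (*-nonNeg (0≤y u) (0≤y v))) (*-nonNeg 0≤1-MX (*-nonNeg (0≤y u) (0≤y v)))))
      where
      x = excess (c G u v)
      X = ι x
      -X≈H : - X ≈ H
      -X≈H = trans (sym (ι-neg x)) (ι-cong (≡.sym (h-adj (clique u v u∈S v∈S u≢v))))
      0≤1-MX : 0# ≤ ι 1ℚ + - (M * X)
      0≤1-MX = ≤⇒0≤- (≤-respˡ (ι-* (fromℕ m) x) (ι-mono (*-excess≤1
        (≡.subst (ℕ._≤ c G u v) ∣S∣≡ (clique-size≤c clique u∈S v∈S)))))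

  2*-cancel-nonNeg : ∀ {x} → 0# ≤ x + x → 0# ≤ x
  2*-cancel-nonNeg {x} h = ≤-cases ≤-stable 0# x (λ p → p) λ x≤0 →
    ≤-trans h (≤-respʳ (+-identityʳ x) (+-mono-≤ ≤-refl x≤0))

  -- Summing `clique-term` bounds (|S| - 1) Q from below, and the factor can be cancelled only if
  -- |S| ≥ 2. In smaller cliques no off-diagonal product survives, and the diagonal of h is 1.
  clique-nonNeg : ∀ {S} → IsClique G S → ∀ {y} → NonNeg y → y SupportedOn S → 0# ≤ Q y
  clique-nonNeg {S} clique {y} 0≤y supp = bySize ∣ S ∣ ≡.refl
    where
    small : ∣ S ∣ ℕ.≤ 1 → 0# ≤ Q y
    small ∣S∣≤1 = ∑∑-nonNeg _ λ u v → term u v (u Fin.≟ v) (u ∈? S) (v ∈? S)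
      where
      zero-term : ∀ u v → y u * y v ≈ 0# → 0# ≤ ι (h u v) * (y u * y v)
      zero-term u v yy≈0 = ≤-reflexive (sym (trans (*-congˡ yy≈0) (zeroʳ _)))
      term : ∀ u v → Dec (u ≡ v) → Dec (u ∈ S) → Dec (v ∈ S) → 0# ≤ ι (h u v) * (y u * y v)
      term u v (yes ≡.refl) _ _ = *-nonNeg
        (ι-nonNeg (≡.subst (0ℚ ℚ.≤_) (≡.sym (h-diagonal u)) (ℚ.<⇒≤ (ℚ.positive⁻¹ 1ℚ)))) (square-nonNeg (y u))
      term u v (no _) (no u∉S) _ = zero-term u v (trans (*-congʳ (supp u u∉S)) (zeroˡ _))
      term u v (no _) (yes _) (no v∉S) = zero-term u v (trans (*-congˡ (supp v v∉S)) (zeroʳ _))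
      term u v (no u≢v) (yes u∈S) (yes v∈S) = ⊥-elim (ℕ.<⇒≱ (∈∧≢⇒2≤∣∣ u∈S v∈S u≢v) ∣S∣≤1)

    large : ∀ m → ∣ S ∣ ≡ suc (suc m) → 0# ≤ Q y
    large m ∣S∣≡ = *-cancelˡ-nonNeg {M} (ι-nonNeg (fromℕ-nonNeg (suc m)))
      (λ M≈0 → ℕ.1+n≢0 (fromℕ-injective {suc m} {0} (ι-0⇒≡0 M≈0)))
      (2*-cancel-nonNeg (≤-respʳ (solve 2 (λ q r → (q :+ r) :+ :- r := q) refl _ _)
        (≤⇒0≤- (≤-respˡ lhs (≤-respʳ rhs (∑∑-mono (clique-term clique ∣S∣≡ 0≤y supp)))))))
      where
      M = ι (fromℕ (suc m))
      N = ι (fromℕ (suc (suc m)))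
      Y = sum λ u → y u * y u
      ∑χ≈N : sum (indicator S) ≈ N
      ∑χ≈N = trans (sum-indicator S) (ι-cong (≡.cong fromℕ ∣S∣≡))
      ∑∑e : ∑∑ (λ u v → N * (e u v * (y u * y v))) ≈ N * Y
      ∑∑e = trans (∑∑-* N _) (*-congˡ (sum-cong λ u → sum-e u (λ v → y u * y v)))
      lhs : ∑∑ (λ u v → N * (e u v * (y u * y v)) + N * (e u v * (y u * y v))) ≈ N * Y + N * Y
      lhs = trans (∑∑-+ _ _) (+-cong ∑∑e ∑∑e)
      rhs : ∑∑ (λ u v → (M * (ι (h u v) * (y u * y v)) + M * (ι (h u v) * (y u * y v)))
                 + (y u * y u * indicator S v + indicator S u * (y v * y v)))
            ≈ (M * Q y + M * Q y) + (N * Y + N * Y)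
      rhs = trans (∑∑-+ _ _) (+-cong
        (trans (∑∑-+ _ _) (+-cong (∑∑-* M _) (∑∑-* M _)))
        (trans (∑∑-+ _ _) (+-cong
          (trans (∑∑-product (λ u → y u * y u) (indicator S)) (trans (*-congˡ ∑χ≈N) (*-comm Y N)))
          (trans (∑∑-product (indicator S) (λ v → y v * y v)) (*-congʳ ∑χ≈N)))))

    bySize : ∀ k → ∣ S ∣ ≡ k → 0# ≤ Q y
    bySize zero          eq = small (ℕ.≤-trans (ℕ.≤-reflexive eq) z≤n)
    bySize (suc zero)    eq = small (ℕ.≤-reflexive eq)
    bySize (suc (suc m)) eq = large m eq

  difference : Fin n → Fin n → V
  difference u v = e u ⊕ ι (ℚ.- 1ℚ) ⊛ e v

  transfer : V → Fin n → Fin n → Carrier → V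
  transfer y u v t = y ⊕ t ⊛ difference u v

  module _ (y : V) {u v : Fin n} (u≢v : u ≢ v) (t : Carrier) where
    private
      simplify : ∀ i {a b} → e u i ≈ a → e v i ≈ b → transfer y u v t i ≈ y i + t * (a + ι (ℚ.- 1ℚ) * b)
      simplify i p q = +-congˡ (*-congˡ (+-cong p (*-congˡ q)))

    transfer-source : transfer y u v t u ≈ y u + t
    transfer-source = trans (simplify u (trans (e-≡ u) (sym ι-1)) (trans (e-≢ (u≢v ∘ ≡.sym)) (sym ι-0)))
      (solve 2 (λ y t → y :+ t :* (con 1ℚ :+ con (ℚ.- 1ℚ) :* con 0ℚ) := y :+ t) refl (y u) t)

    transfer-target : transfer y u v t v ≈ y v + - t
    transfer-target = trans (simplify v (trans (e-≢ u≢v) (sym ι-0)) (trans (e-≡ v) (sym ι-1)))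
      (solve 2 (λ y t → y :+ t :* (con 0ℚ :+ con (ℚ.- 1ℚ) :* con 1ℚ) := y :+ :- t) refl (y v) t)

    transfer-other : ∀ {i} → u ≢ i → v ≢ i → transfer y u v t i ≈ y i
    transfer-other {i} u≢i v≢i = trans (simplify i (trans (e-≢ u≢i) (sym ι-0)) (trans (e-≢ v≢i) (sym ι-0)))
      (solve 2 (λ y t → y :+ t :* (con 0ℚ :+ con (ℚ.- 1ℚ) :* con 0ℚ) := y) refl (y i) t)

    transfer-nonNeg : NonNeg y → 0# ≤ y u + t → 0# ≤ y v + - t → NonNeg (transfer y u v t)
    transfer-nonNeg 0≤y 0≤u 0≤v i = cases (u Fin.≟ i) (v Fin.≟ i)
      where
      cases : Dec (u ≡ i) → Dec (v ≡ i) → 0# ≤ transfer y u v t i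
      cases (yes ≡.refl) _          = ≤-respʳ (sym transfer-source) 0≤u
      cases (no _)       (yes ≡.refl) = ≤-respʳ (sym transfer-target) 0≤v
      cases (no u≢i)     (no v≢i)     = ≤-respʳ (sym (transfer-other u≢i v≢i)) (0≤y i)

    transfer-supported : ∀ {S w} → u ∈ S → v ∈ S → y SupportedOn S → transfer y u v t w ≈ 0# →
      transfer y u v t SupportedOn (S ∖ w)
    transfer-supported {S} {w} u∈S v∈S supp w≈0 i i∉ with i Fin.≟ w
    ... | yes ≡.refl = w≈0
    ... | no i≢w     = trans (transfer-other (λ { ≡.refl → i∉S u∈S }) (λ { ≡.refl → i∉S v∈S })) (supp i i∉S)
      where
      i∉S : i ∉ S
      i∉S i∈S = i∉ (x∈p∧x≢y⇒x∈p-y i∈S i≢w)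

  Q-difference : ∀ {u v} → ¬ Adj u v → Q (difference u v) ≈ 0#
  Q-difference {u} {v} ¬uv = begin
    Q (difference u v)
      ≈⟨ Q-along (e u) (ι (ℚ.- 1ℚ)) (e v) ⟩
    Q (e u) + ι (ℚ.- 1ℚ) * (B (e u) (e v) + B (e u) (e v)) + ι (ℚ.- 1ℚ) * ι (ℚ.- 1ℚ) * Q (e v)
      ≈⟨ +-cong (+-cong (Qe≈1 u) (*-congˡ (+-cong Buv Buv))) (*-congˡ (Qe≈1 v)) ⟩
    ι 1ℚ + ι (ℚ.- 1ℚ) * (ι 1ℚ + ι 1ℚ) + ι (ℚ.- 1ℚ) * ι (ℚ.- 1ℚ) * ι 1ℚ
      ≈⟨ solve 0 (con 1ℚ :+ con (ℚ.- 1ℚ) :* (con 1ℚ :+ con 1ℚ) :+ con (ℚ.- 1ℚ) :* con (ℚ.- 1ℚ) :* con 1ℚ := con 0ℚ) refl ⟩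
    ι 0ℚ
      ≈⟨ ι-0 ⟩
    0# ∎
    where
    Qe≈1 : ∀ i → Q (e i) ≈ ι 1ℚ
    Qe≈1 i = trans (B-e i i) (ι-cong (h-diagonal i))
    Buv : B (e u) (e v) ≈ ι 1ℚ
    Buv = trans (B-e u v) (ι-cong (h-nonadj ¬uv))

  -- Moving weight between two nonadjacent vertices changes Q affinely.
  Q-transfer : ∀ y {u v} → ¬ Adj u v →
    y u * Q (transfer y u v (y v)) + y v * Q (transfer y u v (- y u)) ≈ (y u + y v) * Q y
  Q-transfer y {u} {v} ¬uv = begin
    y u * Q (transfer y u v (y v)) + y v * Q (transfer y u v (- y u))
      ≈⟨ +-cong (*-congˡ (affine (y v))) (*-congˡ (affine (- y u))) ⟩
    y u * (Q y + y v * b) + y v * (Q y + - y u * b)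
      ≈⟨ solve 4 (λ p q c b → p :* (c :+ q :* b) :+ q :* (c :+ :- p :* b) := (p :+ q) :* c) refl (y u) (y v) (Q y) b ⟩
    (y u + y v) * Q y ∎
    where
    b = B y (difference u v) + B y (difference u v)
    affine : ∀ t → Q (transfer y u v t) ≈ Q y + t * b
    affine t = trans (Q-along y t (difference u v)) (trans (+-congˡ (trans (*-congˡ (Q-difference ¬uv)) (zeroʳ _))) (+-identityʳ _))

  copositive-supported : ∀ k S → ∣ S ∣ ℕ.< k → ∀ {y} → NonNeg y → y SupportedOn S → 0# ≤ Q y
  copositive-supported (suc k) S (s≤s ∣S∣≤k) {y} 0≤y supp with nonadjacentPair? S
  ... | no ¬pair = clique-nonNeg clique 0≤y supp
    where
    clique : IsClique G S
    clique u v u∈S v∈S u≢v = decidable-stable (adj? u v) λ ¬uv → ¬pair (u , v , u∈S , v∈S , u≢v , ¬uv)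
  ... | yes (u , v , u∈S , v∈S , u≢v , ¬uv) = ≤-stable λ ¬0≤Qy → ¬0≤Qy
    (*-cancelˡ-nonNeg (+-nonNeg (0≤y u) (0≤y v)) (¬0≤Qy ∘ degenerate) (≤-respʳ (Q-transfer y ¬uv)
      (+-nonNeg (*-nonNeg (0≤y u) 0≤Q₁) (*-nonNeg (0≤y v) 0≤Q₂))))
    where
    0≤Q₁ : 0# ≤ Q (transfer y u v (y v))
    0≤Q₁ = copositive-supported k (S ∖ v) (ℕ.<-≤-trans (x∈p⇒∣p-x∣<∣p∣ v∈S) ∣S∣≤k)
      (transfer-nonNeg y u≢v (y v) 0≤y (+-nonNeg (0≤y u) (0≤y v)) (≤-reflexive (sym (-‿inverseʳ (y v)))))
      (transfer-supported y u≢v (y v) u∈S v∈S supp (trans (transfer-target y u≢v (y v)) (-‿inverseʳ (y v))))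
    0≤Q₂ : 0# ≤ Q (transfer y u v (- y u))
    0≤Q₂ = copositive-supported k (S ∖ u) (ℕ.<-≤-trans (x∈p⇒∣p-x∣<∣p∣ u∈S) ∣S∣≤k)
      (transfer-nonNeg y u≢v (- y u) 0≤y (≤-reflexive (sym (-‿inverseʳ (y u))))
        (≤-respʳ (+-congˡ (sym (-neg (y u)))) (+-nonNeg (0≤y v) (0≤y u))))
      (transfer-supported y u≢v (- y u) u∈S v∈S supp (trans (transfer-source y u≢v (- y u)) (-‿inverseʳ (y u))))
    degenerate : y u + y v ≈ 0# → 0# ≤ Q y
    degenerate p≈0 = copositive-supported k (S ∖ u) (ℕ.<-≤-trans (x∈p⇒∣p-x∣<∣p∣ u∈S) ∣S∣≤k) 0≤y supp′
      where
      supp′ : y SupportedOn (S ∖ u)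
      supp′ i i∉ with i Fin.≟ u
      ... | yes ≡.refl = +-nonNeg-≈0ˡ (0≤y u) (0≤y v) p≈0
      ... | no i≢u     = supp i λ i∈S → i∉ (x∈p∧x≢y⇒x∈p-y i∈S i≢u)

  copositive : ∀ {y} → NonNeg y → 0# ≤ Q y
  copositive 0≤y = copositive-supported (suc n) ⊤ (s≤s (∣p∣≤n ⊤)) 0≤y λ i i∉⊤ → ⊥-elim (i∉⊤ ∈⊤)

  module _ {y : V} (0≤y : NonNeg y) (Qy≈0 : Q y ≈ 0#) {u v : Fin n} (¬uv : ¬ Adj u v) (z : Fin n) where
    private
      r : ℚ
      r = h u z ℚ.- h v z
      R : Carrier
      R = ι r
      d : V
      d = difference u v ⊕ (- R) ⊛ e z

    -- As Q vanishes at `difference u v`, its value at `difference u v` - t e_z is t² - 2 t r. The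
    -- choice t = r minimises it, and makes it negative unless r = 0.
    Q-d : Q d ≈ - (R * R)
    Q-d = begin
      Q d
        ≈⟨ Q-along (difference u v) (- R) (e z) ⟩
      Q (difference u v) + (- R) * (B (difference u v) (e z) + B (difference u v) (e z)) + (- R) * (- R) * Q (e z)
        ≈⟨ +-cong (+-cong (trans (Q-difference ¬uv) (sym ι-0)) (*-congˡ (+-cong Bdz Bdz))) (*-congˡ (trans (B-e z z) (ι-cong (h-diagonal z)))) ⟩
      ι 0ℚ + (- R) * (R + R) + (- R) * (- R) * ι 1ℚ
        ≈⟨ solve 1 (λ r → con 0ℚ :+ (:- r) :* (r :+ r) :+ (:- r) :* (:- r) :* con 1ℚ := :- (r :* r)) refl R ⟩
      - (R * R) ∎
      where
      Bdz : B (difference u v) (e z) ≈ R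
      Bdz = begin
        B (difference u v) (e z)                     ≈⟨ B-⊕ˡ (e u) (ι (ℚ.- 1ℚ) ⊛ e v) (e z) ⟩
        B (e u) (e z) + B (ι (ℚ.- 1ℚ) ⊛ e v) (e z)
          ≈⟨ +-cong (B-e u z) (trans (B-⊛ˡ (ι (ℚ.- 1ℚ)) (e v) (e z)) (*-congˡ (B-e v z))) ⟩
        ι (h u z) + ι (ℚ.- 1ℚ) * ι (h v z)     ≈⟨ solve 2 (λ a b → a :+ con (ℚ.- 1ℚ) :* b := a :+ :- b) refl _ _ ⟩
        ι (h u z) + - ι (h v z)                ≈⟨ +-congˡ (sym (ι-neg (h v z))) ⟩
        ι (h u z) + ι (ℚ.- h v z)              ≈⟨ sym (ι-+ (h u z) (ℚ.- h v z)) ⟩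
        R                                      ∎

    -- 4 y ± s d is a nonnegative vector, so by the parallelogram law
    -- 0 ≤ Q (4 y + s d) + Q (4 y - s d) = 2 s² Q d = - 2 s² r².
    private module Perturb {s : Carrier} (0≤s : 0# ≤ s) (s≉0 : ¬ (s ≈ 0#)) (s≤u : s ≤ y u) (s≤v : s ≤ y v) (s≤z : s ≤ y z) where
      2ℚ 4ℚ : ℚ
      2ℚ = 1ℚ ℚ.+ 1ℚ
      4ℚ = 2ℚ ℚ.+ 2ℚ

      dominated : ∀ w → s ≤ y w → ∀ i → 0# ≤ y i + - (s * e w i)
      dominated w s≤w i = cases (w Fin.≟ i)
        where
        cases : Dec (w ≡ i) → 0# ≤ y i + - (s * e w i)
        cases (yes ≡.refl) = ≤-respʳ (+-congˡ (-‿cong (sym (trans (*-congˡ (e-≡ w)) (*-identityʳ s))))) (≤⇒0≤- s≤w)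
        cases (no w≢i) = ≤-respʳ (sym (trans (+-congˡ (-‿cong (trans (*-congˡ (e-≢ w≢i)) (zeroʳ s))))
          (trans (+-congˡ -0≈0) (+-identityʳ _)))) (0≤y i)

      e-nonNeg : ∀ w i → 0# ≤ e {n} w i
      e-nonNeg w i = cases (w Fin.≟ i)
        where
        cases : Dec (w ≡ i) → 0# ≤ e w i
        cases (yes ≡.refl) = ≤-respʳ (sym (trans (e-≡ w) (sym ι-1))) (ι-nonNeg (ℚ.<⇒≤ (ℚ.positive⁻¹ 1ℚ)))
        cases (no w≢i) = ≤-reflexive (sym (e-≢ w≢i))

      0≤2-R : 0# ≤ ι 2ℚ + - R
      0≤2-R = ≤⇒0≤- (ι-mono (ℚ.+-mono-≤ (h≤1 u z) (ℚ.neg-antimono-≤ (-1≤h v z))))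

      0≤2+R : 0# ≤ ι 2ℚ + R
      0≤2+R = ≤-respʳ (trans (ι-+ 2ℚ r) refl) (ι-nonNeg (ℚ.≤-trans
        (ℚ.≤-reflexive (≡.sym (ℚ.+-inverseʳ 2ℚ)))
        (ℚ.+-monoʳ-≤ 2ℚ (ℚ.+-mono-≤ (-1≤h u z) (ℚ.neg-antimono-≤ (h≤1 v z))))))

      0≤2 : 0# ≤ ι 2ℚ
      0≤2 = ι-nonNeg (ℚ.<⇒≤ (ℚ.positive⁻¹ 2ℚ))

      -- The 4 in 4 y is 1 + 1 + 2: entries of h lie in [-1, 1], so d has coefficients 1, -1 and -r
      -- with |r| ≤ 2. One copy of y pays for e_u, one for e_v and two for e_z, which also covers
      -- coincidences among u, v and z.
      common : ∀ i → 0# ≤ ι 2ℚ * (y i + - (s * e z i)) + (y i + - (s * e u i)) + (y i + - (s * e v i))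
      common i = +-nonNeg (+-nonNeg (*-nonNeg 0≤2 (dominated z s≤z i)) (dominated u s≤u i)) (dominated v s≤v i)

      plus-nonNeg : NonNeg (ι 4ℚ ⊛ y ⊕ s ⊛ d)
      plus-nonNeg i = ≤-respʳ
        (solve 6 (λ y s a b c r →
          (con 2ℚ :* (y :+ :- (s :* c)) :+ (y :+ :- (s :* a)) :+ (y :+ :- (s :* b))) :+ ((con 2ℚ :+ :- r) :* (s :* c) :+ con 2ℚ :* (s :* a))
          := con 4ℚ :* y :+ s :* ((a :+ con (ℚ.- 1ℚ) :* b) :+ (:- r) :* c)) refl (y i) s (e u i) (e v i) (e z i) R)
        (+-nonNeg (common i) (+-nonNeg (*-nonNeg 0≤2-R (*-nonNeg 0≤s (e-nonNeg z i))) (*-nonNeg 0≤2 (*-nonNeg 0≤s (e-nonNeg u i)))))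

      minus-nonNeg : NonNeg (ι 4ℚ ⊛ y ⊕ (- s) ⊛ d)
      minus-nonNeg i = ≤-respʳ
        (solve 6 (λ y s a b c r →
          (con 2ℚ :* (y :+ :- (s :* c)) :+ (y :+ :- (s :* a)) :+ (y :+ :- (s :* b))) :+ ((con 2ℚ :+ r) :* (s :* c) :+ con 2ℚ :* (s :* b))
          := con 4ℚ :* y :+ (:- s) :* ((a :+ con (ℚ.- 1ℚ) :* b) :+ (:- r) :* c)) refl (y i) s (e u i) (e v i) (e z i) R)
        (+-nonNeg (common i) (+-nonNeg (*-nonNeg 0≤2+R (*-nonNeg 0≤s (e-nonNeg z i))) (*-nonNeg 0≤2 (*-nonNeg 0≤s (e-nonNeg v i)))))

      Q4y≈0 : Q (ι 4ℚ ⊛ y) ≈ ι 0ℚ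
      Q4y≈0 = trans (Q-⊛ (ι 4ℚ) y) (trans (*-congˡ Qy≈0) (trans (zeroʳ _) (sym ι-0)))

      parallelogram : Q (ι 4ℚ ⊛ y ⊕ s ⊛ d) + Q (ι 4ℚ ⊛ y ⊕ (- s) ⊛ d) ≈ - (s * R * (s * R) + s * R * (s * R))
      parallelogram = begin
        Q (ι 4ℚ ⊛ y ⊕ s ⊛ d) + Q (ι 4ℚ ⊛ y ⊕ (- s) ⊛ d)
          ≈⟨ +-cong (Q-along (ι 4ℚ ⊛ y) s d) (Q-along (ι 4ℚ ⊛ y) (- s) d) ⟩
        (Q (ι 4ℚ ⊛ y) + s * (b + b) + s * s * Q d) + (Q (ι 4ℚ ⊛ y) + (- s) * (b + b) + (- s) * (- s) * Q d)
          ≈⟨ +-cong (+-cong (+-congʳ Q4y≈0) (*-congˡ Q-d)) (+-cong (+-congʳ Q4y≈0) (*-congˡ Q-d)) ⟩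
        (ι 0ℚ + s * (b + b) + s * s * - (R * R)) + (ι 0ℚ + (- s) * (b + b) + (- s) * (- s) * - (R * R))
          ≈⟨ solve 3 (λ s b r → (con 0ℚ :+ s :* (b :+ b) :+ s :* s :* (:- (r :* r)))
               :+ (con 0ℚ :+ (:- s) :* (b :+ b) :+ (:- s) :* (:- s) :* (:- (r :* r)))
               := :- (s :* r :* (s :* r) :+ s :* r :* (s :* r))) refl s b R ⟩
        - (s * R * (s * R) + s * R * (s * R)) ∎
        where b = B (ι 4ℚ ⊛ y) d

      r≡0 : r ≡ 0ℚ
      r≡0 = ι-0⇒≡0 (zeroDivisorFree s≉0 (square≈0⇒≈0 (+-nonNeg-≈0ˡ (square-nonNeg (s * R)) (square-nonNeg (s * R))
        (≤-antisym (nonNeg-neg (≤-respʳ parallelogram (+-nonNeg (copositive plus-nonNeg) (copositive minus-nonNeg))))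
          (+-nonNeg (square-nonNeg (s * R)) (square-nonNeg (s * R)))))))

    -- At the zero y of a nonnegative form, with three nonzero entries, the direction d can be
    -- followed both ways by s, the least of the three. Which one is least cannot be decided, but
    -- the conclusion is an equation between rationals, so the case distinction is allowed.
    zero-twins : ¬ (y u ≈ 0#) → ¬ (y v ≈ 0#) → ¬ (y z ≈ 0#) → h u z ≡ h v z
    zero-twins u≉0 v≉0 z≉0 = ≡.trans (≡.sym (≡.trans (ℚ.+-assoc (h u z) _ _) (≡.trans (≡.cong (h u z ℚ.+_) (ℚ.+-inverseˡ (h v z))) (ℚ.+-identityʳ (h u z))))) (≡.trans (≡.cong (ℚ._+ h v z) r≡0) (ℚ.+-identityˡ (h v z)))
      where
      via : ∀ {w} → ¬ (y w ≈ 0#) → y w ≤ y u → y w ≤ y v → y w ≤ y z → r ≡ 0ℚ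
      via {w} w≉0 p q t = Perturb.r≡0 (0≤y w) w≉0 p q t
      stable : ¬ ¬ (r ≡ 0ℚ) → r ≡ 0ℚ
      stable = decidable-stable (r ℚ.≟ 0ℚ)
      r≡0 : r ≡ 0ℚ
      r≡0 = ≤-cases stable (y u) (y v)
        (λ u≤v → ≤-cases stable (y u) (y z)
          (λ u≤z → via u≉0 ≤-refl u≤v u≤z)
          (λ z≤u → via z≉0 z≤u (≤-trans z≤u u≤v) ≤-refl))
        (λ v≤u → ≤-cases stable (y v) (y z)
          (λ v≤z → via v≉0 v≤u ≤-refl v≤z)
          (λ z≤v → via z≉0 (≤-trans z≤v v≤u) z≤v ≤-refl))

-- The spectral bound and the equality conditions

module Spectral (K : ArchimedeanRing) {n : ℕ} (G : Graph n) where
  open Graph G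
  open WeightMatrices G
  open ArchimedeanRing K
  open ArchimedeanRingProperties K
  open DoubleSums K
  open QuadraticForm K h h-sym
  open LocalMotzkinStraus K G
  open Solver using (solve; _:=_; _:+_; _:*_; :-_; con)
  open import Relation.Binary.Reasoning.Setoid setoid

  A : Fin n → Fin n → Carrier
  A u v = if does (adj? u v) then 1# else 0#

  A≈a : ∀ u v → A u v ≈ ι (a u v)
  A≈a u v with adj? u v
  ... | yes _ = sym ι-1
  ... | no  _ = sym ι-0

  W : Carrier
  W = ∑∑ λ u v → ι (w u v)

  ι-w-nonNeg : ∀ u v → 0# ≤ ι (w u v)
  ι-w-nonNeg u v = ι-nonNeg (w-nonNeg u v)

  W-nonNeg : 0# ≤ W
  W-nonNeg = ∑∑-nonNeg _ ι-w-nonNeg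

  W≉0 : ∀ {u v} → Adj u v → ¬ (W ≈ 0#)
  W≉0 {u} {v} uv W≈0 = w-adj≢0 uv (ι-0⇒≡0 (∑∑-nonNeg-≈0 _ ι-w-nonNeg W≈0 u v))

  module Eigenpair {x : V} {lam : Carrier} (eigen : ∀ u → sum (λ v → A u v * x v) ≈ lam * x u) where

    N : Carrier
    N = sum λ u → x u * x u

    y : V
    y u = x u * x u

    y-nonNeg : NonNeg y
    y-nonNeg u = square-nonNeg (x u)

    p : Fin n → Fin n → Carrier
    p u v = x u * x v

    N≉0 : ¬ (∀ u → x u ≈ 0#) → ¬ (N ≈ 0#)
    N≉0 x≉0 N≈0 = x≉0 λ u → square≈0⇒≈0 (sum-nonNeg-≈0 y y-nonNeg N≈0 u)

    rayleigh : ∑∑ (λ u v → ι (a u v) * p u v) ≈ lam * N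
    rayleigh = begin
      ∑∑ (λ u v → ι (a u v) * (x u * x v))
        ≈⟨ ∑∑-cong (λ u v → trans (*-congʳ (sym (A≈a u v)))
             (solve 3 (λ a x y → a :* (x :* y) := x :* (a :* y)) refl (A u v) (x u) (x v))) ⟩
      ∑∑ (λ u v → x u * (A u v * x v))
        ≈⟨ sum-cong (λ u → trans (sym (sum-*ˡ (x u) (λ v → A u v * x v))) (*-congˡ (eigen u))) ⟩
      sum (λ u → x u * (lam * x u))
        ≈⟨ sum-cong (λ u → solve 2 (λ l x → x :* (l :* x) := l :* (x :* x)) refl lam (x u)) ⟩
      sum (λ u → lam * (x u * x u))
        ≈⟨ sum-*ˡ lam y ⟨
      lam * N ∎

    ι-g : ∀ u v → ι (g u v) ≈ ι 1ℚ + - ι (h u v)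
    ι-g u v = trans (ι-+ 1ℚ (ℚ.- h u v)) (+-congˡ (ι-neg (h u v)))

    ∑∑gpp : ∑∑ (λ u v → ι (g u v) * (p u v * p u v)) + Q y ≈ N * N
    ∑∑gpp = begin
      ∑∑ (λ u v → ι (g u v) * (p u v * p u v)) + Q y
        ≈⟨ ∑∑-+ _ _ ⟨
      ∑∑ (λ u v → ι (g u v) * (p u v * p u v) + ι (h u v) * (y u * y v))
        ≈⟨ ∑∑-cong (λ u v → trans (+-congʳ (*-congʳ (ι-g u v)))
             (solve 3 (λ h x z → (con 1ℚ :+ :- h) :* (x :* z :* (x :* z)) :+ h :* (x :* x :* (z :* z))
               := x :* x :* (z :* z)) refl (ι (h u v)) (x u) (x v))) ⟩
      ∑∑ (λ u v → y u * y v)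
        ≈⟨ ∑∑-product y y ⟩
      N * N ∎

    L : Carrier
    L = lam * N

    -- The equality condition of Cauchy-Schwarz: on edges p/w has to be constant, and summing p = t
    -- w gives t = L/W. Multiplying by W avoids the division.
    deviation : Fin n → Fin n → Carrier
    deviation u v = ι (g u v) * (W * p u v) + - L

    term : Fin n → Fin n → Carrier
    term u v = ι (w u v) * (deviation u v * deviation u v)

    term-nonNeg : ∀ u v → 0# ≤ term u v
    term-nonNeg u v = *-nonNeg (ι-w-nonNeg u v) (square-nonNeg (deviation u v))

    -- Of the two factors g in the square one is cleared by the weight: w g = a and a g = g.
    term-expand : ∀ u v → term u v ≈
      (W * W * (ι (g u v) * (p u v * p u v)) + - (W * L + W * L) * (ι (a u v) * p u v)) + L * L * ι (w u v)
    term-expand u v = begin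
      term u v
        ≈⟨ solve 5 (λ w g W p L → w :* ((g :* (W :* p) :+ :- L) :* (g :* (W :* p) :+ :- L))
             := (W :* W :* ((w :* g) :* g :* (p :* p)) :+ :- (W :* L :+ W :* L) :* ((w :* g) :* p)) :+ L :* L :* w)
             refl (ι (w u v)) (ι (g u v)) W (p u v) L ⟩
      (W * W * ((ι (w u v) * ι (g u v)) * ι (g u v) * (p u v * p u v)) + - (W * L + W * L) * ((ι (w u v) * ι (g u v)) * p u v)) + L * L * ι (w u v)
        ≈⟨ +-congʳ (+-cong (*-congˡ (*-congʳ (trans (*-congʳ wg≈a) (trans (sym (ι-* (a u v) (g u v))) (ι-cong (a*g≡g u v))))))
             (*-congˡ (*-congʳ wg≈a))) ⟩
      (W * W * (ι (g u v) * (p u v * p u v)) + - (W * L + W * L) * (ι (a u v) * p u v)) + L * L * ι (w u v) ∎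
      where
      wg≈a : ι (w u v) * ι (g u v) ≈ ι (a u v)
      wg≈a = trans (sym (ι-* (w u v) (g u v))) (ι-cong (w*g≡a u v))

    -- Cauchy–Schwarz for Σ_e x_u x_v = Σ_e √w · (x_u x_v / √w), with the defects of
    -- both inequalities of the argument made explicit.
    defects : ∑∑ term + W * W * Q y ≈ W * (N * N) * (W + - (lam * lam))
    defects = begin
      ∑∑ term + W * W * Q y
        ≈⟨ +-congʳ (trans (∑∑-cong term-expand) (trans (∑∑-+ _ _) (+-cong
             (trans (∑∑-+ _ _) (+-cong (∑∑-* (W * W) _) (trans (∑∑-* (- (W * L + W * L)) _) (*-congˡ rayleigh))))
             (∑∑-* (L * L) _)))) ⟩
      ((W * W * S + - (W * L + W * L) * L) + L * L * W) + W * W * Q y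
        ≈⟨ solve 4 (λ W S L q → ((W :* W :* S :+ :- (W :* L :+ W :* L) :* L) :+ L :* L :* W) :+ W :* W :* q
             := W :* W :* (S :+ q) :+ :- (W :* (L :* L))) refl W S L (Q y) ⟩
      W * W * (S + Q y) + - (W * (L * L))
        ≈⟨ +-congʳ (*-congˡ ∑∑gpp) ⟩
      W * W * (N * N) + - (W * (lam * N * (lam * N)))
        ≈⟨ solve 3 (λ W N l → W :* W :* (N :* N) :+ :- (W :* (l :* N :* (l :* N)))
             := W :* (N :* N) :* (W :+ :- (l :* l))) refl W N lam ⟩
      W * (N * N) * (W + - (lam * lam)) ∎
      where
      S = ∑∑ λ u v → ι (g u v) * (p u v * p u v)

    WWQ-nonNeg : 0# ≤ W * W * Q y
    WWQ-nonNeg = *-nonNeg (square-nonNeg W) (copositive y-nonNeg)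

    ∑∑term-nonNeg : 0# ≤ ∑∑ term
    ∑∑term-nonNeg = ∑∑-nonNeg term term-nonNeg

    eigenvalue² : ∀ {u v} → Adj u v → ¬ (∀ i → x i ≈ 0#) → lam * lam ≤ W
    eigenvalue² uv x≉0 = 0≤-⇒≤ (*-cancelˡ-nonNeg
      (*-nonNeg W-nonNeg (square-nonNeg N)) (*-≉0 (W≉0 uv) (*-≉0 (N≉0 x≉0) (N≉0 x≉0)))
      (≤-respʳ defects (+-nonNeg ∑∑term-nonNeg WWQ-nonNeg)))

    module Equality {u₀ v₀} (u₀v₀ : Adj u₀ v₀) (x≉0 : ¬ (∀ i → x i ≈ 0#)) (lam²≈W : lam * lam ≈ W) where

      defects≈0 : ∑∑ term + W * W * Q y ≈ 0#
      defects≈0 = trans defects (trans (*-congˡ (trans (+-congˡ (-‿cong lam²≈W)) (-‿inverseʳ W))) (zeroʳ _))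

      Qy≈0 : Q y ≈ 0#
      Qy≈0 = zeroDivisorFree (*-≉0 (W≉0 u₀v₀) (W≉0 u₀v₀)) (+-nonNeg-≈0ʳ ∑∑term-nonNeg WWQ-nonNeg defects≈0)

      L≉0 : ¬ (L ≈ 0#)
      L≉0 = *-≉0 (λ lam≈0 → W≉0 u₀v₀ (trans (sym lam²≈W) (trans (*-congʳ lam≈0) (zeroˡ lam)))) (N≉0 x≉0)

      edge-equation : ∀ {u v} → Adj u v → ι (g u v) * (W * p u v) ≈ L
      edge-equation {u} {v} uv = begin
        ι (g u v) * (W * p u v)          ≈⟨ solve 2 (λ a l → a := (a :+ :- l) :+ l) refl _ L ⟩
        deviation u v + L                ≈⟨ +-congʳ (square≈0⇒≈0 (zeroDivisorFree (w-adj≢0 uv ∘ ι-0⇒≡0)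
                                             (∑∑-nonNeg-≈0 term term-nonNeg (+-nonNeg-≈0ˡ ∑∑term-nonNeg WWQ-nonNeg defects≈0) u v))) ⟩
        0# + L                           ≈⟨ +-identityˡ L ⟩
        L                                ∎

      nonisolated⇒x≉0 : ∀ {u v} → Adj u v → ¬ (x u ≈ 0#)
      nonisolated⇒x≉0 {u} {v} uv xu≈0 = L≉0 (trans (sym (edge-equation uv))
        (trans (*-congˡ (trans (*-congˡ (trans (*-congʳ xu≈0) (zeroˡ _))) (zeroʳ _))) (zeroʳ _)))

      nonisolated⇒y≉0 : ∀ {u v} → Adj u v → ¬ (y u ≈ 0#)
      nonisolated⇒y≉0 uv = *-≉0 (nonisolated⇒x≉0 uv) (nonisolated⇒x≉0 uv)

      twins : ∀ {u v z v′} → ¬ Adj u v → Adj u z → Adj v v′ → h u z ≡ h v z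
      twins {z = z} ¬uv uz vv′ = zero-twins y-nonNeg Qy≈0 ¬uv z
        (nonisolated⇒y≉0 uz) (nonisolated⇒y≉0 vv′) (nonisolated⇒y≉0 (adj-sym uz))

      -- On edges h is at most 0, elsewhere it is 1; equal entries of h therefore mean equal
      -- adjacency. The vertex v′ only witnesses that v is not isolated.
      nonadjacent-transfer : ∀ {u v z v′} → ¬ Adj u v → Adj u z → Adj v v′ → Adj v z
      nonadjacent-transfer ¬uv uz vv′ = h≢1⇒adj λ h≡1 → h-adj≢1 uz (≡.trans (twins ¬uv uz vv′) h≡1)

      -- The edge equations at uz and vz have the same right-hand side L, and with equal g the
      -- nonzero factor g W x_z cancels. This compares x itself, with its sign.
      x-equal : ∀ {u v z} → Adj u z → Adj v z → h u z ≡ h v z → x u ≈ x v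
      x-equal {u} {v} {z} uz vz h≡ = *-cancelˡ (*-≉0 k≉0 (nonisolated⇒x≉0 (adj-sym uz))) (begin
        ι (g u z) * W * x z * x u        ≈⟨ solve 4 (λ g w z u → g :* w :* z :* u := g :* (w :* (u :* z))) refl _ W (x z) (x u) ⟩
        ι (g u z) * (W * (x u * x z))    ≈⟨ edge-equation uz ⟩
        L                                ≈⟨ edge-equation vz ⟨
        ι (g v z) * (W * (x v * x z))    ≈⟨ *-congʳ (ι-cong (≡.cong (ℚ._-_ 1ℚ) h≡)) ⟨
        ι (g u z) * (W * (x v * x z))    ≈⟨ solve 4 (λ g w z u → g :* w :* z :* u := g :* (w :* (u :* z))) refl _ W (x z) (x v) ⟨
        ι (g u z) * W * x z * x v        ∎)
        where
        k≉0 : ¬ (ι (g u z) * W ≈ 0#)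
        k≉0 eq = L≉0 (trans (sym (edge-equation uz)) (trans (sym (*-assoc _ _ _)) (trans (*-congʳ eq) (zeroˡ _))))

-- From transitive nonadjacency to a complete multipartite graph

module _ {n : ℕ} {P : Fin n → Set} (P? : ∀ v → Dec (P v)) where

  comprehension : Subset n
  comprehension = Vec.tabulate (does ∘ P?)

  ∈-comprehension⁺ : ∀ {v} → P v → v ∈ comprehension
  ∈-comprehension⁺ {v} Pv = Vec.lookup⇒[]= v comprehension
    (≡.trans (Vec.lookup∘tabulate (does ∘ P?) v) (dec-true (P? v) Pv))

  ∈-comprehension⁻ : ∀ {v} → v ∈ comprehension → P v
  ∈-comprehension⁻ {v} v∈ with P? v | ≡.trans (≡.sym (Vec.lookup∘tabulate (does ∘ P?) v)) (Vec.[]=⇒lookup v∈)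
  ... | yes Pv | _  = Pv
  ... | no  _  | ()

module Multipartite {n : ℕ} (G : Graph n) where
  open Graph G
  open CliqueNumber G

  NonIsolated : Fin n → Set
  NonIsolated v = ∃[ w ] Adj v w

  nonIsolated? : ∀ v → Dec (NonIsolated v)
  nonIsolated? v = Fin.any? (adj? v)

  module Classes (2≤ω : 2 ℕ.≤ ω G)
    (transfer : ∀ {u v z} → ¬ Adj u v → Adj u z → NonIsolated v → Adj v z) where

    open MaximumClique enumeratedMaximumClique public

    inClass? : ∀ i v → Dec (NonIsolated v × ¬ Adj (vertex i) v)
    inClass? i v = nonIsolated? v ×-dec ¬? (adj? (vertex i) v)

    -- The vertices of a maximum clique serve as representatives of the nonadjacency classes, so
    -- that the number of classes is ω by construction.
    class : Fin (ω G) → Subset n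
    class i = comprehension (inClass? i)

    ∈class⁺ : ∀ {i v} → NonIsolated v → ¬ Adj (vertex i) v → v ∈ class i
    ∈class⁺ {i} nv ¬iv = ∈-comprehension⁺ (inClass? i) (nv , ¬iv)

    ∈class⁻ : ∀ {i v} → v ∈ class i → NonIsolated v × ¬ Adj (vertex i) v
    ∈class⁻ {i} = ∈-comprehension⁻ (inClass? i)

    other : ∀ {k} → 2 ℕ.≤ k → (i : Fin k) → ∃[ j ] i ≢ j
    other (s≤s (s≤s _)) Fin.zero    = Fin.suc Fin.zero , λ ()
    other (s≤s (s≤s _)) (Fin.suc i) = Fin.zero , λ ()

    vertex-nonIsolated : ∀ i → NonIsolated (vertex i)
    vertex-nonIsolated i = let (j , i≢j) = other 2≤ω i in vertex j , adjacent i≢j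

    vertex∈class : ∀ i → vertex i ∈ class i
    vertex∈class i = ∈class⁺ (vertex-nonIsolated i) (adj-irrefl ≡.refl)

    -- A vertex adjacent to every clique vertex would contradict `maximal`. Adjacency is decidable
    -- and the clique finite, so a nonneighbour can actually be found.
    classOf : ∀ {v} → NonIsolated v → ∃[ i ] v ∈ class i
    classOf {v} nv = let (i , ¬iv) = Fin.¬∀⟶∃¬ (ω G) _ (λ i → adj? (vertex i) v) (maximal v) in
      i , ∈class⁺ nv ¬iv

    -- An edge uv inside the class would be transferred from u to its nonneighbour `vertex i`,
    -- making v a neighbour of `vertex i`.
    ∈class⇒nonadjacent : ∀ {i u v} → u ∈ class i → v ∈ class i → ¬ Adj u v
    ∈class⇒nonadjacent {i} u∈i v∈i uv =
      proj₂ (∈class⁻ v∈i) (transfer (proj₂ (∈class⁻ u∈i) ∘ adj-sym) uv (vertex-nonIsolated i))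

    adjacent⇒ : ∀ {u v} → Adj u v → ∃[ i ] ∃[ j ] (i ≢ j × u ∈ class i × v ∈ class j)
    adjacent⇒ {u} {v} uv =
      let (i , u∈i) = classOf (v , uv)
          (j , v∈j) = classOf (u , adj-sym uv)
      in i , j , (λ i≡j → ∈class⇒nonadjacent u∈i (≡.subst (λ k → v ∈ class k) (≡.sym i≡j) v∈j) uv) , u∈i , v∈j

    -- The clique edge between `vertex i` and `vertex j` is moved one end at a time, each vertex
    -- being replaced by a nonadjacent one: `vertex i` by u, then `vertex j` by v.
    adjacent⇐ : ∀ {i j u v} → i ≢ j → u ∈ class i → v ∈ class j → Adj u v
    adjacent⇐ i≢j u∈i v∈j = let (nu , ¬iu) = ∈class⁻ u∈i ; (nv , ¬jv) = ∈class⁻ v∈j in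
      adj-sym (transfer ¬jv (adj-sym (transfer ¬iu (adjacent i≢j) nu)) nv)

    isCompletePartite : IsCompletePartite+Isolated G (ω G) class
    isCompletePartite = record
      { nonempty = λ i → vertex i , vertex∈class i
      ; disjoint = λ {i} {j} v∈i v∈j → decidable-stable (i Fin.≟ j) λ i≢j →
          adj-irrefl ≡.refl (adjacent⇐ i≢j v∈i v∈j)
      ; adjacent = λ u v → mk⇔ adjacent⇒ λ (i , j , i≢j , u∈i , v∈j) → adjacent⇐ i≢j u∈i v∈j }

  someEdge : 2 ℕ.≤ ω G → ∃[ u ] ∃[ v ] Adj u v
  someEdge 2≤ω = pick 2≤ω enumeratedMaximumClique
    where
    pick : ∀ {k} → 2 ℕ.≤ k → MaximumClique k → ∃[ u ] ∃[ v ] Adj u v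
    pick (s≤s (s≤s _)) Q = _ , _ , MaximumClique.adjacent Q {Fin.zero} {Fin.suc Fin.zero} λ ()

module EqualityCase (K : ArchimedeanRing) {n : ℕ} (G : Graph n) (2≤ω : 2 ℕ.≤ ω G) where
  open Graph G
  open CliqueNumber G
  open Weights
  open WeightMatrices G
  open ArchimedeanRing K
  open ArchimedeanRingProperties K
  open DoubleSums K
  open Spectral K G
  open Multipartite G
  open Solver using (solve; _:=_; _:+_; :-_)
  open import Relation.Binary.Reasoning.Setoid setoid

  module Structure {x : Fin n → Carrier} {lam : Carrier} (eigen : ∀ u → sum (λ v → A u v * x v) ≈ lam * x u)
    (x≉0 : ¬ (∀ i → x i ≈ 0#)) (lam²≈W : lam * lam ≈ W) where

    open Eigenpair eigen
    open Equality (proj₂ (proj₂ (someEdge 2≤ω))) x≉0 lam²≈W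
    open Classes 2≤ω (λ ¬uv uz (_ , vw) → nonadjacent-transfer ¬uv uz vw) public

    module Regular (3≤ω : 3 ℕ.≤ ω G) where

      x-nonadjacent : ∀ {u v} → NonIsolated u → NonIsolated v → ¬ Adj u v → x u ≈ x v
      x-nonadjacent (_ , uz) (_ , vw) ¬uv = x-equal uz (nonadjacent-transfer ¬uv uz vw) (twins ¬uv uz vw)

      h-vertex : ∀ {i j} → i ≢ j → h (vertex i) (vertex j) ≡ ℚ.- excess (ω G)
      h-vertex i≢j = ≡.trans (h-adj (adjacent i≢j))
        (≡.cong (λ k → ℚ.- excess k) (ℕ.≤-antisym (c≤ω _ _) (size≤c _ _)))

      third : ∀ {k} → 3 ℕ.≤ k → (i j : Fin k) → ∃[ l ] (i ≢ l × j ≢ l)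
      third (s≤s (s≤s (s≤s _))) Fin.zero Fin.zero = Fin.suc Fin.zero , (λ ()) , λ ()
      third (s≤s (s≤s (s≤s _))) Fin.zero (Fin.suc Fin.zero) = Fin.suc (Fin.suc Fin.zero) , (λ ()) , λ ()
      third (s≤s (s≤s (s≤s _))) Fin.zero (Fin.suc (Fin.suc _)) = Fin.suc Fin.zero , (λ ()) , λ ()
      third (s≤s (s≤s (s≤s _))) (Fin.suc Fin.zero) Fin.zero = Fin.suc (Fin.suc Fin.zero) , (λ ()) , λ ()
      third (s≤s (s≤s (s≤s _))) (Fin.suc (Fin.suc _)) Fin.zero = Fin.suc Fin.zero , (λ ()) , λ ()
      third (s≤s (s≤s (s≤s _))) (Fin.suc _) (Fin.suc _) = Fin.zero , (λ ()) , λ ()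

      -- Every edge of the maximum clique has c = ω, so a third clique vertex is a common neighbour
      -- with equal entries of h. This is where ω ≥ 3 enters; for ω = 2 the values of x on the two
      -- classes may differ.
      x-vertex : ∀ i j → x (vertex i) ≈ x (vertex j)
      x-vertex i j = let (l , i≢l , j≢l) = third 3≤ω i j in
        x-equal (adjacent i≢l) (adjacent j≢l) (≡.trans (h-vertex i≢l) (≡.sym (h-vertex j≢l)))

      x-constant : ∀ {v} i → NonIsolated v → x v ≈ x (vertex i)
      x-constant i nv = let (j , v∈j) = classOf nv ; (_ , ¬jv) = ∈class⁻ v∈j in
        trans (x-nonadjacent nv (vertex-nonIsolated j) (¬jv ∘ adj-sym)) (x-vertex j i)

      degree : ∀ i → sum (A (vertex i)) ≈ lam
      degree i = *-cancelˡ (nonisolated⇒x≉0 (proj₂ (vertex-nonIsolated i))) (begin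
        x (vertex i) * sum (A (vertex i))             ≈⟨ *-comm _ _ ⟩
        sum (A (vertex i)) * x (vertex i)             ≈⟨ sum-*ʳ (x (vertex i)) (A (vertex i)) ⟩
        sum (λ v → A (vertex i) v * x (vertex i))     ≈⟨ sum-cong (λ v → Ax (adj? (vertex i) v)) ⟨
        sum (λ v → A (vertex i) v * x v)              ≈⟨ eigen (vertex i) ⟩
        lam * x (vertex i)                            ≈⟨ *-comm _ _ ⟩
        x (vertex i) * lam                            ∎)
        where
        Ax : ∀ {v} (d : Dec (Adj (vertex i) v)) →
          (if does d then 1# else 0#) * x v ≈ (if does d then 1# else 0#) * x (vertex i)
        Ax (yes iv) = *-congˡ (x-constant i (_ , adj-sym iv))
        Ax (no _)   = trans (zeroˡ _) (sym (zeroˡ _))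

      -- The neighbours of `vertex i` and class i partition the nonisolated vertices. As `vertex i`
      -- has degree λ, each class has the number of nonisolated vertices minus λ as its order.
      class-complement : ∀ i v → A (vertex i) v + indicator (class i) v ≈ indicator (comprehension nonIsolated?) v
      class-complement i v = cases (adj? (vertex i) v) (nonIsolated? v)
        where
        cases : (d : Dec (Adj (vertex i) v)) → Dec (NonIsolated v) →
          (if does d then 1# else 0#) + indicator (class i) v ≈ indicator (comprehension nonIsolated?) v
        cases (yes iv) _ = trans
          (trans (+-congˡ (indicator-∉ λ v∈i → proj₂ (∈class⁻ v∈i) iv)) (+-identityʳ 1#))
          (sym (indicator-∈ (∈-comprehension⁺ nonIsolated? (_ , adj-sym iv))))
        cases (no ¬iv) (yes nv) = trans
          (trans (+-congˡ (indicator-∈ (∈class⁺ nv ¬iv))) (+-identityˡ 1#))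
          (sym (indicator-∈ (∈-comprehension⁺ nonIsolated? nv)))
        cases (no _) (no ¬nv) = trans
          (trans (+-congˡ (indicator-∉ λ v∈i → ¬nv (proj₁ (∈class⁻ v∈i)))) (+-identityˡ 0#))
          (sym (indicator-∉ (¬nv ∘ ∈-comprehension⁻ nonIsolated?)))

      class-size : ∀ i → lam + ι (fromℕ ∣ class i ∣) ≈ sum (indicator (comprehension nonIsolated?))
      class-size i = begin
        lam + ι (fromℕ ∣ class i ∣)                         ≈⟨ +-cong (sym (degree i)) (sym (sum-indicator (class i))) ⟩
        sum (A (vertex i)) + sum (indicator (class i))      ≈⟨ sum-+ _ _ ⟨
        sum (λ v → A (vertex i) v + indicator (class i) v)  ≈⟨ sum-cong (class-complement i) ⟩
        sum (indicator (comprehension nonIsolated?))        ∎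

      classes-equal : ∀ i j → ∣ class i ∣ ≡ ∣ class j ∣
      classes-equal i j = fromℕ-injective (ι-injective (begin
        ι (fromℕ ∣ class i ∣)                  ≈⟨ solve 2 (λ l s → s := (l :+ s) :+ :- l) refl lam _ ⟩
        (lam + ι (fromℕ ∣ class i ∣)) + - lam  ≈⟨ +-congʳ (trans (class-size i) (sym (class-size j))) ⟩
        (lam + ι (fromℕ ∣ class j ∣)) + - lam  ≈⟨ solve 2 (λ l s → s := (l :+ s) :+ :- l) refl lam _ ⟨
        ι (fromℕ ∣ class j ∣)                  ∎))

-- Eigenvectors of the extremal graphs

module CompleteMultipartite (K : ArchimedeanRing) {n : ℕ} (G : Graph n) {k : ℕ} (class : Fin k → Subset n)
  (partite : IsCompletePartite+Isolated G k class) where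
  open Graph G
  open IsCompletePartite+Isolated partite
  open Weights
  open WeightMatrices G
  open ArchimedeanRing K
  open ArchimedeanRingProperties K
  open DoubleSums K
  open Spectral K G
  open Solver using (solve; _:=_; _:+_; _:*_; :-_; con)
  open import Relation.Binary.Reasoning.Setoid setoid

  χ : Fin k → Fin n → Carrier
  χ i = indicator (class i)

  size : Fin k → Carrier
  size i = ι (fromℕ ∣ class i ∣)

  sum-χ : ∀ i → sum (χ i) ≈ size i
  sum-χ i = sum-indicator (class i)

  size≉0 : ∀ i → ¬ (size i ≈ 0#)
  size≉0 i s≈0 with fromℕ-injective {∣ class i ∣} {0} (ι-0⇒≡0 s≈0)
  ... | eq = ℕ.n≮0 (ℕ.<-≤-trans (x∈p⇒∣p-x∣<∣p∣ (proj₂ (nonempty i))) (ℕ.≤-reflexive eq))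

  χ-∈ : ∀ {i v} → v ∈ class i → ∀ j → χ j v ≈ e i j
  χ-∈ {i} {v} v∈i j = cases (i Fin.≟ j)
    where
    cases : Dec (i ≡ j) → χ j v ≈ e i j
    cases (yes ≡.refl) = trans (indicator-∈ v∈i) (sym (e-≡ i))
    cases (no i≢j)     = trans (indicator-∉ (i≢j ∘ disjoint v∈i)) (sym (e-≢ i≢j))

  sum-χ* : ∀ {i v} → v ∈ class i → ∀ (f : Fin k → Carrier) → sum (λ j → χ j v * f j) ≈ f i
  sum-χ* {i} v∈i f = trans (sum-cong λ j → *-congʳ (χ-∈ v∈i j)) (sum-e i f)

  τ : Fin n → Carrier
  τ v = sum λ i → χ i v

  τ-∈ : ∀ {i v} → v ∈ class i → τ v ≈ 1#
  τ-∈ v∈i = trans (sum-cong λ j → sym (*-identityʳ _)) (sum-χ* v∈i (λ _ → 1#))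

  class? : ∀ v → Dec (∃[ i ] v ∈ class i)
  class? v = Fin.any? λ i → v ∈? class i

  A-adj : ∀ {u v} → Adj u v → A u v ≈ 1#
  A-adj {u} {v} uv = trans (A≈a u v) (trans (ι-cong (a-adj uv)) ι-1)

  A-nonadj : ∀ {u v} → ¬ Adj u v → A u v ≈ 0#
  A-nonadj {u} {v} ¬uv with adj? u v
  ... | yes uv = ⊥-elim (¬uv uv)
  ... | no _   = refl

  nonadjacent : ∀ {i u v} → u ∈ class i → v ∈ class i → ¬ Adj u v
  nonadjacent u∈i v∈i uv = let (j , l , j≢l , u∈j , v∈l) = Equivalence.to (adjacent _ _) uv in
    j≢l (≡.trans (disjoint u∈j u∈i) (disjoint v∈i v∈l))

  -- The decomposition A = τ τᵀ - Σ χ_i χ_iᵀ: all pairs of vertices in classes, minus the pairs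
  -- within one class. The vector τ is 0 at isolated vertices, so these are covered as well.
  A-formula : ∀ u v → A u v + sum (λ i → χ i u * χ i v) ≈ τ u * τ v
  A-formula u v = cases (class? u) (class? v)
    where
    cases : Dec (∃[ i ] u ∈ class i) → Dec (∃[ i ] v ∈ class i) →
      A u v + sum (λ i → χ i u * χ i v) ≈ τ u * τ v
    cases (no u∉) _ = trans
      (+-cong (A-nonadj λ uv → let (i , _ , _ , u∈i , _) = Equivalence.to (adjacent u v) uv in u∉ (i , u∈i))
              (sum-≈0 λ i → trans (*-congʳ (indicator-∉ λ u∈i → u∉ (i , u∈i))) (zeroˡ _)))
      (trans (+-identityˡ 0#) (sym (trans (*-congʳ (sum-≈0 λ i → indicator-∉ λ u∈i → u∉ (i , u∈i))) (zeroˡ _))))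
    cases (yes _) (no v∉) = trans
      (+-cong (A-nonadj λ uv → let (_ , j , _ , _ , v∈j) = Equivalence.to (adjacent u v) uv in v∉ (j , v∈j))
              (sum-≈0 λ i → trans (*-congˡ (indicator-∉ λ v∈i → v∉ (i , v∈i))) (zeroʳ _)))
      (trans (+-identityˡ 0#) (sym (trans (*-congˡ (sum-≈0 λ i → indicator-∉ λ v∈i → v∉ (i , v∈i))) (zeroʳ _))))
    cases (yes (i , u∈i)) (yes (j , v∈j)) =
      trans (A+e≈1 (i Fin.≟ j)) (sym (trans (*-cong (τ-∈ u∈i) (τ-∈ v∈j)) (*-identityˡ 1#)))
      where
      A+e≈1 : Dec (i ≡ j) → A u v + sum (λ l → χ l u * χ l v) ≈ 1#
      A+e≈1 (yes ≡.refl) = trans (+-cong (A-nonadj (nonadjacent u∈i v∈j))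
        (trans (sum-χ* u∈i (λ l → χ l v)) (indicator-∈ v∈j))) (+-identityˡ 1#)
      A+e≈1 (no i≢j) = trans (+-cong (A-adj (Equivalence.from (adjacent u v) (i , j , i≢j , u∈i , v∈j)))
        (trans (sum-χ* u∈i (λ l → χ l v)) (indicator-∉ λ v∈i → i≢j (disjoint v∈i v∈j)))) (+-identityʳ 1#)

  -- Comes from c ≤ ω on every edge. An upper bound on W suffices, because `LargeEigenvalue` asks
  -- for W ≤ μ² and the spectral bound supplies the reverse direction.
  W≤ : ω G ≡ k → W ≤ ι (weight k) * ∑∑ A
  W≤ ω≡k = ≤-respʳ
    (trans (∑∑-cong λ u v → trans (*-comm _ _) (*-congˡ (sym (A≈a u v)))) (∑∑-* (ι (weight k)) A))
    (∑∑-mono λ u v → ≤-respʳ (ι-* (a u v) (weight k)) (ι-mono (w≤a*weight ω≡k u v)))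

  -- A certificate for √W ≤ λ: since λ is the largest eigenvalue, any eigenvalue μ that is at least
  -- √W will do.
  record LargeEigenvalue (μ : Carrier) : Set where
    field
      eigenvector : Fin n → Carrier
      nonzero     : ¬ (∀ v → eigenvector v ≈ 0#)
      eigen       : ∀ u → sum (λ v → A u v * eigenvector v) ≈ μ * eigenvector u
      nonNeg      : 0# ≤ μ
      W≤μ²        : W ≤ μ * μ

  1≉0 : ¬ (1# ≈ 0#)
  1≉0 1≈0 = ℚ.<⇒≢ (ℚ.positive⁻¹ 1ℚ) (≡.sym (ι-0⇒≡0 (trans ι-1 1≈0)))

  module Regular {m} (k≡ : k ≡ suc m) (ω≡k : ω G ≡ k) (i₀ : Fin k) (equal : ∀ i j → ∣ class i ∣ ≡ ∣ class j ∣) where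
    s : Carrier
    s = size i₀

    M : Carrier
    M = ι (fromℕ m)

    -- The common degree of the nonisolated vertices: m = k - 1 other classes of s vertices each.
    μ : Carrier
    μ = M * s

    size≈s : ∀ i → size i ≈ s
    size≈s i = ι-cong (≡.cong fromℕ (equal i i₀))

    k≈ : sum {k} (λ _ → 1#) ≈ 1# + M
    k≈ = ≡.subst (λ k → sum {k} (λ _ → 1#) ≈ 1# + M) (≡.sym k≡) (trans (count (suc m)) (trans (ι-cong (fromℕ-suc m))
      (trans (ι-+ 1ℚ (fromℕ m)) (+-congʳ ι-1))))
      where
      count : ∀ j → sum {j} (λ _ → 1#) ≈ ι (fromℕ j)
      count zero    = trans (reflexive (sum-zero _)) (sym ι-0)
      count (suc j) = trans (reflexive (sum-suc _)) (trans (+-cong (sym ι-1) (count j))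
        (trans (sym (ι-+ 1ℚ (fromℕ j))) (ι-cong (≡.sym (fromℕ-suc j)))))

    sum-τ : sum τ ≈ (1# + M) * s
    sum-τ = begin
      sum τ                                ≈⟨ sum-comm (λ v i → χ i v) ⟩
      sum (λ i → sum (χ i))                ≈⟨ sum-cong (λ i → trans (sum-χ i) (trans (size≈s i) (sym (*-identityˡ s)))) ⟩
      sum {k} (λ _ → 1# * s)               ≈⟨ sum-*ʳ s (λ _ → 1#) ⟨
      sum {k} (λ _ → 1#) * s               ≈⟨ *-congʳ k≈ ⟩
      (1# + M) * s                         ∎

    degree : ∀ u → sum (A u) ≈ μ * τ u
    degree u = begin
      sum (A u)
        ≈⟨ solve 2 (λ a b → a := (a :+ b) :+ :- b) refl _ _ ⟩
      (sum (A u) + s * τ u) + - (s * τ u)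
        ≈⟨ +-congʳ (begin
          sum (A u) + s * τ u
            ≈⟨ +-congˡ (trans (*-comm s (τ u)) (trans (sum-*ʳ s (λ i → χ i u))
                 (trans (sum-cong (λ i → *-congˡ (trans (sym (size≈s i)) (sym (sum-χ i)))))
                 (trans (sum-cong (λ i → sum-*ˡ (χ i u) (χ i))) (sum-comm (λ i v → χ i u * χ i v)))))) ⟩
          sum (A u) + sum (λ v → sum (λ i → χ i u * χ i v))
            ≈⟨ sum-+ _ _ ⟨
          sum (λ v → A u v + sum (λ i → χ i u * χ i v))
            ≈⟨ sum-cong (A-formula u) ⟩
          sum (λ v → τ u * τ v)
            ≈⟨ sum-*ˡ (τ u) τ ⟨
          τ u * sum τ
            ≈⟨ *-congˡ sum-τ ⟩
          τ u * ((1# + M) * s) ∎) ⟩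
      τ u * ((1# + M) * s) + - (s * τ u)
        ≈⟨ +-congʳ (*-congˡ (*-congʳ (+-congʳ (sym ι-1)))) ⟩
      τ u * ((ι 1ℚ + M) * s) + - (s * τ u)
        ≈⟨ solve 3 (λ t m s → t :* ((con 1ℚ :+ m) :* s) :+ :- (s :* t) := m :* s :* t) refl (τ u) M s ⟩
      μ * τ u ∎

    Aτ≈A : ∀ u v → A u v * τ v ≈ A u v
    Aτ≈A u v with adj? u v
    ... | no _   = zeroˡ _
    ... | yes uv = let (_ , _ , _ , _ , v∈j) = Equivalence.to (adjacent u v) uv in trans (*-identityˡ _) (τ-∈ v∈j)

    weight*suc : ι (weight k) * (1# + M) ≈ M
    weight*suc = ≡.subst (λ k → ι (weight k) * (1# + M) ≈ M) (≡.sym k≡) (trans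
      (*-congˡ (trans (+-congʳ (sym ι-1)) (trans (sym (ι-+ 1ℚ (fromℕ m))) (ι-cong (≡.sym (fromℕ-suc m))))))
      (trans (sym (ι-* (weight (suc m)) (fromℕ (suc m)))) (ι-cong (weight-* m))))

    largeEigenvalue : LargeEigenvalue μ
    largeEigenvalue = record
      { eigenvector = τ
      ; nonzero = λ τ≈0 → 1≉0 (trans (sym (τ-∈ (proj₂ (nonempty i₀)))) (τ≈0 (proj₁ (nonempty i₀))))
      ; eigen   = λ u → trans (sum-cong (Aτ≈A u)) (degree u)
      ; nonNeg  = *-nonNeg (ι-nonNeg (fromℕ-nonNeg m)) (ι-nonNeg (fromℕ-nonNeg ∣ class i₀ ∣))
      ; W≤μ²    = ≤-respʳ (begin
          ι (weight k) * ∑∑ A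
            ≈⟨ *-congˡ (trans (sum-cong degree) (trans (sym (sum-*ˡ μ τ)) (*-congˡ sum-τ))) ⟩
          ι (weight k) * (μ * ((1# + M) * s))
            ≈⟨ solve 4 (λ w μ o s → w :* (μ :* (o :* s)) := (w :* o) :* (μ :* s)) refl _ μ (1# + M) s ⟩
          (ι (weight k) * (1# + M)) * (μ * s)
            ≈⟨ *-congʳ weight*suc ⟩
          M * (M * s * s)
            ≈⟨ solve 2 (λ m s → m :* (m :* s :* s) := m :* s :* (m :* s)) refl M s ⟩
          μ * μ ∎) (W≤ ω≡k) }

module CompleteBipartite (K : ArchimedeanRing) {n : ℕ} (G : Graph n) (class : Fin 2 → Subset n)
  (partite : IsCompletePartite+Isolated G 2 class) (ω≡2 : ω G ≡ 2) where
  open IsCompletePartite+Isolated partite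
  open ArchimedeanRing K
  open ArchimedeanRingProperties K
  open DoubleSums K
  open Spectral K G
  open CompleteMultipartite K G class partite
  open Solver using (solve; _:=_; _:+_; _:*_; :-_; con)
  open import Relation.Binary.Reasoning.Setoid setoid

  χ₀ χ₁ : Fin n → Carrier
  χ₀ = χ Fin.zero
  χ₁ = χ (Fin.suc Fin.zero)

  s₀ s₁ : Carrier
  s₀ = size Fin.zero
  s₁ = size (Fin.suc Fin.zero)

  sum₂ : ∀ (f : Fin 2 → Carrier) → sum f ≈ f Fin.zero + f (Fin.suc Fin.zero)
  sum₂ f = trans (reflexive (sum-suc f)) (+-congˡ (trans (reflexive (sum-suc _))
    (trans (+-congˡ (reflexive (sum-zero _))) (+-identityʳ _))))

  A-bipartite : ∀ u v → A u v ≈ χ₀ u * χ₁ v + χ₁ u * χ₀ v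
  A-bipartite u v = begin
    A u v
      ≈⟨ solve 2 (λ a b → a := (a :+ b) :+ :- b) refl _ _ ⟩
    (A u v + sum (λ i → χ i u * χ i v)) + - sum (λ i → χ i u * χ i v)
      ≈⟨ +-cong (trans (A-formula u v) (*-cong (sum₂ _) (sum₂ _))) (-‿cong (sum₂ _)) ⟩
    (χ₀ u + χ₁ u) * (χ₀ v + χ₁ v) + - (χ₀ u * χ₀ v + χ₁ u * χ₁ v)
      ≈⟨ solve 4 (λ a b c d → (a :+ b) :* (c :+ d) :+ :- (a :* c :+ b :* d) := a :* d :+ b :* c)
           refl (χ₀ u) (χ₁ u) (χ₀ v) (χ₁ v) ⟩
    χ₀ u * χ₁ v + χ₁ u * χ₀ v ∎

  indicator-idempotent : ∀ (S : Subset n) v → indicator S v * indicator S v ≈ indicator S v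
  indicator-idempotent S v with v ∈? S
  ... | yes _ = *-identityˡ 1#
  ... | no  _ = zeroˡ 0#

  χ₀χ₁≈0 : ∀ v → χ₀ v * χ₁ v ≈ 0#
  χ₀χ₁≈0 v = cases (v ∈? class Fin.zero)
    where
    cases : Dec (v ∈ class Fin.zero) → χ₀ v * χ₁ v ≈ 0#
    cases (no v∉)  = trans (*-congʳ (indicator-∉ v∉)) (zeroˡ _)
    cases (yes v∈) = trans (*-congˡ (indicator-∉ λ v∈′ → Fin.0≢1+n (disjoint v∈ v∈′))) (zeroʳ _)

  ∑∑A : ∑∑ A ≈ s₀ * s₁ + s₀ * s₁
  ∑∑A = begin
    ∑∑ A                                                       ≈⟨ ∑∑-cong A-bipartite ⟩
    ∑∑ (λ u v → χ₀ u * χ₁ v + χ₁ u * χ₀ v)                     ≈⟨ ∑∑-+ _ _ ⟩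
    ∑∑ (λ u v → χ₀ u * χ₁ v) + ∑∑ (λ u v → χ₁ u * χ₀ v)        ≈⟨ +-cong (∑∑-product χ₀ χ₁) (∑∑-product χ₁ χ₀) ⟩
    sum χ₀ * sum χ₁ + sum χ₁ * sum χ₀                          ≈⟨ +-congˡ (*-comm _ _) ⟩
    sum χ₀ * sum χ₁ + sum χ₀ * sum χ₁                          ≈⟨ +-cong sums sums ⟩
    s₀ * s₁ + s₀ * s₁                                          ∎
    where
    sums : sum χ₀ * sum χ₁ ≈ s₀ * s₁
    sums = *-cong (sum-χ _) (sum-χ _)

  module _ {μ : Carrier} (0≤μ : 0# ≤ μ) (μ²≈ : μ * μ ≈ s₀ * s₁) where

    -- The eigenvector with value √s₁ on class 0 and √s₀ on class 1, scaled by √s₀. After scaling,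
    -- the only root involved is μ = √(s₀ s₁), the root of a rational.
    vector : Fin n → Carrier
    vector v = χ₀ v * μ + χ₁ v * s₀

    A*vector : ∀ u v → A u v * vector v ≈ χ₀ u * s₀ * χ₁ v + χ₁ u * μ * χ₀ v
    A*vector u v = begin
      A u v * vector v
        ≈⟨ *-congʳ (A-bipartite u v) ⟩
      (χ₀ u * χ₁ v + χ₁ u * χ₀ v) * (χ₀ v * μ + χ₁ v * s₀)
        ≈⟨ solve 6 (λ a b c d m s → (a :* d :+ b :* c) :* (c :* m :+ d :* s)
             := (a :* s :* (d :* d) :+ b :* m :* (c :* c)) :+ (a :* m :+ b :* s) :* (c :* d))
             refl (χ₀ u) (χ₁ u) (χ₀ v) (χ₁ v) μ s₀ ⟩
      (χ₀ u * s₀ * (χ₁ v * χ₁ v) + χ₁ u * μ * (χ₀ v * χ₀ v)) + (χ₀ u * μ + χ₁ u * s₀) * (χ₀ v * χ₁ v)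
        ≈⟨ +-cong (+-cong (*-congˡ (indicator-idempotent _ v)) (*-congˡ (indicator-idempotent _ v)))
             (trans (*-congˡ (χ₀χ₁≈0 v)) (zeroʳ _)) ⟩
      (χ₀ u * s₀ * χ₁ v + χ₁ u * μ * χ₀ v) + 0#
        ≈⟨ +-identityʳ _ ⟩
      χ₀ u * s₀ * χ₁ v + χ₁ u * μ * χ₀ v ∎

    largeEigenvalue : LargeEigenvalue μ
    largeEigenvalue = record
      { eigenvector = vector
      ; nonzero = λ vector≈0 → let (v , v∈₁) = nonempty (Fin.suc Fin.zero) in
          size≉0 Fin.zero (begin
            s₀                          ≈⟨ *-identityˡ s₀ ⟨
            1# * s₀                     ≈⟨ +-identityˡ _ ⟨
            0# + 1# * s₀                ≈⟨ +-cong (sym (trans (*-congʳ (indicator-∉ λ v∈₀ → Fin.0≢1+n (disjoint v∈₀ v∈₁))) (zeroˡ μ)))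
                                             (*-congʳ (sym (indicator-∈ v∈₁))) ⟩
            χ₀ v * μ + χ₁ v * s₀        ≈⟨ vector≈0 v ⟩
            0#                          ∎)
      ; eigen = λ u → begin
          sum (λ v → A u v * vector v)
            ≈⟨ trans (sum-cong (A*vector u)) (sum-+ _ _) ⟩
          sum (λ v → χ₀ u * s₀ * χ₁ v) + sum (λ v → χ₁ u * μ * χ₀ v)
            ≈⟨ +-cong (trans (sym (sum-*ˡ _ χ₁)) (*-congˡ (sum-χ _))) (trans (sym (sum-*ˡ _ χ₀)) (*-congˡ (sum-χ _))) ⟩
          χ₀ u * s₀ * s₁ + χ₁ u * μ * s₀
            ≈⟨ +-congʳ (trans (*-assoc _ _ _) (*-congˡ (sym μ²≈))) ⟩
          χ₀ u * (μ * μ) + χ₁ u * μ * s₀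
            ≈⟨ solve 4 (λ a b m s → a :* (m :* m) :+ b :* m :* s := m :* (a :* m :+ b :* s)) refl (χ₀ u) (χ₁ u) μ s₀ ⟩
          μ * vector u ∎
      ; nonNeg = 0≤μ
      ; W≤μ² = ≤-respʳ (begin
          ι (weight 2) * ∑∑ A               ≈⟨ *-congˡ ∑∑A ⟩
          ι (weight 2) * (s₀ * s₁ + s₀ * s₁) ≈⟨ solve 1 (λ z → con (weight 2) :* (z :+ z) := z) refl (s₀ * s₁) ⟩
          s₀ * s₁                           ≈⟨ μ²≈ ⟨
          μ * μ                             ∎) (W≤ ω≡2) }

-- The theorem over a ring with square roots of rationals

record RootedArchimedeanRing : Set₁ where
  field
    archimedeanRing : ArchimedeanRing
  open ArchimedeanRing archimedeanRing
  field
    √        : ℚ → Carrier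
    √-nonNeg : ∀ {p} → 0ℚ ℚ.≤ p → 0# ≤ √ p
    √-square : ∀ {p} → 0ℚ ℚ.≤ p → √ p * √ p ≈ ι p

module SpectralRadius (E : RootedArchimedeanRing) {n : ℕ} (G : Graph n) where
  open RootedArchimedeanRing E
  open ArchimedeanRing archimedeanRing
  open ArchimedeanRingProperties archimedeanRing using (sum; square-cancel-≤; ≤-respˡ; ≤-respʳ; ι-cong)
  open DoubleSums archimedeanRing using (∑∑-ι)
  open Spectral archimedeanRing G
  open Multipartite G using (someEdge)
  open WeightMatrices G using (w; w-nonNeg; 2*edgeSum≡∑∑w)

  IsEigenvalue : Carrier → Set
  IsEigenvalue μ = Σ[ x ∈ Vector Carrier n ] (¬ (∀ i → x i ≈ 0#) × (∀ u → sum (λ v → A u v * x v) ≈ μ * x u))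

  q : ℚ
  q = (+ 2 ℚ./ 1) ℚ.* edgeSum G

  q≈W : ι q ≈ W
  q≈W = trans (ι-cong 2*edgeSum≡∑∑w) (∑∑-ι w)

  0≤q : 0ℚ ℚ.≤ q
  0≤q = ≡.subst (0ℚ ℚ.≤_) (≡.sym 2*edgeSum≡∑∑w)
    (ListSums.sum-nonNeg _ λ u → ListSums.sum-nonNeg _ (w-nonNeg u))

  √²≈W : √ q * √ q ≈ W
  √²≈W = trans (√-square 0≤q) q≈W

  Extremal : Set
  Extremal = (ω G ≡ 2 × CompleteBipartite+Isolated G) ⊎ (3 ℕ.≤ ω G × CompleteRegularPartite+Isolated G (ω G))

  module _ {lam : Carrier} (isEigenvalue : IsEigenvalue lam) (2≤ω : 2 ℕ.≤ ω G) where
    private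
      x = proj₁ isEigenvalue
      x≉0 = proj₁ (proj₂ isEigenvalue)
      eigen = proj₂ (proj₂ isEigenvalue)

    eigenvalue≤√ : lam ≤ √ q
    eigenvalue≤√ = square-cancel-≤ (√-nonNeg 0≤q) (≤-respʳ (sym √²≈W)
      (Eigenpair.eigenvalue² eigen (proj₂ (proj₂ (someEdge 2≤ω))) x≉0))

    eigenvalue≈√⇒extremal : lam ≈ √ q → Extremal
    eigenvalue≈√⇒extremal lam≈√ = split (ℕ.m≤n⇒m<n∨m≡n 2≤ω)
      where
      lam²≈W = trans (*-cong lam≈√ lam≈√) √²≈W
      open EqualityCase.Structure archimedeanRing G 2≤ω eigen x≉0 lam²≈W
      split : 2 ℕ.< ω G ⊎ 2 ≡ ω G → Extremal
      split (inj₁ 3≤ω) = inj₂ (3≤ω , class , isCompletePartite , Regular.classes-equal 3≤ω)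
      split (inj₂ 2≡ω) = inj₁ (≡.sym 2≡ω ,
        ≡.subst (λ k → ∃[ class ] IsCompletePartite+Isolated G k class) (≡.sym 2≡ω) (class , isCompletePartite))

  module _ {lam : Carrier} (upperBound : ∀ μ → IsEigenvalue μ → μ ≤ lam) where

    largeEigenvalue⇒√≤ : ∀ {k} {class : Fin k → Subset n} {partite : IsCompletePartite+Isolated G k class} {μ} →
      CompleteMultipartite.LargeEigenvalue archimedeanRing G class partite μ → √ q ≤ lam
    largeEigenvalue⇒√≤ {μ = μ} large = ≤-trans
      (square-cancel-≤ nonNeg (≤-respˡ (sym √²≈W) W≤μ²))
      (upperBound μ (eigenvector , nonzero , eigen))
      where open CompleteMultipartite.LargeEigenvalue large

    extremal⇒√≤ : Extremal → √ q ≤ lam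
    extremal⇒√≤ (inj₁ (ω≡2 , class , partite)) = largeEigenvalue⇒√≤
      (CompleteBipartite.largeEigenvalue archimedeanRing G class partite ω≡2
        (√-nonNeg 0≤s₀s₁) (trans (√-square 0≤s₀s₁) (ι-* _ _)))
      where
      0≤s₀s₁ : 0ℚ ℚ.≤ fromℕ ∣ class Fin.zero ∣ ℚ.* fromℕ ∣ class (Fin.suc Fin.zero) ∣
      0≤s₀s₁ = ℚ-Order.*-nonNeg (Weights.fromℕ-nonNeg ∣ class Fin.zero ∣) (Weights.fromℕ-nonNeg ∣ class (Fin.suc Fin.zero) ∣)
    extremal⇒√≤ (inj₂ (3≤ω , class , partite , equal)) = largeEigenvalue⇒√≤
      (CompleteMultipartite.Regular.largeEigenvalue archimedeanRing G class partite
        -- This sets m = ω - 1; the reference class i₀ is the one with index 0.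
        (≡.sym (ℕ.m+[n∸m]≡n {1} 1≤ω)) ≡.refl (Fin.fromℕ< 1≤ω) equal)
      where
      1≤ω : 1 ℕ.≤ ω G
      1≤ω = ℕ.≤-trans (s≤s z≤n) 3≤ω

  largestEigenvalue-bound : ∀ {lam} → IsEigenvalue lam × (∀ μ → IsEigenvalue μ → μ ≤ lam) → 2 ℕ.≤ ω G →
    (lam ≤ √ ((+ 2 ℚ./ 1) ℚ.* edgeSum G)) × (lam ≈ √ ((+ 2 ℚ./ 1) ℚ.* edgeSum G) ⇔ Extremal)
  largestEigenvalue-bound (isEigenvalue , upperBound) 2≤ω =
    eigenvalue≤√ isEigenvalue 2≤ω ,
    mk⇔ (eigenvalue≈√⇒extremal isEigenvalue 2≤ω)
        (λ extremal → ≤-antisym (eigenvalue≤√ isEigenvalue 2≤ω) (extremal⇒√≤ upperBound extremal))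

-- The Cauchy reals as an Archimedean ring

open import Defs

module ℝ-Properties where
  open ℚ-Order
  open +-*-Solver
  open ℚ.≤-Reasoning

  private
    variable
      x y z u v : ℝ

  pointwise : (∀ n → seq x n ≡ seq y n) → x ≃ y
  pointwise {x} {y} h = mk≃ λ ε 0<ε → 0 , λ n _ → ≡.subst (ℚ._≤ ε)
    (≡.sym (≡.trans (≡.cong (λ q → ℚ.∣ q ℚ.- seq y n ∣) (h n)) (≡.cong ℚ.∣_∣ (ℚ.+-inverseʳ (seq y n)))))
    (ℚ.<⇒≤ 0<ε)

  ≃-refl : x ≃ x
  ≃-refl {x} = pointwise {x} {x} (λ _ → ≡.refl)

  ≃⇒≤ : x ≃ y → x ≤ y
  ≃⇒≤ (mk≃ h) = mk≤ λ ε 0<ε → let (N , k) = h ε 0<ε in N , λ n N≤n → ∣-∣≤⇒≤+ (k n N≤n)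

  ≤-antisym : x ≤ y → y ≤ x → x ≃ y
  ≤-antisym (mk≤ h) (mk≤ k) = mk≃ λ ε 0<ε →
    let (M , p) = h ε 0<ε ; (N , q) = k ε 0<ε
    in M ℕ.⊔ N , λ n ≥n → ≤+⇒∣-∣≤ (p n (ℕ.m⊔n≤o⇒m≤o M N ≥n)) (q n (ℕ.m⊔n≤o⇒n≤o M N ≥n))

  ≃-sym : x ≃ y → y ≃ x
  ≃-sym {x} {y} (mk≃ h) = mk≃ λ ε 0<ε → let (N , k) = h ε 0<ε in N , λ n N≤n →
    ≡.subst (ℚ._≤ ε) (∣-∣-comm (seq x n) (seq y n)) (k n N≤n)

  ≤-trans : x ≤ y → y ≤ z → x ≤ z
  ≤-trans {x} {y} {z} (mk≤ h) (mk≤ k) = mk≤ λ ε 0<ε →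
    let (M , p) = h (½ ℚ.* ε) (half-pos 0<ε) ; (N , q) = k (½ ℚ.* ε) (half-pos 0<ε)
    in M ℕ.⊔ N , λ n ≥n → half-sum {seq x n} {seq y n} {seq z n} (p n (ℕ.m⊔n≤o⇒m≤o M N ≥n)) (q n (ℕ.m⊔n≤o⇒n≤o M N ≥n))

  ≃-trans : x ≃ y → y ≃ z → x ≃ z
  ≃-trans p q = ≤-antisym (≤-trans (≃⇒≤ p) (≃⇒≤ q)) (≤-trans (≃⇒≤ (≃-sym q)) (≃⇒≤ (≃-sym p)))

  +-mono-≤ : x ≤ y → u ≤ v → x + u ≤ y + v
  +-mono-≤ {x} {y} {u} {v} (mk≤ h) (mk≤ k) = mk≤ λ ε 0<ε →
    let (M , p) = h (½ ℚ.* ε) (half-pos 0<ε) ; (N , q) = k (½ ℚ.* ε) (half-pos 0<ε)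
    in M ℕ.⊔ N , λ n ≥n → begin
      seq x n ℚ.+ seq u n
        ≤⟨ ℚ.+-mono-≤ (p n (ℕ.m⊔n≤o⇒m≤o M N ≥n)) (q n (ℕ.m⊔n≤o⇒n≤o M N ≥n)) ⟩
      (seq y n ℚ.+ ½ ℚ.* ε) ℚ.+ (seq v n ℚ.+ ½ ℚ.* ε)
        ≡⟨ solve 3 (λ y v e → (y :+ e) :+ (v :+ e) := (y :+ v) :+ (e :+ e)) ≡.refl (seq y n) (seq v n) (½ ℚ.* ε) ⟩
      (seq y n ℚ.+ seq v n) ℚ.+ (½ ℚ.* ε ℚ.+ ½ ℚ.* ε)
        ≡⟨ ≡.cong (seq y n ℚ.+ seq v n ℚ.+_) (half+half ε) ⟩
      (seq y n ℚ.+ seq v n) ℚ.+ ε ∎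

  +-cong : x ≃ y → u ≃ v → x + u ≃ y + v
  +-cong p q = ≤-antisym (+-mono-≤ (≃⇒≤ p) (≃⇒≤ q)) (+-mono-≤ (≃⇒≤ (≃-sym p)) (≃⇒≤ (≃-sym q)))

  neg-cauchy : ∀ {f} → Cauchy f → Cauchy (λ n → ℚ.- f n)
  neg-cauchy {f} cf ε 0<ε = let (N , h) = cf ε 0<ε in N , λ m n N≤m N≤n →
    ≡.subst (ℚ._≤ ε) (≡.trans (∣-∣-comm (f m) (f n)) (≡.cong ℚ.∣_∣
      (solve 2 (λ x y → y :- x := (:- x) :- (:- y)) ≡.refl (f m) (f n)))) (h m n N≤m N≤n)

  opaque
    neg : ℝ → ℝ
    neg x = mkℝ (λ n → ℚ.- seq x n) (neg-cauchy {seq x} (cauchy x))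

    seq-neg : ∀ x n → seq (neg x) n ≡ ℚ.- seq x n
    seq-neg x n = ≡.refl

  neg-cong : x ≃ y → neg x ≃ neg y
  neg-cong {x} {y} (mk≃ h) = mk≃ λ ε 0<ε → let (N , k) = h ε 0<ε in N , λ n N≤n →
    ≡.subst (ℚ._≤ ε) (≡.trans (∣-∣-comm (seq x n) (seq y n)) (≡.cong ℚ.∣_∣ (≡.trans
      (solve 2 (λ x y → y :- x := (:- x) :- (:- y)) ≡.refl (seq x n) (seq y n))
      (≡.cong₂ ℚ._-_ (≡.sym (seq-neg x n)) (≡.sym (seq-neg y n)))))) (k n N≤n)

  0<bound+1 : ∀ {x A} → ℚ.∣ x ∣ ℚ.≤ A → 0ℚ ℚ.< A ℚ.+ 1ℚ
  0<bound+1 {x} h = ℚ.+-mono-≤-< (ℚ.≤-trans (ℚ.0≤∣p∣ x) h) (ℚ.positive⁻¹ 1ℚ)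

  -- The summand 1 in the second bound makes A + B positive, so that a tolerance ε can be divided by
  -- it.
  *-bound : ∀ x y → ∃[ A ] ∃[ B ] ((∀ n → ℚ.∣ seq x n ∣ ℚ.≤ A) × (∀ n → ℚ.∣ seq y n ∣ ℚ.≤ B) × 0ℚ ℚ.< A ℚ.+ B)
  *-bound x y =
    let (A , f≤A) = bounded (cauchy x)
        (B , g≤B) = bounded (cauchy y)
    in A , B ℚ.+ 1ℚ , f≤A , (λ n → ℚ.≤-trans (g≤B n) (≤+nonNeg (ℚ.<⇒≤ (ℚ.positive⁻¹ 1ℚ)))) ,
       ℚ.+-mono-≤-< (ℚ.≤-trans (ℚ.0≤∣p∣ (seq x 0)) (f≤A 0)) (0<bound+1 (g≤B 0))

  *-cong : x ≃ y → u ≃ v → x * u ≃ y * v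
  *-cong {x} {y} {u} {v} (mk≃ h) (mk≃ k) = mk≃ λ ε 0<ε →
    let (A , B , x≤A , v≤B , 0<A+B) = *-bound x v
        (δ , 0<δ , Cδ≡ε) = divide 0<A+B 0<ε
        (M , p) = h δ 0<δ ; (N , q) = k δ 0<δ
    in M ℕ.⊔ N , λ n ≥n → ℚ.≤-trans
         (∣*-*∣ (seq x n) (seq u n) (seq y n) (seq v n) (x≤A n) (v≤B n)
           (p n (ℕ.m⊔n≤o⇒m≤o M N ≥n)) (q n (ℕ.m⊔n≤o⇒n≤o M N ≥n)))
         (ℚ.≤-reflexive Cδ≡ε)

  *-nonNegℝ : 0ℝ ≤ x → 0ℝ ≤ y → 0ℝ ≤ x * y
  *-nonNegℝ {x} {y} (mk≤ h) (mk≤ k) = mk≤ λ ε 0<ε →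
    let (A , B , x≤A , y≤B , 0<A+B) = *-bound x y
        (δ , 0<δ , Cδ≡ε) = divide 0<A+B 0<ε
        (M , p) = h δ 0<δ ; (N , q) = k δ 0<δ
    in M ℕ.⊔ N , λ n ≥n → ≡.subst (λ e → 0ℚ ℚ.≤ seq x n ℚ.* seq y n ℚ.+ e) Cδ≡ε
         (almost-nonNeg-* (ℚ.<⇒≤ 0<δ) (x≤A n) (y≤B n)
           (p n (ℕ.m⊔n≤o⇒m≤o M N ≥n)) (q n (ℕ.m⊔n≤o⇒n≤o M N ≥n)))

  -- The constructive substitute for trichotomy. The two alternatives overlap, so one rational
  -- comparison against the midpoint ε/2 decides between them, at a stage K beyond which each
  -- sequence stays within ε/8 of its K-th term.
  compare : ∀ x y {ε} → 0ℚ ℚ.< ε → x ≤ y + fromℚ ε ⊎ ∃[ δ ] (0ℚ ℚ.< δ × y + fromℚ δ ≤ x)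
  compare x y {ε} 0<ε = decide (seq x K ℚ.≤? seq y K ℚ.+ ½ ℚ.* ε)
    where
    δ = ½ ℚ.* (½ ℚ.* ε)
    0<δ = half-pos (half-pos 0<ε)
    M = proj₁ (cauchy x (½ ℚ.* δ) (half-pos 0<δ))
    N = proj₁ (cauchy y (½ ℚ.* δ) (half-pos 0<δ))
    K = M ℕ.⊔ N

    near-x : ∀ n → K ℕ.≤ n → ℚ.∣ seq x K ℚ.- seq x n ∣ ℚ.≤ ½ ℚ.* δ
    near-x n K≤n = proj₂ (cauchy x (½ ℚ.* δ) (half-pos 0<δ)) K n (ℕ.m≤m⊔n M N) (ℕ.m⊔n≤o⇒m≤o M N K≤n)

    near-y : ∀ n → K ℕ.≤ n → ℚ.∣ seq y K ℚ.- seq y n ∣ ℚ.≤ ½ ℚ.* δ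
    near-y n K≤n = proj₂ (cauchy y (½ ℚ.* δ) (half-pos 0<δ)) K n (ℕ.m≤n⊔m M N) (ℕ.m⊔n≤o⇒n≤o M N K≤n)

    decide : Dec (seq x K ℚ.≤ seq y K ℚ.+ ½ ℚ.* ε) → x ≤ y + fromℚ ε ⊎ ∃[ δ ] (0ℚ ℚ.< δ × y + fromℚ δ ≤ x)
    decide (yes x≤y) = inj₁ (mk≤ λ η 0<η → K , λ n K≤n → ℚ.≤-trans
      (near-≤ {seq x n} {seq x K} {seq y n} {seq y K} {ε} 0<ε (near-x n K≤n) (near-y n K≤n) x≤y)
      (≤+nonNeg {seq y n ℚ.+ ε} {η} (ℚ.<⇒≤ 0<η)))
    decide (no x≰y) = inj₂ (δ , 0<δ , mk≤ λ η 0<η → K , λ n K≤n → ℚ.≤-trans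
      (near-≥ {seq x n} {seq x K} {seq y n} {seq y K} {ε} (near-x n K≤n) (near-y n K≤n) (ℚ.<⇒≤ (ℚ.≰⇒> x≰y)))
      (≤+nonNeg {seq x n} {η} (ℚ.<⇒≤ 0<η)))

  ≤-limit : (∀ ε → 0ℚ ℚ.< ε → x ≤ y + fromℚ ε) → x ≤ y
  ≤-limit {x} {y} h = mk≤ λ ε 0<ε →
    let (N , k) = _≤_.below (h (½ ℚ.* ε) (half-pos 0<ε)) (½ ℚ.* ε) (half-pos 0<ε)
    in N , λ n N≤n → ℚ.≤-trans (k n N≤n) (ℚ.≤-reflexive
         (≡.trans (ℚ.+-assoc (seq y n) _ _) (≡.cong (seq y n ℚ.+_) (half+half ε))))

  x+δ≰x : ∀ {δ} → 0ℚ ℚ.< δ → ¬ (x + fromℚ δ ≤ x)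
  x+δ≰x {x} {δ} 0<δ (mk≤ h) = let (N , k) = h (½ ℚ.* δ) (half-pos 0<δ) in ℚ.<-irrefl ≡.refl (begin-strict
    ½ ℚ.* δ               ≡⟨ ℚ.+-identityˡ _ ⟨
    0ℚ ℚ.+ ½ ℚ.* δ        <⟨ ℚ.+-monoˡ-< (½ ℚ.* δ) (half-pos 0<δ) ⟩
    ½ ℚ.* δ ℚ.+ ½ ℚ.* δ   ≡⟨ solve 2 (λ x d → con ½ :* d :+ con ½ :* d := (x :+ d) :- x) ≡.refl (seq x N) δ ⟩
    seq x N ℚ.+ δ ℚ.- seq x N ≤⟨ ≤+⇒-≤ (k N ℕ.≤-refl) ⟩
    ½ ℚ.* δ ∎)

  x≤x+δ : ∀ {δ} → 0ℚ ℚ.≤ δ → x ≤ x + fromℚ δ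
  x≤x+δ {x} 0≤δ = mk≤ λ ε 0<ε → 0 , λ n _ → ℚ.≤-trans (≤+nonNeg {seq x n} 0≤δ) (≤+nonNeg (ℚ.<⇒≤ 0<ε))

  -- For each ε, `compare` either gives x ≤ y + ε or a definite gap y + δ ≤ x. The gap refutes x ≤
  -- y, which contradicts the double negation.
  ≤-stable : ¬ ¬ (x ≤ y) → x ≤ y
  ≤-stable {x} {y} ¬¬x≤y = ≤-limit λ ε 0<ε → [ (λ h → h) , (λ (δ , 0<δ , y+δ≤x) →
    ⊥-elim (¬¬x≤y λ x≤y → x+δ≰x 0<δ (≤-trans y+δ≤x x≤y))) ]′ (compare x y 0<ε)

  ≰⇒≥ : ¬ (x ≤ y) → y ≤ x
  ≰⇒≥ {x} {y} x≰y = ≤-limit λ ε 0<ε → [ (λ h → h) , (λ (δ , 0<δ , x+δ≤y) →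
    ⊥-elim (x≰y (≤-trans (x≤x+δ (ℚ.<⇒≤ 0<δ)) x+δ≤y))) ]′ (compare y x 0<ε)

  isCommutativeRing : IsCommutativeRing _≃_ _+_ _*_ neg 0ℝ 1ℝ
  isCommutativeRing = record
    { isRing = record
      { +-isAbelianGroup = record
        { isGroup = record
          { isMonoid = record
            { isSemigroup = record
              { isMagma = record { isEquivalence = isEquivalence ; ∙-cong = λ {x} {y} {u} {v} → +-cong {x} {y} {u} {v} }
              ; assoc = λ x y z → pointwise {(x + y) + z} {x + (y + z)} λ n → ℚ.+-assoc (seq x n) (seq y n) (seq z n) }
            ; identity = (λ x → pointwise {0ℝ + x} {x} λ n → ℚ.+-identityˡ (seq x n))
                       , (λ x → pointwise {x + 0ℝ} {x} λ n → ℚ.+-identityʳ (seq x n)) }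
          ; inverse = (λ x → pointwise {neg x + x} {0ℝ} λ n → ≡.trans (≡.cong (ℚ._+ seq x n) (seq-neg x n)) (ℚ.+-inverseˡ (seq x n)))
                    , (λ x → pointwise {x + neg x} {0ℝ} λ n → ≡.trans (≡.cong (seq x n ℚ.+_) (seq-neg x n)) (ℚ.+-inverseʳ (seq x n)))
          ; ⁻¹-cong = λ {x} {y} → neg-cong {x} {y} }
        ; comm = λ x y → pointwise {x + y} {y + x} λ n → ℚ.+-comm (seq x n) (seq y n) }
      ; *-cong = λ {x} {y} {u} {v} → *-cong {x} {y} {u} {v}
      ; *-assoc = λ x y z → pointwise {(x * y) * z} {x * (y * z)} λ n → ℚ.*-assoc (seq x n) (seq y n) (seq z n)
      ; *-identity = (λ x → pointwise {1ℝ * x} {x} λ n → ℚ.*-identityˡ (seq x n))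
                   , (λ x → pointwise {x * 1ℝ} {x} λ n → ℚ.*-identityʳ (seq x n))
      ; distrib = (λ x y z → pointwise {x * (y + z)} {x * y + x * z} λ n → ℚ.*-distribˡ-+ (seq x n) (seq y n) (seq z n))
                , (λ x y z → pointwise {(y + z) * x} {y * x + z * x} λ n → ℚ.*-distribʳ-+ (seq x n) (seq y n) (seq z n)) }
    ; *-comm = λ x y → pointwise {x * y} {y * x} λ n → ℚ.*-comm (seq x n) (seq y n) }
    where
    isEquivalence : IsEquivalence _≃_
    isEquivalence = record { refl = ≃-refl ; sym = ≃-sym ; trans = ≃-trans }

  -- Conversion checking of two sums or products in the η-record ℝ descends into their
  -- Cauchy proofs and does not terminate in practice; the opaque copies prevent this.
  infixl 6 _⊕_
  infixl 7 _⊗_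

  opaque
    _⊕_ _⊗_ : ℝ → ℝ → ℝ
    x ⊕ y = x + y
    x ⊗ y = x * y

    ⊕≡+ : ∀ x y → x ⊕ y ≡ x + y
    ⊕≡+ x y = ≡.refl

    ⊗≡* : ∀ x y → x ⊗ y ≡ x * y
    ⊗≡* x y = ≡.refl

    ⊕-⊗-isCommutativeRing : IsCommutativeRing _≃_ _⊕_ _⊗_ neg 0ℝ 1ℝ
    ⊕-⊗-isCommutativeRing = isCommutativeRing

  commutativeRing : CommutativeRing 0ℓ 0ℓ
  commutativeRing = record { isCommutativeRing = ⊕-⊗-isCommutativeRing }

  fromℚ-mono : ∀ {p q} → p ℚ.≤ q → fromℚ p ≤ fromℚ q
  fromℚ-mono p≤q = mk≤ λ ε 0<ε → 0 , λ n _ → ℚ.≤-trans p≤q (≤+nonNeg (ℚ.<⇒≤ 0<ε))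

  fromℚ-injective : ∀ {p q} → fromℚ p ≃ fromℚ q → p ≡ q
  fromℚ-injective {p} {q} p≃q = ℚ.≤-antisym (cancel (≃⇒≤ p≃q)) (cancel (≃⇒≤ (≃-sym p≃q)))
    where
    cancel : ∀ {p q} → fromℚ p ≤ fromℚ q → p ℚ.≤ q
    cancel {p} {q} h with p ℚ.≤? q
    ... | yes p≤q = p≤q
    ... | no  p≰q = ⊥-elim (x+δ≰x {fromℚ q} 0<δ (≤-trans (≃⇒≤ (pointwise λ n →
            solve 2 (λ p q → q :+ (p :- q) := p) ≡.refl p q)) h))
      where
      0<δ : 0ℚ ℚ.< p ℚ.- q
      0<δ = ℚ.≤-<-trans (ℚ.≤-reflexive (≡.sym (ℚ.+-inverseʳ q))) (ℚ.+-monoˡ-< (ℚ.- q) (ℚ.≰⇒> p≰q))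

  ℝ-archimedeanRing : ArchimedeanRing
  ℝ-archimedeanRing = record
    { commutativeRing = commutativeRing
    ; _≤_ = _≤_
    ; ≤-reflexive = ≃⇒≤
    ; ≤-trans = ≤-trans
    ; ≤-antisym = ≤-antisym
    ; ≤-stable = ≤-stable
    ; ≰⇒≥ = ≰⇒≥
    ; +-mono-≤ = λ {x} {y} {u} {v} x≤y u≤v →
        ≡.subst₂ _≤_ (≡.sym (⊕≡+ x u)) (≡.sym (⊕≡+ y v)) (+-mono-≤ x≤y u≤v)
    ; *-nonNeg = λ {x} {y} 0≤x 0≤y → ≡.subst (0ℝ ≤_) (≡.sym (⊗≡* x y)) (*-nonNegℝ 0≤x 0≤y)
    ; ι = fromℚ
    ; ι-+ = λ p q → ≡.subst (fromℚ (p ℚ.+ q) ≃_) (≡.sym (⊕≡+ (fromℚ p) (fromℚ q))) (pointwise λ _ → ≡.refl)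
    ; ι-* = λ p q → ≡.subst (fromℚ (p ℚ.* q) ≃_) (≡.sym (⊗≡* (fromℚ p) (fromℚ q))) (pointwise λ _ → ≡.refl)
    ; ι-neg = λ p → pointwise {fromℚ (ℚ.- p)} {neg (fromℚ p)} λ n → ≡.sym (seq-neg (fromℚ p) n)
    ; ι-0 = ≃-refl {0ℝ}
    ; ι-1 = ≃-refl {1ℝ}
    ; ι-mono = fromℚ-mono
    ; ≤-limit = λ {x} {y} h → ≤-limit λ ε 0<ε → ≡.subst (x ≤_) (⊕≡+ y (fromℚ ε)) (h ε 0<ε)
    ; ι-injective = fromℚ-injective
    }

-- Correctness of the bisection square root

module SquareRoot (q : ℚ) (0≤q : 0ℚ ℚ.≤ q) where
  open ℚ-Order
  open ℚ.≤-Reasoning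
  open +-*-Solver

  private
    lo w : ℕ → ℚ
    lo = √-lower q
    w  = √-width q

  √-lower-nonNeg : ∀ n → 0ℚ ℚ.≤ lo n
  √-lower-nonNeg n = proj₁ (√-nested q (ℕ.≤⇒≤′ (ℕ.z≤n {n})))

  √-lower-square : ∀ n → lo n ℚ.* lo n ℚ.≤ q
  √-lower-square zero = 0≤q
  √-lower-square (suc n)
    with (lo n ℚ.+ w (suc n)) ℚ.* (lo n ℚ.+ w (suc n)) ℚ.≤? q
  ... | yes h = h
  ... | no  _ = √-lower-square n

  √-upper-square : ∀ n → q ℚ.≤ (lo n ℚ.+ w n) ℚ.* (lo n ℚ.+ w n)
  -- The initial interval ends at |q| + 1, and (q + 1)² - q = q² + q + 1.
  √-upper-square zero = 0≤-⇒≤ (begin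
    0ℚ ≤⟨ +-nonNeg (+-nonNeg (*-nonNeg 0≤q 0≤q) 0≤q) (ℚ.<⇒≤ (ℚ.positive⁻¹ 1ℚ)) ⟩
    q ℚ.* q ℚ.+ q ℚ.+ 1ℚ
      ≡⟨ solve 1 (λ q → q :* q :+ q :+ con 1ℚ
           := (con 0ℚ :+ (q :+ con 1ℚ)) :* (con 0ℚ :+ (q :+ con 1ℚ)) :- q) ≡.refl q ⟩
    (0ℚ ℚ.+ (q ℚ.+ 1ℚ)) ℚ.* (0ℚ ℚ.+ (q ℚ.+ 1ℚ)) ℚ.- q
      ≡⟨ ≡.cong (λ x → (0ℚ ℚ.+ (x ℚ.+ 1ℚ)) ℚ.* (0ℚ ℚ.+ (x ℚ.+ 1ℚ)) ℚ.- q) (ℚ.0≤p⇒∣p∣≡p 0≤q) ⟨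
    (lo 0 ℚ.+ w 0) ℚ.* (lo 0 ℚ.+ w 0) ℚ.- q ∎)
  √-upper-square (suc n)
    with (lo n ℚ.+ w (suc n)) ℚ.* (lo n ℚ.+ w (suc n)) ℚ.≤? q
  ... | yes _ = ≡.subst (λ x → q ℚ.≤ x ℚ.* x) (≡.sym (halves q (lo n) n)) (√-upper-square n)
  ... | no  h = ℚ.<⇒≤ (ℚ.≰⇒> h)

  √-nonNeg : 0ℝ ≤ √ q
  √-nonNeg = mk≤ λ ε 0<ε → 0 , λ n _ → ℚ.≤-trans (√-lower-nonNeg n) (≤+nonNeg (ℚ.<⇒≤ 0<ε))

  -- The squares of the two interval ends differ by (2 lo + w) w. Nesting gives lo + w ≤ C for the
  -- initial width C, so this is at most 2 C δ once w ≤ δ.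
  √-upper-square-near : ∀ {δ ε} n → 0ℚ ℚ.≤ δ → (w 0 ℚ.+ w 0) ℚ.* δ ≡ ε → w n ℚ.≤ δ →
    q ℚ.≤ lo n ℚ.* lo n ℚ.+ ε
  √-upper-square-near {δ} {ε} n 0≤δ Cδ≡ε wn≤δ = 0≤-⇒≤ {q} {lo n ℚ.* lo n ℚ.+ ε} (begin
    0ℚ ≤⟨ +-nonNeg (+-nonNeg (+-nonNeg (≤⇒0≤- (√-upper-square n))
            (*-nonNeg (*-nonNeg {1ℚ ℚ.+ 1ℚ} (ℚ.<⇒≤ (ℚ.positive⁻¹ (1ℚ ℚ.+ 1ℚ))) 0≤δ) (≤⇒0≤- lo+w≤C)))
            (*-nonNeg (+-nonNeg (√-lower-nonNeg n) (+-nonNeg (√-lower-nonNeg n) (ℚ.<⇒≤ (√-width-pos q n)))) (≤⇒0≤- wn≤δ)))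
            (*-nonNeg (ℚ.<⇒≤ (√-width-pos q n)) 0≤δ) ⟩
    ((lo n ℚ.+ w n) ℚ.* (lo n ℚ.+ w n) ℚ.- q) ℚ.+ ((1ℚ ℚ.+ 1ℚ) ℚ.* δ) ℚ.* (C ℚ.- (lo n ℚ.+ w n))
      ℚ.+ (lo n ℚ.+ (lo n ℚ.+ w n)) ℚ.* (δ ℚ.- w n) ℚ.+ w n ℚ.* δ
      ≡⟨ solve 5 (λ q l w c d → ((l :+ w) :* (l :+ w) :- q) :+ (con (1ℚ ℚ.+ 1ℚ) :* d) :* (c :- (l :+ w))
           :+ (l :+ (l :+ w)) :* (d :- w) :+ w :* d := l :* l :+ (c :+ c) :* d :- q) ≡.refl q (lo n) (w n) C δ ⟩
    lo n ℚ.* lo n ℚ.+ (C ℚ.+ C) ℚ.* δ ℚ.- q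
      ≡⟨ ≡.cong (λ e → lo n ℚ.* lo n ℚ.+ e ℚ.- q) Cδ≡ε ⟩
    lo n ℚ.* lo n ℚ.+ ε ℚ.- q ∎)
    where
    C = w 0
    lo+w≤C : lo n ℚ.+ w n ℚ.≤ C
    lo+w≤C = ℚ.≤-trans (proj₂ (√-nested q (ℕ.≤⇒≤′ (ℕ.z≤n {n})))) (ℚ.≤-reflexive (ℚ.+-identityˡ C))

  √-width-antitone : ∀ {N n} → N ℕ.≤ n → w n ℚ.≤ w N
  √-width-antitone {N} {n} N≤n = 0≤-⇒≤ {w n} {w N} (begin
    0ℚ ≤⟨ +-nonNeg (≤⇒0≤- (proj₁ nested)) (≤⇒0≤- (proj₂ nested)) ⟩
    (lo n ℚ.- lo N) ℚ.+ ((lo N ℚ.+ w N) ℚ.- (lo n ℚ.+ w n))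
      ≡⟨ solve 4 (λ a b c d → (a :- b) :+ ((b :+ c) :- (a :+ d)) := c :- d) ≡.refl (lo n) (lo N) (w N) (w n) ⟩
    w N ℚ.- w n ∎)
    where nested = √-nested q (ℕ.≤⇒≤′ N≤n)

  √-square : √ q * √ q ≃ fromℚ q
  √-square = ℝ-Properties.≤-antisym
    (mk≤ λ ε 0<ε → 0 , λ n _ → ℚ.≤-trans (√-lower-square n) (≤+nonNeg (ℚ.<⇒≤ 0<ε)))
    (mk≤ λ ε 0<ε →
      let (δ , 0<δ , Cδ≡ε) = divide (ℚ.+-mono-≤-< (ℚ.<⇒≤ (√-width-pos q 0)) (√-width-pos q 0)) 0<ε
          (N , wN≤δ) = √-width-small q 0<δ
      in N , λ n N≤n → √-upper-square-near n (ℚ.<⇒≤ 0<δ) Cδ≡ε (ℚ.≤-trans (√-width-antitone N≤n) wN≤δ))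

-- Transfer to the concrete real matrices

foldr-cong-op : ∀ {A : Set} {_∙_ _⋆_ : A → A → A} → (∀ x y → x ∙ y ≡ x ⋆ y) →
  ∀ {n} z (f : Fin n → A) → foldr _∙_ z f ≡ foldr _⋆_ z f
foldr-cong-op eq {zero}  z f = ≡.refl
foldr-cong-op {_⋆_ = _⋆_} eq {suc n} z f = ≡.trans (eq _ _) (≡.cong (f Fin.zero ⋆_) (foldr-cong-op eq z (f ∘ Fin.suc)))

ℝ-rootedArchimedeanRing : RootedArchimedeanRing
ℝ-rootedArchimedeanRing = record
  { archimedeanRing = ℝ-Properties.ℝ-archimedeanRing
  ; √        = √
  ; √-nonNeg = λ {p} 0≤p → SquareRoot.√-nonNeg p 0≤p
  ; √-square = λ {p} 0≤p → ≡.subst (_≃ fromℚ p) (≡.sym (ℝ-Properties.⊗≡* (√ p) (√ p))) (SquareRoot.√-square p 0≤p) }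

open ℝ-Properties using (ℝ-archimedeanRing; _⊗_; ⊕≡+; ⊗≡*; ≃-refl)
open ArchimedeanRing ℝ-archimedeanRing using (trans; sym; reflexive; *-congʳ)
open ArchimedeanRingProperties ℝ-archimedeanRing using (sum; sum≡; sum-cong)

-- The matrix product folds with `_+_`, whereas the ring adds with its opaque copy `_⊕_`; the two
-- folds agree only propositionally.
foldr≃sum : ∀ {n} (f : Fin n → ℝ) → foldr _+_ 0ℝ f ≃ sum f
foldr≃sum f = reflexive (≡.trans (foldr-cong-op (λ x y → ≡.sym (⊕≡+ x y)) 0ℝ f) (≡.sym (sum≡ f)))

*≃⊗ : ∀ {x y} z → x ≃ y → x * z ≃ y ⊗ z
*≃⊗ {x} {y} z x≃y = ≡.subst (_≃ y ⊗ z) (⊗≡* x z) (*-congʳ x≃y)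

module _ {n : ℕ} {M M′ : Matrix n} (M≃M′ : ∀ u v → M u v ≃ M′ u v) where

  ·≃sum : ∀ x u → (M · x) u ≃ sum (λ v → M′ u v ⊗ x v)
  ·≃sum x u = trans (foldr≃sum (λ v → M u v * x v)) (sum-cong λ v → *≃⊗ (x v) (M≃M′ u v))

  -- Being an eigenvalue, in the operations of the abstract ring. Both directions of the translation
  -- are used: one for λ itself, the other for the competitors μ in its maximality.
  IsEigenvalue⊗ : ℝ → Set
  IsEigenvalue⊗ μ = Σ[ x ∈ Vector ℝ n ] (¬ (∀ i → x i ≃ 0ℝ) × (∀ u → sum (λ v → M′ u v ⊗ x v) ≃ μ ⊗ x u))

  IsEigenvalue⇒⊗ : ∀ μ → IsEigenvalue M μ → IsEigenvalue⊗ μ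
  IsEigenvalue⇒⊗ μ (x , x≄0 , eigen) = x , x≄0 , λ u →
    trans (sym (·≃sum x u)) (trans (eigen u) (reflexive (≡.sym (⊗≡* μ (x u)))))

  IsEigenvalue⊗⇒ : ∀ μ → IsEigenvalue⊗ μ → IsEigenvalue M μ
  IsEigenvalue⊗⇒ μ (x , x≄0 , eigen) = x , x≄0 , λ u →
    trans (·≃sum x u) (trans (eigen u) (reflexive (⊗≡* μ (x u))))

adjacencyMatrix≃A : ∀ {n} (G : Graph n) u v → adjacencyMatrix G u v ≃ Spectral.A ℝ-archimedeanRing G u v
adjacencyMatrix≃A G u v with Graph.adj? G u v
... | yes _ = ≃-refl
... | no  _ = ≃-refl

theorem3p1 : ∀ {n : ℕ} (G : Graph n) (lam : ℝ) → IsSpectralRadius G lam → 2 ℕ.≤ ω G →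
    (lam ≤ √ ((+ 2 ℚ./ 1) ℚ.* edgeSum G))
    × (lam ≃ √ ((+ 2 ℚ./ 1) ℚ.* edgeSum G)
    ⇔ ((ω G ≡ 2 × CompleteBipartite+Isolated G)
    ⊎ (3 ℕ.≤ ω G × CompleteRegularPartite+Isolated G (ω G))))
theorem3p1 G lam (isEigenvalue , upperBound) = SpectralRadius.largestEigenvalue-bound ℝ-rootedArchimedeanRing G {lam}
  ( IsEigenvalue⇒⊗ {M = adjacencyMatrix G} {M′ = Spectral.A ℝ-archimedeanRing G} (adjacencyMatrix≃A G) lam isEigenvalue
  , λ μ h → upperBound μ (IsEigenvalue⊗⇒ {M = adjacencyMatrix G} {M′ = Spectral.A ℝ-archimedeanRing G} (adjacencyMatrix≃A G) μ h))
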